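{- Fix $n\ge2$ and consider the partition $\theta=(2,1,1,\dots,1,0)$ with $n-1$ nonzero parts and $|\theta|=n$. For $k\ge0$, let $\mathcal C_k$ denote the set of column strict fillings $F$ of shape $k\theta$ with entries in $[n]$, with the property that either $1$ occurs in the first column of $F$ or $1$ does not occur in its last column. Then $$\chi_{\Lambda_0}=\sum_{k\ge0}\ \sum_{F\in\mathcal C_k}\overline{x}^{\,F}\,q^{k^2-\mathrm{inv}(F)}.$$
   Context: For $\gamma=(c_1,\dots,c_n)\in\mathbb Z^n$, $|\gamma|=\sum c_i$, $\lVert\gamma\rVert^2=\sum_{i=1}^nc_i^2-|\gamma|^2/n$ and $x^\gamma=\prod x_i^{c_i}$. $$\chi_{\Lambda_0}:=\frac{\Theta(X_n,q)}{\prod_{k\ge1}(1-q^k)^{n-1}},\qquad\Theta(X_n,q)=\sum_{\gamma\in\mathbb Z^n,\,|\gamma|=0}q^{\lVert\gamma\rVert^2/2}x^\gamma;$$ this is the (normalized) character of the basic representation $L(\Lambda_0)$ of the affine Lie algebra $\widehat{\mathfrak{sl}_n}$. Identities are between formal power series in $q$ with Laurent polynomial coefficients in $x_1,\dots,x_n$. For a partition $\mu$, $\mathrm{dg}(\mu)=\{(r,c):1\le c\le\mu_r\}$ ($r$ = row from the top, $c$ = column from the left); a column strict filling of shape $\mu$ is a map $F:\mathrm{dg}(\mu)\to[n]=\{1,\dots,n\}$ strictly increasing down each column. $x^F=\prod_{c\in\mathrm{dg}(\mu)}x_{F(c)}$ and, for $n$ dividing $|\mu|$, $\overline{x}^{\,F}=x^F(x_1x_2\cdots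 x_n)^{ -|\mu|/n}$. For $k=0$ the shape is empty and $\mathcal C_0$ consists of the single empty filling. For a cell $u=(i,j)$ with $i>1$ let $u^\uparrow=(i-1,j)$; $\mathrm{Des}(F)$ is the set of cells $u$ not in the first row with $F(u)>F(u^\uparrow)$; $\mathrm{arm}(u)$ is the number of cells strictly to the right of $u$ in its row. A cell $u$ Inv-attacks $v$ if they are in the same row with $u$ strictly left of $v$, or $u$ is in the row immediately below that of $v$, in a column strictly to the right of that of $v$. $\mathrm{Inv}(F)$ is the set of pairs $(u,v)$ such that $u$ Inv-attacks $v$ and $F(u)>F(v)$; $\mathrm{inv}(F)=|\mathrm{Inv}(F)|-\sum_{u\in\mathrm{Des}(F)}\mathrm{arm}(u)$. -}

module Defs where

open import Data.Bool.Base using (if_then_else_)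
open import Data.Fin.Base as Fin using (Fin; toℕ)
import Data.Fin.Properties as Fin
open import Data.Integer.Base as ℤ using (ℤ; +_; -[1+_]; 0ℤ; 1ℤ; _⊖_)
import Data.Integer.Properties as ℤ
open import Data.List.Base as List
  using (List; []; _∷_; [_]; _++_; length; filter; allFin; upTo; replicate;
         cartesianProduct; cartesianProductWith)
open import Data.List.Membership.Propositional using (_∈_)
open import Data.List.Membership.Propositional.Properties
  using (∈-allFin; ∈-cartesianProductWith⁺)
open import Data.List.Relation.Unary.All using (All; []; _∷_)
open import Data.List.Relation.Unary.Any using (here)
open import Data.List.Relation.Unary.Unique.Propositional using (Unique)
import Data.List.Relation.Unary.Unique.Propositional.Properties as Unique
import Data.List.Relation.Unary.AllPairs as AllPairs
open import Data.Nat.Base as ℕ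
  using (ℕ; zero; suc; _∸_; _≤_; _<_; NonZero; NonTrivial; nonTrivial⇒nonZero)
import Data.Nat.DivMod as ℕ
import Data.Nat.ListAction as ℕ
import Data.Nat.Properties as ℕ
open import Data.Product.Base using (∃-syntax; _×_; _,_)
open import Data.Rational.Base as ℚ using (ℚ)
import Data.Rational.Properties as ℚ
open import Data.Sum.Base using (_⊎_)
open import Data.Vec.Base as Vec using (Vec; []; _∷_)
import Data.Vec.Properties as Vec
open import Relation.Binary.PropositionalEquality using (_≡_; refl)
open import Relation.Nullary.Decidable
  using (Dec; does; ¬?; _×-dec_; _⊎-dec_; _→-dec_; map′)
open import Relation.Nullary.Negation.Core using (¬_)
open import Relation.Unary using (Decidable)

------------------------------------------------------------------------
-- Finite sums

∑ : {A : Set} → List A → (A → ℤ) → ℤ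
∑ xs f = List.foldr ℤ._+_ 0ℤ (List.map f xs)

infix 5 ∑
syntax ∑ xs (λ x → e) = ∑[ x ∈ xs ] e

⟦_⟧ : {P : Set} → Dec P → ℤ
⟦ p? ⟧ = if does p? then 1ℤ else 0ℤ

------------------------------------------------------------------------
-- Power series in q with integer coefficients

ℤ[[q]] : Set
ℤ[[q]] = ℕ → ℤ

one : ℤ[[q]]
one d = ⟦ d ℕ.≟ 0 ⟧

infixl 7 _⊛_
_⊛_ : ℤ[[q]] → ℤ[[q]] → ℤ[[q]]
(f ⊛ g) d = ∑[ i ∈ upTo (suc d) ] f i ℤ.* g (d ∸ i)

pow : ℤ[[q]] → ℕ → ℤ[[q]]
pow f zero    = one
pow f (suc m) = f ⊛ pow f m

1-q^_ : ℕ → ℤ[[q]]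
(1-q^ k) d = ⟦ d ℕ.≟ 0 ⟧ ℤ.- ⟦ d ℕ.≟ k ⟧

-- ∏_{k=1}^{m} f k
∏≤ : ℕ → (ℕ → ℤ[[q]]) → ℤ[[q]]
∏≤ zero    f = one
∏≤ (suc m) f = ∏≤ m f ⊛ f (suc m)

-- ∏_{k≥1} f k, for factors with f k ≡ 1 mod q^k: those with k > d do not
-- affect the coefficient of q^d.
∏ : (ℕ → ℤ[[q]]) → ℤ[[q]]
∏ f d = ∏≤ d f d

-- The coefficients g_d, …, g_0 of g = 1/f, where f has constant term 1:
-- g_0 = 1 and g_{d+1} = - (f_1 g_d + f_2 g_{d-1} + … + f_{d+1} g_0).
recipCoeffs : ℤ[[q]] → ∀ d → Vec ℤ (suc d)
recipCoeffs f zero    = 1ℤ ∷ []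
recipCoeffs f (suc d) = ℤ.- s ∷ gs
  where
  gs = recipCoeffs f d
  s  = ∑[ i ∈ allFin (suc d) ] f (suc (toℕ i)) ℤ.* Vec.lookup gs i

recip : ℤ[[q]] → ℤ[[q]]
recip f d = Vec.head (recipCoeffs f d)

------------------------------------------------------------------------
-- Series in q with coefficients in Laurent polynomials in x₁, …, xₙ

-- γ stands for the monomial x^γ.
Exponent : ℕ → Set
Exponent n = Vec ℤ n

_≟ᴱ_ : ∀ {n} (γ δ : Exponent n) → Dec (γ ≡ δ)
_≟ᴱ_ = Vec.≡-dec ℤ._≟_

-- A d γ is the coefficient of q^d x^γ.
PowerSeries : ℕ → Set
PowerSeries n = ℕ → Exponent n → ℤ

-- The same with arbitrary integer powers of q.
LaurentSeries : ℕ → Set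
LaurentSeries n = ℤ → Exponent n → ℤ

_/q_ : ∀ {n} → PowerSeries n → ℤ[[q]] → PowerSeries n
(A /q f) d γ = ∑[ i ∈ upTo (suc d) ] recip f i ℤ.* A (d ∸ i) γ

toLaurent : ∀ {n} → PowerSeries n → LaurentSeries n
toLaurent A (+ d)    γ = A d γ
toLaurent A -[1+ _ ] γ = 0ℤ

x^_q^_ : ∀ {n} → Exponent n → ℤ → LaurentSeries n
(x^ γ q^ e) d δ = ⟦ (d ℤ.≟ e) ×-dec (δ ≟ᴱ γ) ⟧

∑ˢ : ∀ {n} {A : Set} → List A → (A → LaurentSeries n) → LaurentSeries n
∑ˢ xs t d γ = ∑[ x ∈ xs ] t x d γ

infix 5 ∑ˢ
syntax ∑ˢ xs (λ x → e) = ∑ˢ[ x ∈ xs ] e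

-- A = ∑_{k≥0} t k, convergence being q-adic: the coefficient of each power
-- of q, negative powers included, is eventually constant in the partial sums.
_≈∑_ : ∀ {n} → LaurentSeries n → (ℕ → LaurentSeries n) → Set
A ≈∑ t = ∀ d → ∃[ K ] (∀ m → K ≤ m → ∀ γ → A d γ ≡ (∑ˢ[ k ∈ upTo m ] t k) d γ)

------------------------------------------------------------------------
-- The character of the basic representation

∣_∣ᴱ : ∀ {n} → Exponent n → ℤ
∣ γ ∣ᴱ = ∑[ c ∈ Vec.toList γ ] c

‖_‖² : ∀ {n} .{{_ : NonZero n}} → Exponent n → ℚ
‖_‖² {n} γ = (∑[ c ∈ Vec.toList γ ] c ℤ.* c) ℚ./ 1 ℚ.- (∣ γ ∣ᴱ ℤ.* ∣ γ ∣ᴱ) ℚ./ n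

module _ (n : ℕ) .{{_ : NonTrivial n}} where

  private instance
    n≢0 : NonZero n
    n≢0 = nonTrivial⇒nonZero n

  Θ : PowerSeries n
  Θ d γ = ⟦ (∣ γ ∣ᴱ ℤ.≟ 0ℤ) ×-dec (‖ γ ‖² ℚ.* ℚ.½ ℚ.≟ (+ d) ℚ./ 1) ⟧

  χΛ₀ : PowerSeries n
  χΛ₀ = Θ /q ∏ (λ k → pow (1-q^ k) (n ∸ 1))

------------------------------------------------------------------------
-- Diagrams and fillings

-- A partition is the list of its parts, in weakly decreasing order and
-- possibly with trailing zeros.
Partition : Set
Partition = List ℕ

-- Rows and columns are numbered from 0.
record Cell (μ : Partition) : Set where
  constructor cell
  field
    r : Fin (length μ)
    c : Fin (List.lookup μ r)

module _ {μ : Partition} where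

  row col : Cell μ → ℕ
  row (cell r c) = toℕ r
  col (cell r c) = toℕ c

  all-cells? : {P : Cell μ → Set} → Decidable P → Dec (∀ u → P u)
  all-cells? P? = map′ (λ f u → f (Cell.r u) (Cell.c u)) (λ f r c → f (cell r c))
    (Fin.all? λ r → Fin.all? λ c → P? (cell r c))

  any-cell? : {P : Cell μ → Set} → Decidable P → Dec (∃[ u ] P u)
  any-cell? P? = map′ (λ (r , c , p) → cell r c , p) (λ (cell r c , p) → r , c , p)
    (Fin.any? λ r → Fin.any? λ c → P? (cell r c))

cells : (μ : Partition) → List (Cell μ)
cells μ = List.concatMap (λ r → List.map (cell r) (allFin (List.lookup μ r)))
                         (allFin (length μ))

-- A map dg(μ) → [n], given by its rows; the entry i ∈ [n] is the element of
-- Fin n with toℕ equal to i - 1.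
Filling : ℕ → Partition → Set
Filling n μ = All (Vec (Fin n)) μ

infix 9 _⟨_⟩
_⟨_⟩ : ∀ {n μ} → Filling n μ → Cell μ → Fin n
(w ∷ F) ⟨ cell Fin.zero c ⟩    = Vec.lookup w c
(w ∷ F) ⟨ cell (Fin.suc r) c ⟩ = F ⟨ cell r c ⟩

words : ∀ n m → List (Vec (Fin n) m)
words n zero    = [ [] ]
words n (suc m) = cartesianProductWith _∷_ (allFin n) (words n m)

fillings : ∀ n μ → List (Filling n μ)
fillings n []      = [ [] ]
fillings n (m ∷ μ) = cartesianProductWith _∷_ (words n m) (fillings n μ)

∈-words : ∀ {n m} (w : Vec (Fin n) m) → w ∈ words n m
∈-words []      = here refl
∈-words (i ∷ w) = ∈-cartesianProductWith⁺ _∷_ (∈-allFin i) (∈-words w)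

∈-fillings : ∀ {n μ} (F : Filling n μ) → F ∈ fillings n μ
∈-fillings []      = here refl
∈-fillings (w ∷ F) = ∈-cartesianProductWith⁺ _∷_ (∈-words w) (∈-fillings F)

words-unique : ∀ n m → Unique (words n m)
words-unique n zero    = [] AllPairs.∷ AllPairs.[]
words-unique n (suc m) = Unique.cartesianProductWith⁺ _∷_ (λ { refl → refl , refl })
  (Unique.allFin⁺ n) (words-unique n m)

fillings-unique : ∀ n μ → Unique (fillings n μ)
fillings-unique n []      = [] AllPairs.∷ AllPairs.[]
fillings-unique n (m ∷ μ) = Unique.cartesianProductWith⁺ _∷_ (λ { refl → refl , refl })
  (words-unique n m) (fillings-unique n μ)

module _ {n : ℕ} {μ : Partition} (F : Filling n μ) where

  ColumnStrict : Set
  ColumnStrict = ∀ u v → col u ≡ col v → row u < row v → F ⟨ u ⟩ Fin.< F ⟨ v ⟩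

  columnStrict? : Dec ColumnStrict
  columnStrict? = all-cells? λ u → all-cells? λ v →
    (col u ℕ.≟ col v) →-dec ((row u ℕ.<? row v) →-dec (F ⟨ u ⟩ Fin.<? F ⟨ v ⟩))

-- x̄^F = x^F (x₁ ⋯ xₙ)^{-|μ|/n}

  x^F : Exponent n
  x^F = Vec.tabulate λ i → + length (filter (λ u → F ⟨ u ⟩ Fin.≟ i) (cells μ))

  x̄^F : .{{_ : NonZero n}} → Exponent n
  x̄^F = Vec.map (ℤ._- + (ℕ.sum μ ℕ./ n)) x^F

------------------------------------------------------------------------
-- Descents and inversions

module _ {μ : Partition} where

  IsAbove : Cell μ → Cell μ → Set
  IsAbove v u = suc (row v) ≡ row u × col v ≡ col u

  isAbove? : ∀ v u → Dec (IsAbove v u)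
  isAbove? v u = (suc (row v) ℕ.≟ row u) ×-dec (col v ℕ.≟ col u)

  arm : Cell μ → ℕ
  arm u = length (filter (λ v → (row v ℕ.≟ row u) ×-dec (col u ℕ.<? col v)) (cells μ))

  InvAttacks : Cell μ → Cell μ → Set
  InvAttacks u v = (row u ≡ row v × col u < col v)
                 ⊎ (row u ≡ suc (row v) × col v < col u)

  invAttacks? : ∀ u v → Dec (InvAttacks u v)
  invAttacks? u v = ((row u ℕ.≟ row v) ×-dec (col u ℕ.<? col v))
             ⊎-dec ((row u ℕ.≟ suc (row v)) ×-dec (col v ℕ.<? col u))

module _ {n : ℕ} {μ : Partition} (F : Filling n μ) where

  -- If μ is a partition, a cell not in the first row has exactly one cell
  -- directly above it.
  IsDescent : Cell μ → Set
  IsDescent u = ∃[ v ] (IsAbove v u × F ⟨ v ⟩ Fin.< F ⟨ u ⟩)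

  isDescent? : Decidable IsDescent
  isDescent? u = any-cell? λ v → isAbove? v u ×-dec (F ⟨ v ⟩ Fin.<? F ⟨ u ⟩)

  Des : List (Cell μ)
  Des = filter isDescent? (cells μ)

  Inv : List (Cell μ × Cell μ)
  Inv = filter (λ (u , v) → invAttacks? u v ×-dec (F ⟨ v ⟩ Fin.<? F ⟨ u ⟩))
               (cartesianProduct (cells μ) (cells μ))

  inv : ℤ
  inv = length Inv ⊖ ℕ.sum (List.map arm Des)

------------------------------------------------------------------------
-- The fillings 𝒞ₖ

-- For n ≥ 2 the last part of (2,1,…,1,0) is the only zero one.
θ : ℕ → Partition
θ n = 2 ∷ replicate (n ∸ 2) 1 ++ 0 ∷ []

infixl 7 _·_
_·_ : ℕ → Partition → Partition
k · μ = List.map (k ℕ.*_) μ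

-- The number of columns: the first part.
width : Partition → ℕ
width []      = 0
width (m ∷ _) = m

module _ {n : ℕ} {μ : Partition} (F : Filling n μ) where

  -- The entry 1 is the one with toℕ equal to 0.
  OneInFirstColumn OneInLastColumn : Set
  OneInFirstColumn = ∃[ u ] (col u ≡ 0 × toℕ (F ⟨ u ⟩) ≡ 0)
  OneInLastColumn  = ∃[ u ] (suc (col u) ≡ width μ × toℕ (F ⟨ u ⟩) ≡ 0)

  In𝒞 : Set
  In𝒞 = ColumnStrict F × (OneInFirstColumn ⊎ ¬ OneInLastColumn)

  in𝒞? : Dec In𝒞
  in𝒞? = columnStrict? F ×-dec
    (any-cell? (λ u → (col u ℕ.≟ 0) ×-dec (toℕ (F ⟨ u ⟩) ℕ.≟ 0))
     ⊎-dec
     ¬? (any-cell? (λ u → (suc (col u) ℕ.≟ width μ) ×-dec (toℕ (F ⟨ u ⟩) ℕ.≟ 0))))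

𝒞 : ∀ n k → List (Filling n (k · θ n))
𝒞 n k = filter in𝒞? (fillings n (k · θ n))

module _ (n : ℕ) .{{_ : NonTrivial n}} where

  private instance
    n≢0′ : NonZero n
    n≢0′ = nonTrivial⇒nonZero n

  -- x̄^F q^{k² - inv F}
  term : ∀ k → Filling n (k · θ n) → LaurentSeries n
  term k F = x^ x̄^F F q^ (+ (k ℕ.^ 2) ℤ.- inv F)

-- A column strict filling F of shape kθ has columns [n] ∖ {a_1}, …, [n] ∖ {a_k}
-- and {b_k}, …, {b_1}, so it amounts to two words a and b of length k. If α and
-- β are their contents, then x̄^F = x^{β-α} and
--   inv F = #{c < d : a_c < a_d} + #{c < d : b_c < b_d} + α_1 β_1,
-- whence, writing ℓ for the number of inversions of a word,
--   k² - inv F = ‖β-α‖²/2 + Σ_{i≥2} α_i β_i + ℓ(a) + ℓ(b).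
-- For k ≥ 1, F is not in 𝒞ₖ if and only if both words start with 1; deleting
-- these two letters changes neither x̄^F nor k² - inv F. Hence the sum over
-- 𝒞₀, …, 𝒞ₘ telescopes to the sum over all pairs of words of length m. By
-- q-multinomial counting, Σ q^{ℓ(a)} over the words a of content α is
-- (q)_m / ∏ (q)_{α_i}. So for m → ∞ the coefficient of x^γ tends to
--   q^{‖γ‖²/2} ∏_{i≥2} Σ_{β-α=γ_i} q^{αβ} / ((q)_α (q)_β),
-- in which each factor is 1/(q)_∞ by dissecting partitions along their Durfee
-- rectangles.

module Submission where

open import Defs
open import Algebra.Bundles using (CommutativeSemiring)
open import Algebra.Structures.Biased using (isCommutativeSemiringˡ; isCommutativeMonoidˡ)
import Algebra.Solver.Ring.NaturalCoefficients.Default as SemiringSolver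
open import Data.Bool.Base using (true; false; if_then_else_)
open import Data.Fin.Base as Fin using (Fin; toℕ; punchIn)
import Data.Fin.Properties as Fin
open import Data.Fin.Relation.Unary.Top using (view; ‵fromℕ; ‵inject₁)
open import Data.Integer.Base as ℤ using (ℤ; +_; -[1+_]; 0ℤ; 1ℤ; _⊖_)
import Data.Integer.Properties as ℤ
import Algebra.Properties.AbelianGroup ℤ.+-0-abelianGroup as ℤGroup
import Data.Integer.Tactic.RingSolver as ℤ
open import Data.List.Base as List
  using (List; []; _∷_; _++_; length; filter; allFin; upTo; replicate;
         cartesianProduct; cartesianProductWith)
import Data.List.Properties as List
open import Data.List.Membership.Propositional using (_∈_)
import Data.List.Membership.Propositional.Properties as ∈
open import Data.List.Relation.Binary.Permutation.Propositional as Perm using (_↭_)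
import Data.List.Membership.Propositional.Properties.WithK as ∈
open import Data.List.Relation.Binary.BagAndSetEquality using (∼bag⇒↭)
open import Data.List.Relation.Unary.All as All using (All; []; _∷_)
open import Data.List.Relation.Unary.AllPairs using ([]; _∷_)
open import Data.List.Relation.Unary.Any using (here; there)
open import Data.List.Relation.Unary.Unique.Propositional using (Unique)
import Data.List.Relation.Unary.Unique.Propositional.Properties as Unique
open import Data.Nat.Base as ℕ
  using (ℕ; zero; suc; _∸_; _≤_; _<_; z≤n; s≤s; NonZero; NonTrivial)
import Data.Nat.DivMod as ℕ
import Data.Nat.ListAction as ℕ
import Data.Nat.Properties as ℕ
import Data.Nat.Tactic.RingSolver as ℕ
open import Data.Product.Base using (∃-syntax; _×_; _,_; proj₁; proj₂; uncurry)
import Data.Rational.Base as ℚ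
import Data.Rational.Properties as ℚ
import Data.Rational.Unnormalised.Base as ℚᵘ
import Data.Rational.Unnormalised.Properties as ℚᵘ
open import Data.Sum.Base using (_⊎_; inj₁; inj₂)
open import Data.Vec.Base as Vec using (Vec; []; _∷_; lookup; updateAt)
import Data.Vec.Properties as Vec
open import Function.Bundles using (mk⇔)
open import Function.Base using (_∘_; id; const; flip)
open import Relation.Binary.Structures using (IsEquivalence)
open import Relation.Binary.PropositionalEquality
  using (_≡_; _≢_; refl; sym; trans; cong; cong₂; subst; subst₂; module ≡-Reasoning)
import Relation.Binary.Reasoning.Setoid as SetoidReasoning
open import Relation.Nullary.Decidable
  using (Dec; yes; no; does; ¬?; _×-dec_; _⊎-dec_; dec-true; dec-false)
open import Relation.Nullary.Negation.Core using (¬_; contradiction)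
open import Relation.Unary using (Decidable)

-- Convergence asks for a K that depends on the power q^d but not on γ. If |γ| = 0, then Σ |c_i| ≤
-- ‖γ‖² because the c_i are integers, so Σ |c_i| ≤ 2d as soon as ‖γ‖²/2 ≤ d. This is the 2d in the
-- threshold d + (n-1)d + 2d for the word length; (n-1)d bounds the common parts of α and β in the
-- letters other than 1, and the remaining d leaves at least d letters 1 in each word, enough to
-- make (q)_m and (q)_{α_1} agree modulo q^{d+1}. Limits are therefore never taken: every identity
-- is a congruence modulo q^{d+1}, in a semiring of series, with (q)_d in the place of (q)_∞. The
-- Durfee identity is obtained without a bijection. Let D_c = Σ_t q^{t(t+c)} / ((q)_t (q)_{t+c}). A
-- comparison of terms gives D_c - D_{c+1} = q^{c+1} (D_{c+2} - D_{c+1}), and for c ≥ d only t = 0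
-- survives, so all D_c agree with 1/(q)_d.

module Sum {c ℓ} (R : CommutativeSemiring c ℓ) where

  open CommutativeSemiring R renaming (refl to ≈-refl; sym to ≈-sym; trans to ≈-trans)
  open SetoidReasoning setoid
  open SemiringSolver R using (solve; _:=_; _:+_; _:*_)

  -- The same manipulations are needed over the integers and over series modulo q^{d+1}, hence an
  -- arbitrary commutative semiring.
  sum : {A : Set} → List A → (A → Carrier) → Carrier
  sum xs f = List.foldr _+_ 0# (List.map f xs)

  [_] : {P : Set} → Dec P → Carrier
  [ p? ] = if does p? then 1# else 0#

  []-yes : {P : Set} (p? : Dec P) → P → [ p? ] ≈ 1#
  []-yes p? p rewrite dec-true p? p = ≈-refl

  []-no : {P : Set} (p? : Dec P) → ¬ P → [ p? ] ≈ 0#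
  []-no p? ¬p rewrite dec-false p? ¬p = ≈-refl

  []-⇔ : {P Q : Set} (p? : Dec P) (q? : Dec Q) → (P → Q) → (Q → P) → [ p? ] ≈ [ q? ]
  []-⇔ (yes p) q? to from = ≈-sym ([]-yes q? (to p))
  []-⇔ (no ¬p) q? to from = ≈-sym ([]-no q? (¬p ∘ from))

  []-× : {P Q : Set} (p? : Dec P) (q? : Dec Q) → [ p? ×-dec q? ] ≈ [ p? ] * [ q? ]
  []-× (yes p) q? = ≈-sym (*-identityˡ _)
  []-× (no ¬p) q? = ≈-sym (zeroˡ _)

  module _ {A : Set} where

    private variable
      f g : A → Carrier

    sum-cong-∈ : ∀ (xs : List A) → (∀ {x} → x ∈ xs → f x ≈ g x) → sum xs f ≈ sum xs g
    sum-cong-∈ []       f≈g = ≈-refl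
    sum-cong-∈ (x ∷ xs) f≈g = +-cong (f≈g (here refl)) (sum-cong-∈ xs (f≈g ∘ there))

    sum-cong : ∀ (xs : List A) → (∀ x → f x ≈ g x) → sum xs f ≈ sum xs g
    sum-cong xs f≈g = sum-cong-∈ xs (λ {x} _ → f≈g x)

    sum-0 : ∀ (xs : List A) → (∀ {x} → x ∈ xs → f x ≈ 0#) → sum xs f ≈ 0#
    sum-0 []       f≈0 = ≈-refl
    sum-0 (x ∷ xs) f≈0 =
      ≈-trans (+-cong (f≈0 (here refl)) (sum-0 xs (f≈0 ∘ there))) (+-identityˡ 0#)

    sum-+ : ∀ (xs : List A) f g → sum xs (λ x → f x + g x) ≈ sum xs f + sum xs g
    sum-+ []       f g = ≈-sym (+-identityˡ 0#)
    sum-+ (x ∷ xs) f g = ≈-trans (+-congˡ (sum-+ xs f g))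
      (solve 4 (λ a b c d → (a :+ b) :+ (c :+ d) := (a :+ c) :+ (b :+ d)) ≈-refl
        (f x) (g x) (sum xs f) (sum xs g))

    *-sum : ∀ a (xs : List A) f → a * sum xs f ≈ sum xs (λ x → a * f x)
    *-sum a []       f = zeroʳ a
    *-sum a (x ∷ xs) f = ≈-trans (distribˡ a _ _) (+-congˡ (*-sum a xs f))

    sum-* : ∀ (xs : List A) f a → sum xs f * a ≈ sum xs (λ x → f x * a)
    sum-* []       f a = zeroˡ a
    sum-* (x ∷ xs) f a = ≈-trans (distribʳ a _ _) (+-congˡ (sum-* xs f a))

    sum-++ : ∀ (xs ys : List A) f → sum (xs ++ ys) f ≈ sum xs f + sum ys f
    sum-++ []       ys f = ≈-sym (+-identityˡ _)
    sum-++ (x ∷ xs) ys f = ≈-trans (+-congˡ (sum-++ xs ys f)) (≈-sym (+-assoc _ _ _))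

    sum-filter : {P : A → Set} (P? : Decidable P) (xs : List A) (f : A → Carrier) →
                 sum (filter P? xs) f ≈ sum xs (λ x → [ P? x ] * f x)
    sum-filter P? []       f = ≈-refl
    sum-filter P? (x ∷ xs) f with does (P? x)
    ... | true  = +-cong (≈-sym (*-identityˡ _)) (sum-filter P? xs f)
    ... | false = ≈-trans (sum-filter P? xs f)
                    (≈-sym (≈-trans (+-congʳ (zeroˡ _)) (+-identityˡ _)))

    sum-↭ : ∀ {xs ys : List A} f → xs ↭ ys → sum xs f ≈ sum ys f
    sum-↭ f Perm.refl         = ≈-refl
    sum-↭ f (Perm.prep x p)   = +-congˡ (sum-↭ f p)
    sum-↭ f (Perm.swap {xs} {ys} x y p) = ≈-trans (+-congˡ (+-congˡ (sum-↭ f p)))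
      (solve 3 (λ a b c → a :+ (b :+ c) := b :+ (a :+ c)) ≈-refl (f x) (f y) (sum ys f))
    sum-↭ f (Perm.trans p q)  = ≈-trans (sum-↭ f p) (sum-↭ f q)

    sum-single : ∀ {xs : List A} {x} f → Unique xs → x ∈ xs →
                 (∀ {y} → y ≢ x → f y ≈ 0#) → sum xs f ≈ f x
    sum-single {x ∷ xs} f (x∉xs ∷ _) (here refl) f≈0 = ≈-trans
      (+-congˡ (sum-0 xs λ y∈xs → f≈0 (All.lookup x∉xs y∈xs ∘ sym))) (+-identityʳ _)
    sum-single {y ∷ xs} f (y∉xs ∷ !xs) (there x∈xs) f≈0 = ≈-trans
      (+-cong (f≈0 (All.lookup y∉xs x∈xs)) (sum-single f !xs x∈xs f≈0)) (+-identityˡ _)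

  module _ {A B : Set} where

    sum-map : ∀ (h : A → B) xs f → sum (List.map h xs) f ≡ sum xs (f ∘ h)
    sum-map h []       f = refl
    sum-map h (x ∷ xs) f = cong (_+_ (f (h x))) (sum-map h xs f)

    sum-concatMap : ∀ (h : A → List B) xs f →
                    sum (List.concatMap h xs) f ≈ sum xs (λ x → sum (h x) f)
    sum-concatMap h []       f = ≈-refl
    sum-concatMap h (x ∷ xs) f = ≈-trans (sum-++ (h x) _ f) (+-congˡ (sum-concatMap h xs f))

    sum-swap : ∀ (xs : List A) (ys : List B) (f : A → B → Carrier) →
               sum xs (λ x → sum ys (f x)) ≈ sum ys (λ y → sum xs (λ x → f x y))
    sum-swap []       ys f = ≈-sym (sum-0 ys (λ _ → ≈-refl))
    sum-swap (x ∷ xs) ys f = ≈-trans (+-congˡ (sum-swap xs ys f)) (≈-sym (sum-+ ys _ _))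

    sum-*-sum : ∀ (xs : List A) (ys : List B) (f : A → Carrier) (g : B → Carrier) →
                sum xs f * sum ys g ≈ sum xs (λ x → sum ys (λ y → f x * g y))
    sum-*-sum xs ys f g = ≈-trans (sum-* xs f _) (sum-cong xs λ x → *-sum _ ys g)

  sum-cartesianProductWith : ∀ {A B C : Set} (h : A → B → C) xs ys f →
    sum (cartesianProductWith h xs ys) f ≈ sum xs (λ x → sum ys (λ y → f (h x y)))
  sum-cartesianProductWith h []       ys f = ≈-refl
  sum-cartesianProductWith h (x ∷ xs) ys f = ≈-trans (sum-++ (List.map (h x) ys) _ f)
    (+-cong (reflexive (sum-map (h x) ys f)) (sum-cartesianProductWith h xs ys f))

  sum-upTo : ∀ n (f : ℕ → Carrier) → sum (upTo (suc n)) f ≡ f 0 + sum (upTo n) (f ∘ suc)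
  sum-upTo n f = cong (_+_ (f 0)) (trans (cong (λ xs → sum xs f) (sym (List.map-applyUpTo id suc n)))
                                        (sum-map suc (upTo n) f))

  sum-upTo-last : ∀ n (f : ℕ → Carrier) → sum (upTo (suc n)) f ≈ sum (upTo n) f + f n
  sum-upTo-last zero    f = +-comm (f 0) 0#
  sum-upTo-last (suc n) f = begin
    sum (upTo (suc (suc n))) f                    ≡⟨ sum-upTo (suc n) f ⟩
    f 0 + sum (upTo (suc n)) (f ∘ suc)            ≈⟨ +-congˡ (sum-upTo-last n (f ∘ suc)) ⟩
    f 0 + (sum (upTo n) (f ∘ suc) + f (suc n))    ≈⟨ +-assoc _ _ _ ⟨
    f 0 + sum (upTo n) (f ∘ suc) + f (suc n)      ≡⟨ cong (_+ f (suc n)) (sum-upTo n f) ⟨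
    sum (upTo (suc n)) f + f (suc n)              ∎

  sum-allFin : ∀ n (f : Fin (suc n) → Carrier) →
               sum (allFin (suc n)) f ≡ f Fin.zero + sum (allFin n) (f ∘ Fin.suc)
  sum-allFin n f = cong (_+_ (f Fin.zero))
    (trans (cong (λ xs → sum xs f) (sym (List.map-tabulate id Fin.suc)))
           (sum-map Fin.suc (allFin n) f))

-- Over the integers `sum` and `[_]` unfold to `∑` and `⟦_⟧`, so the lemmas apply to the sums of the
-- theorem as they stand.
open module ℤΣ = Sum ℤ.+-*-commutativeSemiring using () renaming (sum to ∑ℤ)

-- Power series

monomial : ℕ → ℤ[[q]]
monomial m i = ⟦ i ℕ.≟ m ⟧

tail : ℤ[[q]] → ℤ[[q]]
tail f i = f (suc i)

⊛-zero : ∀ f g → (f ⊛ g) 0 ≡ f 0 ℤ.* g 0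
⊛-zero f g = ℤ.+-identityʳ _

-- This is f g = f₀ g + q (tail f) g. Together with its mirror image `⊛-sucʳ` it reduces
-- commutativity and associativity to induction on the coefficient, with no reindexing of double
-- sums.
⊛-suc : ∀ f g i → (f ⊛ g) (suc i) ≡ f 0 ℤ.* g (suc i) ℤ.+ (tail f ⊛ g) i
⊛-suc f g i = ℤΣ.sum-upTo (suc i) (λ j → f j ℤ.* g (suc i ∸ j))

⊛-sucʳ : ∀ f g i → (f ⊛ g) (suc i) ≡ (f ⊛ tail g) i ℤ.+ f (suc i) ℤ.* g 0
⊛-sucʳ f g zero = begin
  f 0 ℤ.* g 1 ℤ.+ (f 1 ℤ.* g 0 ℤ.+ 0ℤ)  ≡⟨ regroup (f 0 ℤ.* g 1) (f 1 ℤ.* g 0) ⟩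
  f 0 ℤ.* g 1 ℤ.+ 0ℤ ℤ.+ f 1 ℤ.* g 0    ∎
  where
  open ≡-Reasoning
  regroup : ∀ x y → x ℤ.+ (y ℤ.+ 0ℤ) ≡ x ℤ.+ 0ℤ ℤ.+ y
  regroup = ℤ.solve-∀
⊛-sucʳ f g (suc i) = begin
  (f ⊛ g) (2 ℕ.+ i)
    ≡⟨ ⊛-suc f g (suc i) ⟩
  f 0 ℤ.* g (2 ℕ.+ i) ℤ.+ (tail f ⊛ g) (suc i)
    ≡⟨ cong (λ z → f 0 ℤ.* g (2 ℕ.+ i) ℤ.+ z) (⊛-sucʳ (tail f) g i) ⟩
  f 0 ℤ.* g (2 ℕ.+ i) ℤ.+ ((tail f ⊛ tail g) i ℤ.+ f (2 ℕ.+ i) ℤ.* g 0)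
    ≡⟨ ℤ.+-assoc (f 0 ℤ.* g (2 ℕ.+ i)) _ _ ⟨
  f 0 ℤ.* g (2 ℕ.+ i) ℤ.+ (tail f ⊛ tail g) i ℤ.+ f (2 ℕ.+ i) ℤ.* g 0
    ≡⟨ cong (ℤ._+ f (2 ℕ.+ i) ℤ.* g 0) (⊛-suc f (tail g) i) ⟨
  (f ⊛ tail g) (suc i) ℤ.+ f (2 ℕ.+ i) ℤ.* g 0  ∎
  where open ≡-Reasoning

⊛-comm : ∀ f g i → (f ⊛ g) i ≡ (g ⊛ f) i
⊛-comm f g zero = cong (ℤ._+ 0ℤ) (ℤ.*-comm (f 0) (g 0))
⊛-comm f g (suc i) = begin
  (f ⊛ g) (suc i)                             ≡⟨ ⊛-suc f g i ⟩
  f 0 ℤ.* g (suc i) ℤ.+ (tail f ⊛ g) i        ≡⟨ cong₂ ℤ._+_ (ℤ.*-comm (f 0) _) (⊛-comm (tail f) g i) ⟩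
  g (suc i) ℤ.* f 0 ℤ.+ (g ⊛ tail f) i        ≡⟨ ℤ.+-comm (g (suc i) ℤ.* f 0) _ ⟩
  (g ⊛ tail f) i ℤ.+ g (suc i) ℤ.* f 0        ≡⟨ ⊛-sucʳ g f i ⟨
  (g ⊛ f) (suc i)                             ∎
  where open ≡-Reasoning

⊛-cong-≤ : ∀ {f f′ g g′} d → (∀ i → i ≤ d → f i ≡ f′ i) → (∀ i → i ≤ d → g i ≡ g′ i) →
           (f ⊛ g) d ≡ (f′ ⊛ g′) d
⊛-cong-≤ d f≡f′ g≡g′ = ℤΣ.sum-cong-∈ (upTo (suc d)) λ {i} i∈ →
  cong₂ ℤ._*_ (f≡f′ i (ℕ.s≤s⁻¹ (∈.∈-upTo⁻ i∈))) (g≡g′ (d ∸ i) (ℕ.m∸n≤m d i))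

-- Shaped for associativity, where the tail of f g is f₀ (tail g) + (tail f) g.
⊛-linearˡ : ∀ a f g h i → ((λ j → a ℤ.* f j ℤ.+ g j) ⊛ h) i ≡ a ℤ.* (f ⊛ h) i ℤ.+ (g ⊛ h) i
⊛-linearˡ a f g h i = begin
  ∑[ j ∈ js ] (a ℤ.* f j ℤ.+ g j) ℤ.* h (i ∸ j)
    ≡⟨ ℤΣ.sum-cong js (λ j → distrib a (f j) (g j) (h (i ∸ j))) ⟩
  ∑[ j ∈ js ] (a ℤ.* (f j ℤ.* h (i ∸ j)) ℤ.+ g j ℤ.* h (i ∸ j))
    ≡⟨ ℤΣ.sum-+ js (λ j → a ℤ.* (f j ℤ.* h (i ∸ j))) (λ j → g j ℤ.* h (i ∸ j)) ⟩
  ∑ js (λ j → a ℤ.* (f j ℤ.* h (i ∸ j))) ℤ.+ (g ⊛ h) i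
    ≡⟨ cong (ℤ._+ (g ⊛ h) i) (ℤΣ.*-sum a js (λ j → f j ℤ.* h (i ∸ j))) ⟨
  a ℤ.* (f ⊛ h) i ℤ.+ (g ⊛ h) i  ∎
  where
  open ≡-Reasoning
  js = upTo (suc i)
  distrib : ∀ a x y z → (a ℤ.* x ℤ.+ y) ℤ.* z ≡ a ℤ.* (x ℤ.* z) ℤ.+ y ℤ.* z
  distrib = ℤ.solve-∀

⊛-assoc : ∀ f g h i → ((f ⊛ g) ⊛ h) i ≡ (f ⊛ (g ⊛ h)) i
⊛-assoc f g h zero = begin
  ((f ⊛ g) ⊛ h) 0              ≡⟨ ⊛-zero (f ⊛ g) h ⟩
  (f ⊛ g) 0 ℤ.* h 0            ≡⟨ cong (ℤ._* h 0) (⊛-zero f g) ⟩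
  f 0 ℤ.* g 0 ℤ.* h 0          ≡⟨ ℤ.*-assoc (f 0) (g 0) (h 0) ⟩
  f 0 ℤ.* (g 0 ℤ.* h 0)        ≡⟨ cong (f 0 ℤ.*_) (⊛-zero g h) ⟨
  f 0 ℤ.* (g ⊛ h) 0            ≡⟨ ⊛-zero f (g ⊛ h) ⟨
  (f ⊛ (g ⊛ h)) 0              ∎
  where open ≡-Reasoning
⊛-assoc f g h (suc i) = begin
  ((f ⊛ g) ⊛ h) (suc i)
    ≡⟨ ⊛-suc (f ⊛ g) h i ⟩
  (f ⊛ g) 0 ℤ.* h (suc i) ℤ.+ (tail (f ⊛ g) ⊛ h) i
    ≡⟨ cong₂ (λ x y → x ℤ.* h (suc i) ℤ.+ y) (⊛-zero f g)
         (⊛-cong-≤ {g = h} i (λ j _ → ⊛-suc f g j) (λ _ _ → refl)) ⟩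
  f 0 ℤ.* g 0 ℤ.* h (suc i) ℤ.+ ((λ j → f 0 ℤ.* tail g j ℤ.+ (tail f ⊛ g) j) ⊛ h) i
    ≡⟨ cong (λ z → f 0 ℤ.* g 0 ℤ.* h (suc i) ℤ.+ z) (⊛-linearˡ (f 0) (tail g) (tail f ⊛ g) h i) ⟩
  f 0 ℤ.* g 0 ℤ.* h (suc i) ℤ.+ (f 0 ℤ.* (tail g ⊛ h) i ℤ.+ ((tail f ⊛ g) ⊛ h) i)
    ≡⟨ cong (λ z → f 0 ℤ.* g 0 ℤ.* h (suc i) ℤ.+ (f 0 ℤ.* (tail g ⊛ h) i ℤ.+ z)) (⊛-assoc (tail f) g h i) ⟩
  f 0 ℤ.* g 0 ℤ.* h (suc i) ℤ.+ (f 0 ℤ.* (tail g ⊛ h) i ℤ.+ (tail f ⊛ (g ⊛ h)) i)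
    ≡⟨ regroup (f 0) (g 0) (h (suc i)) _ _ ⟩
  f 0 ℤ.* (g 0 ℤ.* h (suc i) ℤ.+ (tail g ⊛ h) i) ℤ.+ (tail f ⊛ (g ⊛ h)) i
    ≡⟨ cong (λ z → f 0 ℤ.* z ℤ.+ (tail f ⊛ (g ⊛ h)) i) (⊛-suc g h i) ⟨
  f 0 ℤ.* (g ⊛ h) (suc i) ℤ.+ (tail f ⊛ (g ⊛ h)) i
    ≡⟨ ⊛-suc f (g ⊛ h) i ⟨
  (f ⊛ (g ⊛ h)) (suc i)  ∎
  where
  open ≡-Reasoning
  regroup : ∀ a b c x y → a ℤ.* b ℤ.* c ℤ.+ (a ℤ.* x ℤ.+ y) ≡ a ℤ.* (b ℤ.* c ℤ.+ x) ℤ.+ y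
  regroup = ℤ.solve-∀

⊛-zeroˡ : ∀ f i → ((λ _ → 0ℤ) ⊛ f) i ≡ 0ℤ
⊛-zeroˡ f i = ℤΣ.sum-0 (upTo (suc i)) λ {j} _ → ℤ.*-zeroˡ (f (i ∸ j))

⊛-identityˡ : ∀ f i → (one ⊛ f) i ≡ f i
⊛-identityˡ f zero    = trans (⊛-zero one f) (ℤ.*-identityˡ (f 0))
⊛-identityˡ f (suc i) = begin
  (one ⊛ f) (suc i)                   ≡⟨ ⊛-suc one f i ⟩
  1ℤ ℤ.* f (suc i) ℤ.+ ((λ _ → 0ℤ) ⊛ f) i      ≡⟨ cong₂ ℤ._+_ (ℤ.*-identityˡ (f (suc i))) (⊛-zeroˡ f i) ⟩
  f (suc i) ℤ.+ 0ℤ                    ≡⟨ ℤ.+-identityʳ _ ⟩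
  f (suc i)                           ∎
  where open ≡-Reasoning

⊛-distribʳ : ∀ f g h i → ((λ j → g j ℤ.+ h j) ⊛ f) i ≡ (g ⊛ f) i ℤ.+ (h ⊛ f) i
⊛-distribʳ f g h i = trans
  (ℤΣ.sum-cong (upTo (suc i)) λ j → ℤ.*-distribʳ-+ (f (i ∸ j)) (g j) (h j))
  (ℤΣ.sum-+ (upTo (suc i)) (λ j → g j ℤ.* f (i ∸ j)) (λ j → h j ℤ.* f (i ∸ j)))

monomial-suc-⊛ : ∀ m f i → (monomial (suc m) ⊛ f) (suc i) ≡ (monomial m ⊛ f) i
monomial-suc-⊛ m f i = trans (⊛-suc (monomial (suc m)) f i)
  (trans (cong (ℤ._+ (monomial m ⊛ f) i) (ℤ.*-zeroˡ (f (suc i)))) (ℤ.+-identityˡ _))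

monomial-+ : ∀ m n i → (monomial m ⊛ monomial n) i ≡ monomial (m ℕ.+ n) i
monomial-+ zero    n i       = ⊛-identityˡ (monomial n) i
monomial-+ (suc m) n zero    = trans (⊛-zero (monomial (suc m)) (monomial n)) (ℤ.*-zeroˡ (monomial n 0))
monomial-+ (suc m) n (suc i) = trans (monomial-suc-⊛ m (monomial n) i) (monomial-+ m n i)

sum-allFin-upTo : ∀ n (f : ℕ → ℤ) → ∑ (allFin n) (f ∘ toℕ) ≡ ∑ (upTo n) f
sum-allFin-upTo zero    f = refl
sum-allFin-upTo (suc n) f = begin
  ∑ (allFin (suc n)) (f ∘ toℕ)               ≡⟨ ℤΣ.sum-allFin n (f ∘ toℕ) ⟩
  f 0 ℤ.+ ∑ (allFin n) (f ∘ suc ∘ toℕ)       ≡⟨ cong (λ z → f 0 ℤ.+ z) (sum-allFin-upTo n (f ∘ suc)) ⟩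
  f 0 ℤ.+ ∑ (upTo n) (f ∘ suc)               ≡⟨ ℤΣ.sum-upTo n f ⟨
  ∑ (upTo (suc n)) f                         ∎
  where open ≡-Reasoning

lookup-recipCoeffs : ∀ f d i → lookup (recipCoeffs f d) i ≡ recip f (d ∸ toℕ i)
lookup-recipCoeffs f zero    Fin.zero    = refl
lookup-recipCoeffs f (suc d) Fin.zero    = refl
lookup-recipCoeffs f (suc d) (Fin.suc i) = lookup-recipCoeffs f d i

recip-inverseʳ : ∀ f → f 0 ≡ 1ℤ → ∀ i → (f ⊛ recip f) i ≡ one i
recip-inverseʳ f f₀≡1 zero    = trans (⊛-zero f (recip f)) (cong (ℤ._* 1ℤ) f₀≡1)
recip-inverseʳ f f₀≡1 (suc d) = begin
  (f ⊛ recip f) (suc d)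
    ≡⟨ ⊛-suc f (recip f) d ⟩
  f 0 ℤ.* (ℤ.- s) ℤ.+ (tail f ⊛ recip f) d
    ≡⟨ cong₂ (λ x y → x ℤ.* (ℤ.- s) ℤ.+ y) f₀≡1 (sym s≡) ⟩
  1ℤ ℤ.* (ℤ.- s) ℤ.+ s
    ≡⟨ cong (ℤ._+ s) (ℤ.*-identityˡ (ℤ.- s)) ⟩
  ℤ.- s ℤ.+ s
    ≡⟨ ℤ.+-inverseˡ s ⟩
  0ℤ  ∎
  where
  open ≡-Reasoning
  s = ∑[ i ∈ allFin (suc d) ] f (suc (toℕ i)) ℤ.* lookup (recipCoeffs f d) i
  s≡ : s ≡ (tail f ⊛ recip f) d
  s≡ = trans
    (ℤΣ.sum-cong (allFin (suc d)) λ i → cong (f (suc (toℕ i)) ℤ.*_) (lookup-recipCoeffs f d i))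
    (sum-allFin-upTo (suc d) λ i → f (suc i) ℤ.* recip f (d ∸ i))

-- Power series modulo q^{d+1}

-- ℤ[[q]] as a type without η, so that the operations below do not unfold.
record Series : Set where
  no-eta-equality
  constructor series
  field coeff : ℤ[[q]]

open Series

infixl 6 _⊕_
infixl 7 _⊗_
infix 8 q^_

_⊕_ _⊗_ : Series → Series → Series
coeff (f ⊕ g) i = coeff f i ℤ.+ coeff g i
coeff (f ⊗ g)   = coeff f ⊛ coeff g

𝟘 𝟙 : Series
coeff 𝟘 _ = 0ℤ
coeff 𝟙   = one

q^_ 1-q^ˢ_ 1/poch : ℕ → Series
coeff (q^ m)      = monomial m
coeff (1-q^ˢ m)   = 1-q^ m
coeff (1/poch m)  = recip (∏≤ m 1-q^_)

_^ˢ_ : Series → ℕ → Series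
f ^ˢ zero  = 𝟙
f ^ˢ suc r = f ⊗ f ^ˢ r

-- (q)ₘ
poch : ℕ → Series
poch zero    = 𝟙
poch (suc m) = poch m ⊗ 1-q^ˢ suc m

-- A record and not a function type, so that `d`, `f` and `g` can be recovered by unification.
record EqualUpTo (d : ℕ) (f g : Series) : Set where
  constructor equal
  field at : ∀ i → i ≤ d → coeff f i ≡ coeff g i

open EqualUpTo

exact : ∀ {d f g} → (∀ i → coeff f i ≡ coeff g i) → EqualUpTo d f g
exact f≡g = equal λ i _ → f≡g i

-- Truncation respects products because the coefficient of q^i in a product involves only
-- coefficients up to i, which is `⊛-cong-≤`. The bundle gives access to `Sum` and to the semiring
-- solver.
seriesSemiring : ℕ → CommutativeSemiring _ _
seriesSemiring d = record
  { Carrier = Series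
  ; _≈_     = EqualUpTo d
  ; _+_     = _⊕_
  ; _*_     = _⊗_
  ; 0#      = 𝟘
  ; 1#      = 𝟙
  ; isCommutativeSemiring = isCommutativeSemiringˡ record
    { +-isCommutativeMonoid = isCommutativeMonoidˡ record
      { isSemigroup = record
        { isMagma = record
          { isEquivalence = isEquivalence
          ; ∙-cong = λ (equal p) (equal r) → equal λ i i≤d → cong₂ ℤ._+_ (p i i≤d) (r i i≤d)
          }
        ; assoc = λ f g h → exact λ i → ℤ.+-assoc (coeff f i) (coeff g i) (coeff h i)
        }
      ; identityˡ = λ f → exact λ i → ℤ.+-identityˡ (coeff f i)
      ; comm = λ f g → exact λ i → ℤ.+-comm (coeff f i) (coeff g i)
      }
    ; *-isCommutativeMonoid = isCommutativeMonoidˡ record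
      { isSemigroup = record
        { isMagma = record
          { isEquivalence = isEquivalence
          ; ∙-cong = λ (equal p) (equal r) → equal λ i i≤d →
              ⊛-cong-≤ i (λ j j≤i → p j (ℕ.≤-trans j≤i i≤d)) (λ j j≤i → r j (ℕ.≤-trans j≤i i≤d))
          }
        ; assoc = λ f g h → exact (⊛-assoc (coeff f) (coeff g) (coeff h))
        }
      ; identityˡ = λ f → exact (⊛-identityˡ (coeff f))
      ; comm = λ f g → exact (⊛-comm (coeff f) (coeff g))
      }
    ; distribʳ = λ f g h → exact (⊛-distribʳ (coeff f) (coeff g) (coeff h))
    ; zeroˡ = λ f → exact (⊛-zeroˡ (coeff f))
    }
  }
  where
  isEquivalence : IsEquivalence (EqualUpTo d)
  isEquivalence = record
    { refl  = exact λ _ → refl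
    ; sym   = λ (equal p) → equal λ i i≤d → sym (p i i≤d)
    ; trans = λ (equal p) (equal r) → equal λ i i≤d → trans (p i i≤d) (r i i≤d)
    }

module Modulo (d : ℕ) where

  open CommutativeSemiring (seriesSemiring d) public
    renaming (refl to ≈-refl; sym to ≈-sym; trans to ≈-trans)
    hiding (_+_; _*_; 0#; 1#; Carrier; zero)
  open Sum (seriesSemiring d) public
  open SemiringSolver (seriesSemiring d) using (solve; _:=_; _:*_)
  open SetoidReasoning setoid

  ⊕-cancelʳ : ∀ {f g h k} → f ⊕ h ≈ g ⊕ k → h ≈ k → f ≈ g
  ⊕-cancelʳ {f} {g} {h} {k} (equal p) (equal r) = equal λ i i≤d →
    ℤGroup.∙-cancelʳ (coeff h i) _ _
      (trans (p i i≤d) (cong (λ z → coeff g i ℤ.+ z) (sym (r i i≤d))))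

  q^0≈1 : q^ 0 ≈ 𝟙
  q^0≈1 = exact λ _ → refl

  q^-+ : ∀ m n → q^ (m ℕ.+ n) ≈ q^ m ⊗ q^ n
  q^-+ m n = exact λ i → sym (monomial-+ m n i)

  q^≈0 : ∀ {m} → d < m → q^ m ≈ 𝟘
  q^≈0 {m} d<m = equal λ i i≤d → ℤΣ.[]-no (i ℕ.≟ m) λ { refl → ℕ.≤⇒≯ i≤d d<m }

  -- A semiring has no subtraction, so 1 - q^k is characterised additively; where a difference would
  -- be formed, `⊕-cancelʳ` is used instead.
  1-q^+q^≈1 : ∀ k → 1-q^ˢ k ⊕ q^ k ≈ 𝟙
  1-q^+q^≈1 k = exact λ i → ℤGroup.//-rightDividesˡ (monomial k i) (one i)

  1-q^≈1 : ∀ {k} → d < k → 1-q^ˢ k ≈ 𝟙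
  1-q^≈1 {k} d<k = begin
    1-q^ˢ k           ≈⟨ +-identityʳ _ ⟨
    1-q^ˢ k ⊕ 𝟘       ≈⟨ +-congˡ (q^≈0 d<k) ⟨
    1-q^ˢ k ⊕ q^ k    ≈⟨ 1-q^+q^≈1 k ⟩
    𝟙                 ∎

  1-q^0≈0 : 1-q^ˢ 0 ≈ 𝟘
  1-q^0≈0 = exact λ i → ℤ.+-inverseʳ (one i)

  inverse-unique : ∀ {f g h} → f ⊗ g ≈ 𝟙 → f ⊗ h ≈ 𝟙 → g ≈ h
  inverse-unique {f} {g} {h} fg fh = begin
    g              ≈⟨ *-identityʳ g ⟨
    g ⊗ 𝟙          ≈⟨ *-congˡ fh ⟨
    g ⊗ (f ⊗ h)    ≈⟨ solve 3 (λ f g h → g :* (f :* h) := (f :* g) :* h) ≈-refl f g h ⟩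
    f ⊗ g ⊗ h      ≈⟨ *-congʳ fg ⟩
    𝟙 ⊗ h          ≈⟨ *-identityˡ h ⟩
    h              ∎

  ⊗-recip : ∀ {f g} → f ≈ series g → g 0 ≡ 1ℤ → f ⊗ series (recip g) ≈ 𝟙
  ⊗-recip {g = g} f≈g g₀≡1 = ≈-trans (*-congʳ f≈g) (exact (recip-inverseʳ g g₀≡1))

  poch≈ : ∀ m → poch m ≈ series (∏≤ m 1-q^_)
  poch≈ zero    = exact λ _ → refl
  poch≈ (suc m) = ≈-trans (*-congʳ (poch≈ m)) (exact λ _ → refl)

  poch-1/poch : ∀ m → poch m ⊗ 1/poch m ≈ 𝟙
  poch-1/poch m = ≈-trans (*-congˡ (exact λ _ → refl)) (⊗-recip (poch≈ m) (∏≤-0 m))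
    where
    ∏≤-0 : ∀ m → ∏≤ m 1-q^_ 0 ≡ 1ℤ
    ∏≤-0 zero    = refl
    ∏≤-0 (suc m) = trans (⊛-zero (∏≤ m 1-q^_) (1-q^ suc m)) (cong (ℤ._* 1ℤ) (∏≤-0 m))

  1/poch-suc : ∀ m → 1/poch m ≈ 1/poch (suc m) ⊗ 1-q^ˢ suc m
  1/poch-suc m = inverse-unique (poch-1/poch m) (≈-trans
    (solve 3 (λ f g h → f :* (g :* h) := f :* h :* g) ≈-refl
      (poch m) (1/poch (suc m)) (1-q^ˢ suc m))
    (poch-1/poch (suc m)))

  -- Factors 1 - q^k with k > d are 1 modulo q^{d+1}. Hence `poch d` and `1/poch d` can stand for
  -- (q)_∞ and its inverse.
  poch-stable : ∀ {m n} → d ≤ m → d ≤ n → poch m ≈ poch n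
  poch-stable d≤m d≤n = ≈-trans (stable d≤m) (≈-sym (stable d≤n))
    where
    stable : ∀ {m} → d ≤ m → poch m ≈ poch d
    stable {zero}  z≤n = ≈-refl
    stable {suc m} d≤1+m with ℕ.m≤n⇒m<n∨m≡n d≤1+m
    ... | inj₂ refl  = ≈-refl
    ... | inj₁ d<1+m = begin
      poch m ⊗ 1-q^ˢ suc m  ≈⟨ *-cong (stable (ℕ.s≤s⁻¹ d<1+m)) (1-q^≈1 d<1+m) ⟩
      poch d ⊗ 𝟙            ≈⟨ *-identityʳ _ ⟩
      poch d                ∎

  1/poch-stable : ∀ {m n} → d ≤ m → d ≤ n → 1/poch m ≈ 1/poch n
  1/poch-stable {m} {n} d≤m d≤n = inverse-unique (poch-1/poch m)
    (≈-trans (*-congʳ (poch-stable d≤m d≤n)) (poch-1/poch n))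

  ^ˢ-cong : ∀ {f g} r → f ≈ g → f ^ˢ r ≈ g ^ˢ r
  ^ˢ-cong zero    f≈g = ≈-refl
  ^ˢ-cong (suc r) f≈g = *-cong f≈g (^ˢ-cong r f≈g)

  𝟙-^ˢ : ∀ r → 𝟙 ^ˢ r ≈ 𝟙
  𝟙-^ˢ zero    = ≈-refl
  𝟙-^ˢ (suc r) = ≈-trans (*-identityˡ _) (𝟙-^ˢ r)

  ⊗-^ˢ : ∀ f g r → (f ⊗ g) ^ˢ r ≈ f ^ˢ r ⊗ g ^ˢ r
  ⊗-^ˢ f g zero    = ≈-sym (*-identityˡ 𝟙)
  ⊗-^ˢ f g (suc r) = ≈-trans (*-congˡ (⊗-^ˢ f g r))
    (solve 4 (λ f g x y → f :* g :* (x :* y) := (f :* x) :* (g :* y)) ≈-refl f g (f ^ˢ r) (g ^ˢ r))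

  pow≈ : ∀ f r → series (pow (coeff f) r) ≈ f ^ˢ r
  pow≈ f zero    = exact λ _ → refl
  pow≈ f (suc r) = ≈-trans (exact λ _ → refl) (*-congˡ {f} (pow≈ f r))

  ∏≤-pow : ∀ r m → series (∏≤ m (λ k → pow (1-q^ k) r)) ≈ poch m ^ˢ r
  ∏≤-pow r zero    = ≈-trans (exact λ _ → refl) (≈-sym (𝟙-^ˢ r))
  ∏≤-pow r (suc m) = begin
    series (∏≤ (suc m) (λ k → pow (1-q^ k) r))
      ≈⟨ exact (λ _ → refl) ⟩
    series (∏≤ m (λ k → pow (1-q^ k) r)) ⊗ series (pow (1-q^ suc m) r)
      ≈⟨ *-cong (∏≤-pow r m) (pow≈ (1-q^ˢ suc m) r) ⟩
    poch m ^ˢ r ⊗ (1-q^ˢ suc m) ^ˢ r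
      ≈⟨ ⊗-^ˢ (poch m) (1-q^ˢ suc m) r ⟨
    poch (suc m) ^ˢ r  ∎

-- The coefficient of q^i in `∏` is read off the i-th partial product, so each i ≤ d is compared at
-- its own truncation level i.
∏-pow : ∀ d r → EqualUpTo d (poch d ^ˢ r) (series (∏ (λ k → pow (1-q^ k) r)))
∏-pow d r = equal λ i i≤d → let open Modulo i in
  sym (at (≈-trans (∏≤-pow r i) (^ˢ-cong r (poch-stable ℕ.≤-refl i≤d))) i ℕ.≤-refl)

-- 1 / ((q)∞)ʳ
recip-∏-pow : ∀ d r → EqualUpTo d (series (recip (∏ (λ k → pow (1-q^ k) r)))) (1/poch d ^ˢ r)
recip-∏-pow d r = inverse-unique (⊗-recip (∏-pow d r) refl) (begin
  poch d ^ˢ r ⊗ 1/poch d ^ˢ r    ≈⟨ ⊗-^ˢ (poch d) (1/poch d) r ⟨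
  (poch d ⊗ 1/poch d) ^ˢ r       ≈⟨ ^ˢ-cong r (poch-1/poch d) ⟩
  𝟙 ^ˢ r                         ≈⟨ 𝟙-^ˢ r ⟩
  𝟙                              ∎)
  where
  open Modulo d
  open SetoidReasoning setoid

-- Durfee rectangles

module Durfee (d : ℕ) where

  open Modulo d
  open SetoidReasoning setoid
  open SemiringSolver (seriesSemiring d) using (solve; _:=_; _:+_; _:*_)

  -- The generating function of the partitions with Durfee rectangle t × (t + c). Those with t > d
  -- have size above d, so `durfee` may stop at t = d.
  rectangle : ℕ → ℕ → Series
  rectangle c t = q^ (t ℕ.* (t ℕ.+ c)) ⊗ (1/poch t ⊗ 1/poch (t ℕ.+ c))

  durfee : ℕ → Series
  durfee c = sum (upTo (suc d)) (rectangle c)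

  private
    -- The rectangles for c and for c + 1 are both multiples of `u c t`, by 1 - q^{t+c+1} and by
    -- q^t. The remainder `v` turns out to be a rectangle for c + 2 with t shifted by one.
    u v : ℕ → ℕ → Series
    u c t = q^ (t ℕ.* (t ℕ.+ c)) ⊗ (1/poch t ⊗ 1/poch (suc (t ℕ.+ c)))
    v c t = u c t ⊗ 1-q^ˢ t

    q≡ : ∀ {m n} → m ≡ n → q^ m ≈ q^ n
    q≡ m≡n = reflexive (cong q^_ m≡n)

    q^+1-q^ : ∀ f k → f ⊗ 1-q^ˢ k ⊕ q^ k ⊗ f ≈ f
    q^+1-q^ f k = begin
      f ⊗ 1-q^ˢ k ⊕ q^ k ⊗ f    ≈⟨ solve 3 (λ f x y → f :* x :+ y :* f := f :* (x :+ y)) ≈-refl f (1-q^ˢ k) (q^ k) ⟩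
      f ⊗ (1-q^ˢ k ⊕ q^ k)      ≈⟨ *-congˡ (1-q^+q^≈1 k) ⟩
      f ⊗ 𝟙                     ≈⟨ *-identityʳ f ⟩
      f                         ∎

    rectangle-u : ∀ c t → rectangle c t ≈ u c t ⊗ 1-q^ˢ suc (t ℕ.+ c)
    rectangle-u c t = ≈-trans (*-congˡ (*-congˡ (1/poch-suc (t ℕ.+ c))))
      (solve 4 (λ x y z w → x :* (y :* (z :* w)) := x :* (y :* z) :* w) ≈-refl
        (q^ (t ℕ.* (t ℕ.+ c))) (1/poch t) (1/poch (suc (t ℕ.+ c))) (1-q^ˢ suc (t ℕ.+ c)))

    rectangle-suc-u : ∀ c t → rectangle (suc c) t ≈ q^ t ⊗ u c t
    rectangle-suc-u c t rewrite ℕ.+-suc t c | ℕ.*-suc t (t ℕ.+ c) =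
      ≈-trans (*-congʳ (q^-+ t (t ℕ.* (t ℕ.+ c)))) (*-assoc _ _ _)

    -- Both sides equal `u c t`: on the left 1 is split as (1 - q^{t+c+1}) + q^{t+c+1}, on the right
    -- as (1 - q^t) + q^t.
    rectangle-step : ∀ c t → rectangle c t ⊕ q^ suc c ⊗ rectangle (suc c) t ≈ rectangle (suc c) t ⊕ v c t
    rectangle-step c t = begin
      rectangle c t ⊕ q^ suc c ⊗ rectangle (suc c) t
        ≈⟨ +-cong (rectangle-u c t) (*-congˡ (rectangle-suc-u c t)) ⟩
      u c t ⊗ 1-q^ˢ suc (t ℕ.+ c) ⊕ q^ suc c ⊗ (q^ t ⊗ u c t)
        ≈⟨ +-congˡ (≈-trans (≈-sym (*-assoc _ _ _)) (*-congʳ (≈-trans (≈-sym (q^-+ (suc c) t)) (q≡ (cong suc (ℕ.+-comm c t)))))) ⟩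
      u c t ⊗ 1-q^ˢ suc (t ℕ.+ c) ⊕ q^ suc (t ℕ.+ c) ⊗ u c t
        ≈⟨ q^+1-q^ (u c t) (suc (t ℕ.+ c)) ⟩
      u c t
        ≈⟨ q^+1-q^ (u c t) t ⟨
      v c t ⊕ q^ t ⊗ u c t
        ≈⟨ +-comm _ _ ⟩
      q^ t ⊗ u c t ⊕ v c t
        ≈⟨ +-congʳ (rectangle-suc-u c t) ⟨
      rectangle (suc c) t ⊕ v c t  ∎

    v-zero : ∀ c → v c 0 ≈ 𝟘
    v-zero c = ≈-trans (*-congˡ 1-q^0≈0) (zeroʳ _)

    -- The factor 1 - q^{t+1} turns 1/(q)_{t+1} into 1/(q)_t, and the exponent t(t+2+c) of the new
    -- rectangle falls short of (t+1)(t+1+c) by c + 1.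
    v-suc : ∀ c t → v c (suc t) ≈ q^ suc c ⊗ rectangle (2 ℕ.+ c) t
    v-suc c t = begin
      q^ (suc t ℕ.* (suc t ℕ.+ c)) ⊗ (1/poch (suc t) ⊗ 1/poch (suc (suc t ℕ.+ c))) ⊗ 1-q^ˢ suc t
        ≈⟨ solve 4 (λ x y z w → x :* (y :* z) :* w := x :* ((y :* w) :* z)) ≈-refl
             (q^ (suc t ℕ.* (suc t ℕ.+ c))) (1/poch (suc t)) (1/poch (suc (suc t ℕ.+ c))) (1-q^ˢ suc t) ⟩
      q^ (suc t ℕ.* (suc t ℕ.+ c)) ⊗ (1/poch (suc t) ⊗ 1-q^ˢ suc t ⊗ 1/poch (suc (suc t ℕ.+ c)))
        ≈⟨ *-cong (≈-trans (q≡ (exponent c t)) (q^-+ (suc c) _)) (*-cong (≈-sym (1/poch-suc t)) (reflexive (cong 1/poch index))) ⟩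
      q^ suc c ⊗ q^ (t ℕ.* (t ℕ.+ (2 ℕ.+ c))) ⊗ (1/poch t ⊗ 1/poch (t ℕ.+ (2 ℕ.+ c)))
        ≈⟨ *-assoc _ _ _ ⟩
      q^ suc c ⊗ rectangle (2 ℕ.+ c) t  ∎
      where
      index : suc (suc t ℕ.+ c) ≡ t ℕ.+ (2 ℕ.+ c)
      index = sym (trans (ℕ.+-suc t (suc c)) (cong suc (ℕ.+-suc t c)))
      exponent : ∀ c t → suc t ℕ.* (suc t ℕ.+ c) ≡ suc c ℕ.+ t ℕ.* (t ℕ.+ (2 ℕ.+ c))
      exponent = ℕ.solve-∀

    -- After the shift of t the sum ends at t = d - 1. The missing term for t = d has exponent (c+1)
    -- + d(d+2+c) > d and can be added freely.
    sum-v : ∀ c → sum (upTo (suc d)) (v c) ≈ q^ suc c ⊗ durfee (2 ℕ.+ c)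
    sum-v c = begin
      sum (upTo (suc d)) (v c)
        ≡⟨ sum-upTo d (v c) ⟩
      v c 0 ⊕ sum (upTo d) (v c ∘ suc)
        ≈⟨ +-cong (v-zero c) (sum-cong (upTo d) (v-suc c)) ⟩
      𝟘 ⊕ sum (upTo d) (λ t → q^ suc c ⊗ rectangle (2 ℕ.+ c) t)
        ≈⟨ +-comm _ _ ⟩
      sum (upTo d) (λ t → q^ suc c ⊗ rectangle (2 ℕ.+ c) t) ⊕ 𝟘
        ≈⟨ +-congˡ last≈0 ⟨
      sum (upTo d) (λ t → q^ suc c ⊗ rectangle (2 ℕ.+ c) t) ⊕ q^ suc c ⊗ rectangle (2 ℕ.+ c) d
        ≈⟨ sum-upTo-last d (λ t → q^ suc c ⊗ rectangle (2 ℕ.+ c) t) ⟨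
      sum (upTo (suc d)) (λ t → q^ suc c ⊗ rectangle (2 ℕ.+ c) t)
        ≈⟨ *-sum (q^ suc c) (upTo (suc d)) (rectangle (2 ℕ.+ c)) ⟨
      q^ suc c ⊗ durfee (2 ℕ.+ c)  ∎
      where
      exponent> : d < suc c ℕ.+ d ℕ.* (d ℕ.+ (2 ℕ.+ c))
      exponent> = s≤s (ℕ.≤-trans (ℕ.m≤m*n d (d ℕ.+ (2 ℕ.+ c)) {{ℕ.>-nonZero (ℕ.≤-trans (s≤s z≤n) (ℕ.m≤n+m (2 ℕ.+ c) d))}})
                                 (ℕ.m≤n+m _ c))
      last≈0 : q^ suc c ⊗ rectangle (2 ℕ.+ c) d ≈ 𝟘
      last≈0 = ≈-trans (≈-sym (*-assoc _ _ _)) (≈-trans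
        (*-congʳ (≈-trans (≈-sym (q^-+ (suc c) _)) (q^≈0 exponent>))) (zeroˡ _))

    durfee-step : ∀ c → durfee c ⊕ q^ suc c ⊗ durfee (1 ℕ.+ c) ≈ durfee (1 ℕ.+ c) ⊕ q^ suc c ⊗ durfee (2 ℕ.+ c)
    durfee-step c = begin
      durfee c ⊕ q^ suc c ⊗ durfee (suc c)
        ≈⟨ +-congˡ (*-sum (q^ suc c) ts (rectangle (suc c))) ⟩
      durfee c ⊕ sum ts (λ t → q^ suc c ⊗ rectangle (suc c) t)
        ≈⟨ sum-+ ts _ _ ⟨
      sum ts (λ t → rectangle c t ⊕ q^ suc c ⊗ rectangle (suc c) t)
        ≈⟨ sum-cong ts (rectangle-step c) ⟩
      sum ts (λ t → rectangle (suc c) t ⊕ v c t)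
        ≈⟨ sum-+ ts _ _ ⟩
      durfee (suc c) ⊕ sum ts (v c)
        ≈⟨ +-congˡ (sum-v c) ⟩
      durfee (suc c) ⊕ q^ suc c ⊗ durfee (2 ℕ.+ c)  ∎
      where ts = upTo (suc d)

    -- For t ≥ 1 the exponent t(t+c) is at least 1 + c > d, so only the term 1/(q)_c for t = 0
    -- remains.
    durfee-large : ∀ {c} → d ≤ c → durfee c ≈ 1/poch d
    durfee-large {c} d≤c = begin
      durfee c
        ≡⟨ sum-upTo d (rectangle c) ⟩
      q^ 0 ⊗ (1/poch 0 ⊗ 1/poch c) ⊕ sum (upTo d) (rectangle c ∘ suc)
        ≈⟨ +-cong (*-cong q^0≈1 (*-cong 1/poch-0 (1/poch-stable d≤c ℕ.≤-refl)))
                  (sum-0 (upTo d) (λ {t} _ → ≈-trans (*-congʳ (q^≈0 (exponent> t))) (zeroˡ _))) ⟩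
      𝟙 ⊗ (𝟙 ⊗ 1/poch d) ⊕ 𝟘
        ≈⟨ +-identityʳ _ ⟩
      𝟙 ⊗ (𝟙 ⊗ 1/poch d)
        ≈⟨ ≈-trans (*-identityˡ _) (*-identityˡ _) ⟩
      1/poch d  ∎
      where
      1/poch-0 : 1/poch 0 ≈ 𝟙
      1/poch-0 = inverse-unique (poch-1/poch 0) (*-identityˡ 𝟙)
      exponent> : ∀ t → d < suc t ℕ.* (suc t ℕ.+ c)
      exponent> t = s≤s (ℕ.≤-trans d≤c (ℕ.≤-trans (ℕ.m≤n+m c t) (ℕ.m≤m+n _ _)))

  -- Induction downwards in c from the range c ≥ d, where `durfee-large` applies; `j` bounds the
  -- distance to that range.
  durfee≈1/poch : ∀ c → durfee c ≈ 1/poch d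
  durfee≈1/poch c = go d c (ℕ.m≤m+n d c)
    where
    -- durfee c - durfee (c+1) ≈ q^{c+1} (durfee (c+2) - durfee (c+1))
    go : ∀ j c → d ≤ j ℕ.+ c → durfee c ≈ 1/poch d
    go zero    c d≤ = durfee-large d≤
    go (suc j) c d≤ = ≈-trans
      (⊕-cancelʳ (durfee-step c) (*-congˡ (≈-trans (go j (1 ℕ.+ c) d≤₁) (≈-sym (go j (2 ℕ.+ c) d≤₂)))))
      (go j (1 ℕ.+ c) d≤₁)
      where
      d≤₁ = ℕ.≤-trans d≤ (ℕ.≤-reflexive (sym (ℕ.+-suc j c)))
      d≤₂ = ℕ.≤-trans d≤₁ (ℕ.+-monoʳ-≤ j (ℕ.n≤1+n (suc c)))

-- Words, their contents and inversions

private variable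
  m n : ℕ

_≟ᶜ_ : (α β : Vec ℕ n) → Dec (α ≡ β)
_≟ᶜ_ = Vec.≡-dec ℕ._≟_

content : Vec (Fin n) m → Vec ℕ n
content []      = Vec.replicate _ 0
content (i ∷ w) = updateAt (content w) i suc

-- For a word of content α, the number of its letters smaller than i, that is, the inversions
-- created by an i put in front.
below : Fin n → Vec ℕ n → ℕ
below Fin.zero    (x ∷ α) = 0
below (Fin.suc i) (x ∷ α) = x ℕ.+ below i α

inversions : Vec (Fin n) m → ℕ
inversions []      = 0
inversions (i ∷ w) = below i (content w) ℕ.+ inversions w

sum-content : ∀ (w : Vec (Fin n) m) → Vec.sum (content w) ≡ m

below-updateAt : ∀ (i : Fin n) α → below i (updateAt α i suc) ≡ below i α
below-updateAt Fin.zero    (x ∷ α) = refl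
below-updateAt (Fin.suc i) (x ∷ α) = cong (x ℕ.+_) (below-updateAt i α)

sum-updateAt : ∀ (i : Fin n) α → Vec.sum (updateAt α i suc) ≡ suc (Vec.sum α)
sum-updateAt Fin.zero    (x ∷ α) = refl
sum-updateAt (Fin.suc i) (x ∷ α) = trans (cong (x ℕ.+_) (sum-updateAt i α)) (ℕ.+-suc x _)

updateAt-suc-injective : ∀ (i : Fin n) {α β} → updateAt α i suc ≡ updateAt β i suc → α ≡ β
updateAt-suc-injective Fin.zero    {x ∷ α} {y ∷ β} eq =
  cong₂ _∷_ (ℕ.suc-injective (Vec.∷-injectiveˡ eq)) (Vec.∷-injectiveʳ eq)
updateAt-suc-injective (Fin.suc i) {x ∷ α} {y ∷ β} eq =
  cong₂ _∷_ (Vec.∷-injectiveˡ eq) (updateAt-suc-injective i (Vec.∷-injectiveʳ eq))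

-- Decides whether a word of content α can begin with i; in that case β is the content of the rest.
lookup≡0⊎updateAt : ∀ (i : Fin n) α → lookup α i ≡ 0 ⊎ ∃[ β ] α ≡ updateAt β i suc
lookup≡0⊎updateAt Fin.zero    (zero  ∷ α) = inj₁ refl
lookup≡0⊎updateAt Fin.zero    (suc x ∷ α) = inj₂ (x ∷ α , refl)
lookup≡0⊎updateAt (Fin.suc i) (x ∷ α) with lookup≡0⊎updateAt i α
... | inj₁ α≡0         = inj₁ α≡0
... | inj₂ (β , refl)  = inj₂ (x ∷ β , refl)

sum-content {n} []      = sum-replicate n
  where
  sum-replicate : ∀ n → Vec.sum (Vec.replicate n 0) ≡ 0
  sum-replicate zero    = refl
  sum-replicate (suc n) = sum-replicate n
sum-content (i ∷ w) = trans (sum-updateAt i (content w)) (cong suc (sum-content w))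

sum≡0⇒replicate : ∀ (α : Vec ℕ n) → Vec.sum α ≡ 0 → α ≡ Vec.replicate n 0
sum≡0⇒replicate []         _  = refl
sum≡0⇒replicate (zero ∷ α) eq = cong (0 ∷_) (sum≡0⇒replicate α eq)

-- The q-multinomial count of words by inversions

module Multinomial (d : ℕ) where

  open Modulo d
  open SetoidReasoning setoid
  open SemiringSolver (seriesSemiring d) using (solve; _:=_; _:+_; _:*_)

  pochs 1/pochs : Vec ℕ n → Series
  pochs []      = 𝟙
  pochs (x ∷ α) = poch x ⊗ pochs α
  1/pochs []      = 𝟙
  1/pochs (x ∷ α) = 1/poch x ⊗ 1/pochs α

  pochs-1/pochs : ∀ (α : Vec ℕ n) → pochs α ⊗ 1/pochs α ≈ 𝟙
  pochs-1/pochs []      = *-identityˡ 𝟙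
  pochs-1/pochs (x ∷ α) = ≈-trans
    (solve 4 (λ x y z w → x :* y :* (z :* w) := x :* z :* (y :* w)) ≈-refl
      (poch x) (pochs α) (1/poch x) (1/pochs α))
    (≈-trans (*-cong (poch-1/poch x) (pochs-1/pochs α)) (*-identityˡ 𝟙))

  pochs-updateAt : ∀ (i : Fin n) α → pochs (updateAt α i suc) ≈ 1-q^ˢ suc (lookup α i) ⊗ pochs α
  pochs-updateAt Fin.zero    (x ∷ α) =
    solve 3 (λ x y z → x :* y :* z := y :* (x :* z)) ≈-refl (poch x) (1-q^ˢ suc x) (pochs α)
  pochs-updateAt (Fin.suc i) (x ∷ α) = ≈-trans (*-congˡ (pochs-updateAt i α))
    (solve 3 (λ x y z → x :* (y :* z) := y :* (x :* z)) ≈-refl (poch x) (1-q^ˢ suc (lookup α i)) (pochs α))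

  pochs-replicate-0 : ∀ n → pochs (Vec.replicate n 0) ≈ 𝟙
  pochs-replicate-0 zero    = ≈-refl
  pochs-replicate-0 (suc n) = ≈-trans (*-identityˡ _) (pochs-replicate-0 n)

  -- The sum telescopes: its i-th term is q^{s} - q^{s'}, where s and s' are the sums of the entries
  -- of α before i and up to i.
  sum-below : ∀ (α : Vec ℕ n) →
    sum (allFin n) (λ i → q^ below i α ⊗ 1-q^ˢ lookup α i) ⊕ q^ Vec.sum α ≈ 𝟙
  sum-below []      = ≈-trans (+-identityˡ _) q^0≈1
  sum-below {suc n} (x ∷ α) = begin
    sum (allFin (suc n)) (λ i → q^ below i (x ∷ α) ⊗ 1-q^ˢ lookup (x ∷ α) i) ⊕ q^ (x ℕ.+ Vec.sum α)
      ≈⟨ +-cong (reflexive (sum-allFin n _)) (q^-+ x (Vec.sum α)) ⟩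
    q^ 0 ⊗ 1-q^ˢ x ⊕ sum (allFin n) (λ i → q^ (x ℕ.+ below i α) ⊗ 1-q^ˢ lookup α i) ⊕ q^ x ⊗ q^ Vec.sum α
      ≈⟨ +-congʳ (+-cong (≈-trans (*-congʳ q^0≈1) (*-identityˡ _))
           (≈-trans (sum-cong (allFin n) λ i → ≈-trans (*-congʳ (q^-+ x (below i α))) (*-assoc _ _ _))
                    (≈-sym (*-sum (q^ x) (allFin n) _)))) ⟩
    1-q^ˢ x ⊕ q^ x ⊗ sum (allFin n) (λ i → q^ below i α ⊗ 1-q^ˢ lookup α i) ⊕ q^ x ⊗ q^ Vec.sum α
      ≈⟨ solve 4 (λ p y s z → p :+ y :* s :+ y :* z := p :+ y :* (s :+ z)) ≈-refl (1-q^ˢ x) (q^ x) _ (q^ Vec.sum α) ⟩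
    1-q^ˢ x ⊕ q^ x ⊗ (sum (allFin n) (λ i → q^ below i α ⊗ 1-q^ˢ lookup α i) ⊕ q^ Vec.sum α)
      ≈⟨ +-congˡ (≈-trans (*-congˡ (sum-below α)) (*-identityʳ _)) ⟩
    1-q^ˢ x ⊕ q^ x
      ≈⟨ 1-q^+q^≈1 x ⟩
    𝟙  ∎

  multinomial : ∀ m → Vec ℕ n → Series
  multinomial {n} m α = sum (words n m) (λ w → [ content w ≟ᶜ α ] ⊗ q^ inversions w)

  private
    firstLetter : ∀ m → Vec ℕ n → Fin n → Series
    firstLetter {n} m α i = sum (words n m) (λ w → [ content (i ∷ w) ≟ᶜ α ] ⊗ q^ inversions (i ∷ w))

    multinomial-suc : ∀ m (α : Vec ℕ n) → multinomial (suc m) α ≈ sum (allFin n) (firstLetter m α)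
    multinomial-suc {n} m α = sum-cartesianProductWith _∷_ (allFin n) (words n m) _

    firstLetter-absent : ∀ m (α : Vec ℕ n) i → lookup α i ≡ 0 → firstLetter m α i ≈ 𝟘
    firstLetter-absent {n} m α i αᵢ≡0 = sum-0 (words n m) λ {w} _ →
      ≈-trans (*-congʳ ([]-no (content (i ∷ w) ≟ᶜ α) λ { refl →
        contradiction (trans (sym αᵢ≡0) (Vec.lookup∘updateAt i (content w))) λ () })) (zeroˡ _)

    -- The leading i forms the same number of inversions with every rest of content α, so its
    -- contribution leaves the sum.
    firstLetter-present : ∀ m (α : Vec ℕ n) i →
      firstLetter m (updateAt α i suc) i ≈ q^ below i α ⊗ multinomial m α
    firstLetter-present {n} m α i = ≈-trans (sum-cong (words n m) pull) (≈-sym (*-sum _ (words n m) _))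
      where
      pull : ∀ w → [ content (i ∷ w) ≟ᶜ updateAt α i suc ] ⊗ q^ inversions (i ∷ w) ≈
                   q^ below i α ⊗ ([ content w ≟ᶜ α ] ⊗ q^ inversions w)
      pull w with content w ≟ᶜ α
      ... | yes eq = begin
        [ content (i ∷ w) ≟ᶜ updateAt α i suc ] ⊗ q^ inversions (i ∷ w)
          ≈⟨ *-cong ([]-yes (content (i ∷ w) ≟ᶜ updateAt α i suc) (cong (λ β → updateAt β i suc) eq)) (q^-+ (below i (content w)) _) ⟩
        𝟙 ⊗ (q^ below i (content w) ⊗ q^ inversions w)
          ≈⟨ *-congˡ (*-congʳ (reflexive (cong (λ β → q^ below i β) eq))) ⟩
        𝟙 ⊗ (q^ below i α ⊗ q^ inversions w)
          ≈⟨ solve 3 (λ x y z → x :* (y :* z) := y :* (x :* z)) ≈-refl 𝟙 (q^ below i α) (q^ inversions w) ⟩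
        q^ below i α ⊗ (𝟙 ⊗ q^ inversions w)  ∎
      ... | no  ≢α = begin
        [ content (i ∷ w) ≟ᶜ updateAt α i suc ] ⊗ q^ inversions (i ∷ w)
          ≈⟨ *-congʳ ([]-no (content (i ∷ w) ≟ᶜ updateAt α i suc) (≢α ∘ updateAt-suc-injective i)) ⟩
        𝟘 ⊗ q^ inversions (i ∷ w)
          ≈⟨ ≈-trans (zeroˡ _) (≈-sym (≈-trans (*-congˡ (zeroˡ _)) (zeroʳ _))) ⟩
        q^ below i α ⊗ (𝟘 ⊗ q^ inversions w)  ∎

  -- Induction on the length by the first letter i. Removing it lowers α_i by one, which costs the
  -- factor 1 - q^{α_i} of (q)_{α_i}; this factor is 0 exactly for a letter that does not occur, so
  -- absent letters need no separate count. The resulting sum over i is 1 - q^{m+1} by `sum-below`.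
  -- The multiplied form avoids division.
  multinomial-pochs : ∀ m (α : Vec ℕ n) → Vec.sum α ≡ m → multinomial m α ⊗ pochs α ≈ poch m
  multinomial-pochs {n} zero α |α|≡0 rewrite sum≡0⇒replicate α |α|≡0 = begin
    ([ Vec.replicate n 0 ≟ᶜ Vec.replicate n 0 ] ⊗ q^ 0 ⊕ 𝟘) ⊗ pochs (Vec.replicate n 0)
      ≈⟨ *-cong (≈-trans (+-identityʳ _) (*-cong ([]-yes (Vec.replicate n 0 ≟ᶜ _) refl) q^0≈1)) (pochs-replicate-0 n) ⟩
    𝟙 ⊗ 𝟙 ⊗ 𝟙
      ≈⟨ ≈-trans (*-identityʳ _) (*-identityʳ _) ⟩
    𝟙  ∎
  multinomial-pochs {n} (suc m) α |α|≡1+m = begin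
    multinomial (suc m) α ⊗ pochs α
      ≈⟨ *-congʳ (multinomial-suc m α) ⟩
    sum (allFin n) (firstLetter m α) ⊗ pochs α
      ≈⟨ sum-* (allFin n) _ _ ⟩
    sum (allFin n) (λ i → firstLetter m α i ⊗ pochs α)
      ≈⟨ sum-cong (allFin n) step ⟩
    sum (allFin n) (λ i → q^ below i α ⊗ 1-q^ˢ lookup α i ⊗ poch m)
      ≈⟨ sum-* (allFin n) _ _ ⟨
    sum (allFin n) (λ i → q^ below i α ⊗ 1-q^ˢ lookup α i) ⊗ poch m
      ≈⟨ *-congʳ (⊕-cancelʳ (≈-trans (sum-below α) (≈-sym (1-q^+q^≈1 (suc m)))) (reflexive (cong q^_ |α|≡1+m))) ⟩
    1-q^ˢ suc m ⊗ poch m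
      ≈⟨ *-comm _ _ ⟩
    poch (suc m)  ∎
    where
    step : ∀ i → firstLetter m α i ⊗ pochs α ≈ q^ below i α ⊗ 1-q^ˢ lookup α i ⊗ poch m
    step i with lookup≡0⊎updateAt i α
    ... | inj₁ αᵢ≡0 = begin
      firstLetter m α i ⊗ pochs α                  ≈⟨ *-congʳ (firstLetter-absent m α i αᵢ≡0) ⟩
      𝟘 ⊗ pochs α                                  ≈⟨ ≈-trans (zeroˡ _) (≈-sym (zeroˡ _)) ⟩
      𝟘 ⊗ poch m                                   ≈⟨ *-congʳ (≈-trans (*-congˡ (≈-trans (reflexive (cong 1-q^ˢ_ αᵢ≡0)) 1-q^0≈0)) (zeroʳ _)) ⟨
      q^ below i α ⊗ 1-q^ˢ lookup α i ⊗ poch m     ∎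
    ... | inj₂ (β , refl) = begin
      firstLetter m (updateAt β i suc) i ⊗ pochs (updateAt β i suc)
        ≈⟨ *-cong (firstLetter-present m β i) (pochs-updateAt i β) ⟩
      q^ below i β ⊗ multinomial m β ⊗ (1-q^ˢ suc (lookup β i) ⊗ pochs β)
        ≈⟨ solve 4 (λ x y z w → x :* y :* (z :* w) := x :* z :* (y :* w)) ≈-refl
             (q^ below i β) (multinomial m β) (1-q^ˢ suc (lookup β i)) (pochs β) ⟩
      q^ below i β ⊗ 1-q^ˢ suc (lookup β i) ⊗ (multinomial m β ⊗ pochs β)
        ≈⟨ *-cong (*-cong (reflexive (cong q^_ (sym (below-updateAt i β)))) (reflexive (cong 1-q^ˢ_ (sym (Vec.lookup∘updateAt i β)))))
             (multinomial-pochs m β (ℕ.suc-injective (trans (sym (sum-updateAt i β)) |α|≡1+m))) ⟩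
      q^ below i (updateAt β i suc) ⊗ 1-q^ˢ lookup (updateAt β i suc) i ⊗ poch m  ∎

  -- From x ≥ d follows m ≥ d, so (q)_m and (q)_x agree modulo q^{d+1} and cancel in the multinomial
  -- coefficient.
  multinomial-limit : ∀ m x (v : Vec ℕ n) → x ℕ.+ Vec.sum v ≡ m → d ≤ x →
                      multinomial m (x ∷ v) ≈ 1/pochs v
  multinomial-limit m x v |α|≡m d≤x = inverse-unique (begin
    pochs v ⊗ multinomial m (x ∷ v)
      ≈⟨ *-identityʳ _ ⟨
    pochs v ⊗ multinomial m (x ∷ v) ⊗ 𝟙
      ≈⟨ *-congˡ (poch-1/poch x) ⟨
    pochs v ⊗ multinomial m (x ∷ v) ⊗ (poch x ⊗ 1/poch x)
      ≈⟨ solve 4 (λ v m p r → v :* m :* (p :* r) := m :* (p :* v) :* r) ≈-refl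
           (pochs v) (multinomial m (x ∷ v)) (poch x) (1/poch x) ⟩
    multinomial m (x ∷ v) ⊗ (poch x ⊗ pochs v) ⊗ 1/poch x
      ≈⟨ *-congʳ (≈-trans (multinomial-pochs m (x ∷ v) |α|≡m) (poch-stable (ℕ.≤-trans d≤x x≤m) d≤x)) ⟩
    poch x ⊗ 1/poch x
      ≈⟨ poch-1/poch x ⟩
    𝟙  ∎) (pochs-1/pochs v)
    where x≤m = ℕ.≤-trans (ℕ.m≤m+n x (Vec.sum v)) (ℕ.≤-reflexive |α|≡m)

-- Pairs of contents with a given difference

private variable
  r : ℕ

diff : Vec ℕ r → Vec ℕ r → Exponent r
diff = Vec.zipWith (λ x y → + y ℤ.- + x)

dot : Vec ℕ r → Vec ℕ r → ℕ
dot []      []      = 0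
dot (x ∷ v) (y ∷ w) = x ℕ.* y ℕ.+ dot v w

pos neg : ℤ → ℕ
pos (+ k)    = k
pos -[1+ k ] = 0
neg (+ k)    = 0
neg -[1+ k ] = suc k

-- The pair `shift neg δ t`, `shift pos δ t` is the pair of contents with difference δ and common
-- part t. Its dot product is `area δ t`, since in each coordinate `pos` or `neg` is 0.
shift : (ℤ → ℕ) → Exponent r → Vec ℕ r → Vec ℕ r
shift f = Vec.zipWith (λ c t → t ℕ.+ f c)

area : Exponent r → Vec ℕ r → ℕ
area []      []      = 0
area (c ∷ δ) (t ∷ v) = t ℕ.* (t ℕ.+ ℤ.∣ c ∣) ℕ.+ area δ v

absSum : Exponent r → ℕ
absSum []      = 0
absSum (c ∷ δ) = ℤ.∣ c ∣ ℕ.+ absSum δ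

sum-shift : ∀ f → (∀ c → f c ≤ ℤ.∣ c ∣) → (δ : Exponent r) (t : Vec ℕ r) →
            Vec.sum (shift f δ t) ≤ Vec.sum t ℕ.+ absSum δ
sum-shift f f≤ []      []      = z≤n
sum-shift f f≤ (c ∷ δ) (x ∷ t) = begin
  (x ℕ.+ f c) ℕ.+ Vec.sum (shift f δ t)               ≤⟨ ℕ.+-mono-≤ (ℕ.+-monoʳ-≤ x (f≤ c)) (sum-shift f f≤ δ t) ⟩
  (x ℕ.+ ℤ.∣ c ∣) ℕ.+ (Vec.sum t ℕ.+ absSum δ)        ≡⟨ regroup x ℤ.∣ c ∣ (Vec.sum t) (absSum δ) ⟩
  x ℕ.+ Vec.sum t ℕ.+ (ℤ.∣ c ∣ ℕ.+ absSum δ)          ∎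
  where
  open ℕ.≤-Reasoning
  regroup : ∀ a b c d → a ℕ.+ b ℕ.+ (c ℕ.+ d) ≡ a ℕ.+ c ℕ.+ (b ℕ.+ d)
  regroup = ℕ.solve-∀

pos≤∣∣ : ∀ c → pos c ≤ ℤ.∣ c ∣
pos≤∣∣ (+ k)    = ℕ.≤-refl
pos≤∣∣ -[1+ k ] = z≤n

neg≤∣∣ : ∀ c → neg c ≤ ℤ.∣ c ∣
neg≤∣∣ (+ k)    = z≤n
neg≤∣∣ -[1+ k ] = ℕ.≤-refl

pos-neg : ∀ c t → + (t ℕ.+ pos c) ℤ.- + (t ℕ.+ neg c) ≡ c
pos-neg c t = trans (cong₂ (λ x y → x ℤ.- y) (ℤ.pos-+ t (pos c)) (ℤ.pos-+ t (neg c)))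
  (trans (cancel (+ t) (+ pos c) (+ neg c)) (pos-neg₀ c))
  where
  cancel : ∀ t x y → t ℤ.+ x ℤ.- (t ℤ.+ y) ≡ x ℤ.- y
  cancel = ℤ.solve-∀
  pos-neg₀ : ∀ c → + pos c ℤ.- + neg c ≡ c
  pos-neg₀ (+ k)    = ℤ.+-identityʳ (+ k)
  pos-neg₀ -[1+ k ] = refl

area-shift : ∀ c t → (t ℕ.+ neg c) ℕ.* (t ℕ.+ pos c) ≡ t ℕ.* (t ℕ.+ ℤ.∣ c ∣)
area-shift (+ k)    t = cong (ℕ._* (t ℕ.+ k)) (ℕ.+-identityʳ t)
area-shift -[1+ k ] t = trans (cong ((t ℕ.+ suc k) ℕ.*_) (ℕ.+-identityʳ t)) (ℕ.*-comm (t ℕ.+ suc k) t)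

-- The pairs (x , y) with y - x = c are the (t + neg c , t + pos c).
common-part : ∀ c {x y} → + y ℤ.- + x ≡ c → ∃[ t ] (x ≡ t ℕ.+ neg c × y ≡ t ℕ.+ pos c)
common-part (+ k) {x} {y} y-x≡c = x , sym (ℕ.+-identityʳ x) , ℤ.+-injective (begin
  + y                      ≡⟨ ℤGroup.//-rightDividesˡ (+ x) (+ y) ⟨
  + y ℤ.- + x ℤ.+ + x      ≡⟨ cong (ℤ._+ + x) y-x≡c ⟩
  + k ℤ.+ + x              ≡⟨ ℤ.+-comm (+ k) (+ x) ⟩
  + (x ℕ.+ k)              ∎)
  where open ≡-Reasoning
common-part -[1+ k ] {x} {y} y-x≡c = y , ℤ.+-injective (begin
  + x                                   ≡⟨ swap (+ x) (+ y) ⟩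
  + y ℤ.- (+ y ℤ.- + x)                 ≡⟨ cong (λ z → + y ℤ.- z) y-x≡c ⟩
  + (y ℕ.+ suc k)                       ∎) , sym (ℕ.+-identityʳ y)
  where
  open ≡-Reasoning
  swap : ∀ x y → x ≡ y ℤ.- (y ℤ.- x)
  swap = ℤ.solve-∀

-- The sum over pairs of long words, modulo q^{d+1}

module Limit (d : ℕ) where

  open Modulo d
  open Durfee d
  open Multinomial d
  open SetoidReasoning setoid
  open SemiringSolver (seriesSemiring d) using (solve; _:=_; _:*_)

  -- A common part with a coordinate above d has area above d, so this finite range suffices.
  box : ∀ r → List (Vec ℕ r)
  box zero    = [] ∷ []
  box (suc r) = cartesianProductWith _∷_ (upTo (suc d)) (box r)

  sum-∈-box : ∀ {t : Vec ℕ r} → t ∈ box r → Vec.sum t ≤ r ℕ.* d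
  sum-∈-box {zero}  {[]} _ = z≤n
  sum-∈-box {suc r} t∈ with ∈.∈-cartesianProductWith⁻ _∷_ (upTo (suc d)) (box r) t∈
  ... | x , t , x∈ , t∈′ , refl = ℕ.+-mono-≤ (ℕ.s≤s⁻¹ (∈.∈-upTo⁻ x∈)) (sum-∈-box t∈′)

  private
    coordinate : ℕ → ℕ → ℤ → ℕ → Series
    coordinate x y c t = [ x ℕ.≟ t ℕ.+ neg c ] ⊗ [ y ℕ.≟ t ℕ.+ pos c ] ⊗ q^ (t ℕ.* (t ℕ.+ ℤ.∣ c ∣))

    coordinate≈0 : ∀ {x y c t} → ¬ (x ≡ t ℕ.+ neg c × y ≡ t ℕ.+ pos c) → coordinate x y c t ≈ 𝟘
    coordinate≈0 {x} {y} {c} {t} ¬eq = ≈-trans (*-congʳ (≈-trans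
      (≈-sym ([]-× x≟ y≟)) ([]-no (x≟ ×-dec y≟) ¬eq))) (zeroˡ _)
      where
      x≟ = x ℕ.≟ t ℕ.+ neg c
      y≟ = y ℕ.≟ t ℕ.+ pos c

    coordinate-diagonal : ∀ c t → coordinate (t ℕ.+ neg c) (t ℕ.+ pos c) c t ≈ q^ (t ℕ.* (t ℕ.+ ℤ.∣ c ∣))
    coordinate-diagonal c t = ≈-trans
      (*-congʳ (*-cong ([]-yes (t ℕ.+ neg c ℕ.≟ t ℕ.+ neg c) refl) ([]-yes (t ℕ.+ pos c ℕ.≟ t ℕ.+ pos c) refl)))
      (≈-trans (*-congʳ (*-identityˡ 𝟙)) (*-identityˡ _))

  -- The condition y - x = c couples x and y. Summing over the common part t replaces it by a
  -- product of a condition on x and a condition on y, after which the two words can be summed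
  -- independently.
  sum-coordinate : ∀ x y c →
    [ (+ y ℤ.- + x) ℤ.≟ c ] ⊗ q^ (x ℕ.* y) ≈ sum (upTo (suc d)) (coordinate x y c)
  sum-coordinate x y c with (+ y ℤ.- + x) ℤ.≟ c
  ... | no  ≢c = ≈-trans (zeroˡ _) (≈-sym (sum-0 (upTo (suc d)) λ {t} _ →
    coordinate≈0 {x} {y} {c} {t} λ { (refl , refl) → ≢c (pos-neg c t) }))
  ... | yes eq with common-part c {x} {y} eq
  ... | t , refl , refl = begin
    𝟙 ⊗ q^ ((t ℕ.+ neg c) ℕ.* (t ℕ.+ pos c))
      ≈⟨ *-identityˡ _ ⟩
    q^ ((t ℕ.+ neg c) ℕ.* (t ℕ.+ pos c))
      ≡⟨ cong q^_ (area-shift c t) ⟩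
    q^ (t ℕ.* (t ℕ.+ ℤ.∣ c ∣))
      ≈⟨ evaluate (t ℕ.<? suc d) ⟨
    sum (upTo (suc d)) (coordinate (t ℕ.+ neg c) (t ℕ.+ pos c) c)  ∎
    where
    off-diagonal : ∀ {s} → s ≢ t → coordinate (t ℕ.+ neg c) (t ℕ.+ pos c) c s ≈ 𝟘
    off-diagonal {s} s≢t = coordinate≈0 {t ℕ.+ neg c} {t ℕ.+ pos c} {c} {s} λ (p , _) → s≢t (sym (ℕ.+-cancelʳ-≡ (neg c) t s p))

    evaluate : Dec (t < suc d) →
      sum (upTo (suc d)) (coordinate (t ℕ.+ neg c) (t ℕ.+ pos c) c) ≈ q^ (t ℕ.* (t ℕ.+ ℤ.∣ c ∣))
    evaluate (yes t≤d) = ≈-trans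
      (sum-single _ (Unique.upTo⁺ (suc d)) (∈.∈-upTo⁺ t≤d) off-diagonal) (coordinate-diagonal c t)
    -- Here the common part is outside the range of summation, but then t(t + |c|) ≥ t > d and the
    -- left side vanishes as well.
    evaluate (no  t≰d) = ≈-trans
      (sum-0 (upTo (suc d)) λ s∈ → off-diagonal λ { refl → t≰d (∈.∈-upTo⁻ s∈) })
      (≈-sym (q^≈0 d<))
      where
      d<t = ℕ.≰⇒> (t≰d ∘ s≤s)
      d< : d < t ℕ.* (t ℕ.+ ℤ.∣ c ∣)
      d< = ℕ.<-≤-trans d<t (ℕ.m≤m*n t (t ℕ.+ ℤ.∣ c ∣)
        {{ℕ.>-nonZero (ℕ.≤-trans (ℕ.≤-trans (s≤s z≤n) d<t) (ℕ.m≤m+n t _))}})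

  private
    []-∷ᶜ : ∀ x y (v w : Vec ℕ r) → [ (x ∷ v) ≟ᶜ (y ∷ w) ] ≈ [ x ℕ.≟ y ] ⊗ [ v ≟ᶜ w ]
    []-∷ᶜ x y v w = ≈-trans
      ([]-⇔ ((x ∷ v) ≟ᶜ (y ∷ w)) ((x ℕ.≟ y) ×-dec (v ≟ᶜ w)) (λ { refl → refl , refl }) (λ { (refl , refl) → refl }))
      ([]-× (x ℕ.≟ y) (v ≟ᶜ w))

    []-∷ᴱ : ∀ x y (v w : Exponent r) → [ (x ∷ v) ≟ᴱ (y ∷ w) ] ≈ [ x ℤ.≟ y ] ⊗ [ v ≟ᴱ w ]
    []-∷ᴱ x y v w = ≈-trans
      ([]-⇔ ((x ∷ v) ≟ᴱ (y ∷ w)) ((x ℤ.≟ y) ×-dec (v ≟ᴱ w)) (λ { refl → refl , refl }) (λ { (refl , refl) → refl }))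
      ([]-× (x ℤ.≟ y) (v ≟ᴱ w))

  sum-box : ∀ (δ : Exponent r) v w → [ diff v w ≟ᴱ δ ] ⊗ q^ dot v w ≈
    sum (box r) (λ t → [ v ≟ᶜ shift neg δ t ] ⊗ [ w ≟ᶜ shift pos δ t ] ⊗ q^ area δ t)
  sum-box []      []      []      = ≈-trans
    (≈-sym (*-congʳ (*-identityˡ 𝟙))) (≈-sym (+-identityʳ _))
  sum-box {suc r} (c ∷ δ) (x ∷ v) (y ∷ w) = begin
    [ diff (x ∷ v) (y ∷ w) ≟ᴱ (c ∷ δ) ] ⊗ q^ (x ℕ.* y ℕ.+ dot v w)
      ≈⟨ *-cong ([]-∷ᴱ (+ y ℤ.- + x) c (diff v w) δ) (q^-+ (x ℕ.* y) (dot v w)) ⟩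
    [ (+ y ℤ.- + x) ℤ.≟ c ] ⊗ [ diff v w ≟ᴱ δ ] ⊗ (q^ (x ℕ.* y) ⊗ q^ dot v w)
      ≈⟨ solve 4 (λ a b e f → a :* b :* (e :* f) := a :* e :* (b :* f)) ≈-refl
           [ (+ y ℤ.- + x) ℤ.≟ c ] [ diff v w ≟ᴱ δ ] (q^ (x ℕ.* y)) (q^ dot v w) ⟩
    [ (+ y ℤ.- + x) ℤ.≟ c ] ⊗ q^ (x ℕ.* y) ⊗ ([ diff v w ≟ᴱ δ ] ⊗ q^ dot v w)
      ≈⟨ *-cong (sum-coordinate x y c) (sum-box δ v w) ⟩
    sum (upTo (suc d)) (coordinate x y c) ⊗ sum (box r) (rest δ v w)
      ≈⟨ sum-*-sum (upTo (suc d)) (box r) (coordinate x y c) (rest δ v w) ⟩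
    sum (upTo (suc d)) (λ s → sum (box r) (λ t → coordinate x y c s ⊗ rest δ v w t))
      ≈⟨ sum-cong (upTo (suc d)) (λ s → sum-cong (box r) λ t → merge s t) ⟩
    sum (upTo (suc d)) (λ s → sum (box r) (λ t → rest (c ∷ δ) (x ∷ v) (y ∷ w) (s ∷ t)))
      ≈⟨ sum-cartesianProductWith _∷_ (upTo (suc d)) (box r) (rest (c ∷ δ) (x ∷ v) (y ∷ w)) ⟨
    sum (box (suc r)) (rest (c ∷ δ) (x ∷ v) (y ∷ w))  ∎
    where
    rest : ∀ {r} → Exponent r → (v w : Vec ℕ r) → Vec ℕ r → Series
    rest δ v w t = [ v ≟ᶜ shift neg δ t ] ⊗ [ w ≟ᶜ shift pos δ t ] ⊗ q^ area δ t

    merge : ∀ s t → coordinate x y c s ⊗ rest δ v w t ≈ rest (c ∷ δ) (x ∷ v) (y ∷ w) (s ∷ t)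
    merge s t = ≈-trans
      (solve 6 (λ a b e f g h → a :* b :* e :* (f :* g :* h) := a :* f :* (b :* g) :* (e :* h)) ≈-refl
        [ x ℕ.≟ s ℕ.+ neg c ] [ y ℕ.≟ s ℕ.+ pos c ] (q^ (s ℕ.* (s ℕ.+ ℤ.∣ c ∣)))
        [ v ≟ᶜ shift neg δ t ] [ w ≟ᶜ shift pos δ t ] (q^ area δ t))
      (≈-sym (*-cong (*-cong ([]-∷ᶜ x (s ℕ.+ neg c) v (shift neg δ t)) ([]-∷ᶜ y (s ℕ.+ pos c) w (shift pos δ t)))
                     (q^-+ _ (area δ t))))

  -- The sum over the box is a product over the coordinates, and the factor for the entry c is the
  -- Durfee sum for |c|: the sign of c only decides which of the two denominators is the larger one.
  sum-rectangles : ∀ (δ : Exponent r) →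
    sum (box r) (λ t → q^ area δ t ⊗ (1/pochs (shift neg δ t) ⊗ 1/pochs (shift pos δ t))) ≈ 1/poch d ^ˢ r
  sum-rectangles []      = ≈-trans (+-identityʳ _)
    (≈-trans (*-cong q^0≈1 (*-identityˡ 𝟙)) (*-identityˡ 𝟙))
  sum-rectangles {suc r} (c ∷ δ) = begin
    sum (box (suc r)) (f (c ∷ δ))
      ≈⟨ sum-cartesianProductWith _∷_ (upTo (suc d)) (box r) (f (c ∷ δ)) ⟩
    sum (upTo (suc d)) (λ s → sum (box r) (λ t → f (c ∷ δ) (s ∷ t)))
      ≈⟨ sum-cong (upTo (suc d)) (λ s → sum-cong (box r) λ t → split s t) ⟩
    sum (upTo (suc d)) (λ s → sum (box r) (λ t → rectangle ℤ.∣ c ∣ s ⊗ f δ t))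
      ≈⟨ sum-*-sum (upTo (suc d)) (box r) (rectangle ℤ.∣ c ∣) (f δ) ⟨
    durfee ℤ.∣ c ∣ ⊗ sum (box r) (f δ)
      ≈⟨ *-cong (durfee≈1/poch ℤ.∣ c ∣) (sum-rectangles δ) ⟩
    1/poch d ^ˢ suc r  ∎
    where
    f : ∀ {r} → Exponent r → Vec ℕ r → Series
    f δ t = q^ area δ t ⊗ (1/pochs (shift neg δ t) ⊗ 1/pochs (shift pos δ t))

    sides : ∀ c s → 1/poch (s ℕ.+ neg c) ⊗ 1/poch (s ℕ.+ pos c) ≈ 1/poch s ⊗ 1/poch (s ℕ.+ ℤ.∣ c ∣)
    sides (+ k)    s = *-congʳ (reflexive (cong 1/poch (ℕ.+-identityʳ s)))
    sides -[1+ k ] s = ≈-trans (*-comm _ _) (*-congʳ (reflexive (cong 1/poch (ℕ.+-identityʳ s))))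

    split : ∀ s t → f (c ∷ δ) (s ∷ t) ≈ rectangle ℤ.∣ c ∣ s ⊗ f δ t
    split s t = ≈-trans (*-congʳ (q^-+ _ (area δ t))) (≈-trans
      (solve 6 (λ a b u v x y → a :* b :* (u :* v :* (x :* y)) := a :* (u :* x) :* (b :* (v :* y))) ≈-refl
        (q^ (s ℕ.* (s ℕ.+ ℤ.∣ c ∣))) (q^ area δ t)
        (1/poch (s ℕ.+ neg c)) (1/pochs (shift neg δ t)) (1/poch (s ℕ.+ pos c)) (1/pochs (shift pos δ t)))
      (*-congʳ (*-congˡ (sides c s))))

  -- The length m and the multiplicities of the other letters determine the number of letters 1. By
  -- hypothesis it is at least d, so `multinomial-limit` applies.
  fixedTail : ∀ m (v : Vec ℕ r) → d ℕ.+ Vec.sum v ≤ m →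
    sum (words (suc r) m) (λ w → [ Vec.tail (content w) ≟ᶜ v ] ⊗ q^ inversions w) ≈ 1/pochs v
  fixedTail {r} m v d+v≤m = ≈-trans
    (sum-cong (words (suc r) m) λ w → *-congʳ ([]-⇔ (Vec.tail (content w) ≟ᶜ v) (content w ≟ᶜ (m ∸ Vec.sum v ∷ v))
      (determined (content w) (sum-content w)) (cong Vec.tail)))
    (multinomial-limit m (m ∸ Vec.sum v) v (ℕ.m∸n+n≡m (ℕ.≤-trans (ℕ.m≤n+m (Vec.sum v) d) d+v≤m))
      (ℕ.m+n≤o⇒m≤o∸n d d+v≤m))
    where
    determined : ∀ α → Vec.sum α ≡ m → Vec.tail α ≡ v → α ≡ m ∸ Vec.sum v ∷ v
    determined (x ∷ v) |α|≡m refl = cong (_∷ v)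
      (sym (trans (cong (_∸ Vec.sum v) (sym |α|≡m)) (ℕ.m+n∸n≡m x (Vec.sum v))))

  -- In the threshold, r d bounds the sum of a common part in the box, `absSum δ` what `shift` can
  -- add to it, and the first d is the number of letters 1 required by `fixedTail`.
  sum-words : ∀ m (δ : Exponent r) → d ℕ.+ (r ℕ.* d ℕ.+ absSum δ) ≤ m →
    sum (words (suc r) m) (λ a → sum (words (suc r) m) λ b →
      [ diff (Vec.tail (content a)) (Vec.tail (content b)) ≟ᴱ δ ]
        ⊗ q^ (dot (Vec.tail (content a)) (Vec.tail (content b)) ℕ.+ (inversions a ℕ.+ inversions b)))
    ≈ 1/poch d ^ˢ r
  sum-words {r} m δ m≥ = begin
    sum ws (λ a → sum ws λ b →
      [ diff (tl a) (tl b) ≟ᴱ δ ] ⊗ q^ (dot (tl a) (tl b) ℕ.+ (inversions a ℕ.+ inversions b)))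
      ≈⟨ sum-cong ws (λ a → sum-cong ws (expand a)) ⟩
    sum ws (λ a → sum ws λ b → sum (box r) λ t → q^ area δ t ⊗ (A t a ⊗ B t b))
      ≈⟨ sum-cong ws (λ a → sum-swap ws (box r) _) ⟩
    sum ws (λ a → sum (box r) λ t → sum ws λ b → q^ area δ t ⊗ (A t a ⊗ B t b))
      ≈⟨ sum-swap ws (box r) _ ⟩
    sum (box r) (λ t → sum ws λ a → sum ws λ b → q^ area δ t ⊗ (A t a ⊗ B t b))
      ≈⟨ sum-cong-∈ (box r) collect ⟩
    sum (box r) (λ t → q^ area δ t ⊗ (1/pochs (shift neg δ t) ⊗ 1/pochs (shift pos δ t)))
      ≈⟨ sum-rectangles δ ⟩
    1/poch d ^ˢ r  ∎
    where
    ws = words (suc r) m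
    tl : Vec (Fin (suc r)) m → Vec ℕ r
    tl w = Vec.tail (content w)
    A B : Vec ℕ r → Vec (Fin (suc r)) m → Series
    A t w = [ tl w ≟ᶜ shift neg δ t ] ⊗ q^ inversions w
    B t w = [ tl w ≟ᶜ shift pos δ t ] ⊗ q^ inversions w

    expand : ∀ a b → [ diff (tl a) (tl b) ≟ᴱ δ ] ⊗ q^ (dot (tl a) (tl b) ℕ.+ (inversions a ℕ.+ inversions b)) ≈
                     sum (box r) (λ t → q^ area δ t ⊗ (A t a ⊗ B t b))
    expand a b = begin
      [ diff (tl a) (tl b) ≟ᴱ δ ] ⊗ q^ (dot (tl a) (tl b) ℕ.+ (inversions a ℕ.+ inversions b))
        ≈⟨ *-congˡ (≈-trans (q^-+ (dot (tl a) (tl b)) _) (*-congˡ (q^-+ (inversions a) (inversions b)))) ⟩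
      [ diff (tl a) (tl b) ≟ᴱ δ ] ⊗ (q^ dot (tl a) (tl b) ⊗ (q^ inversions a ⊗ q^ inversions b))
        ≈⟨ *-assoc _ _ _ ⟨
      [ diff (tl a) (tl b) ≟ᴱ δ ] ⊗ q^ dot (tl a) (tl b) ⊗ (q^ inversions a ⊗ q^ inversions b)
        ≈⟨ *-congʳ (sum-box δ (tl a) (tl b)) ⟩
      sum (box r) (λ t → [ tl a ≟ᶜ shift neg δ t ] ⊗ [ tl b ≟ᶜ shift pos δ t ] ⊗ q^ area δ t) ⊗ (q^ inversions a ⊗ q^ inversions b)
        ≈⟨ sum-* (box r) _ _ ⟩
      sum (box r) (λ t → [ tl a ≟ᶜ shift neg δ t ] ⊗ [ tl b ≟ᶜ shift pos δ t ] ⊗ q^ area δ t ⊗ (q^ inversions a ⊗ q^ inversions b))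
        ≈⟨ sum-cong (box r) (λ t → solve 5 (λ u v w x y → u :* v :* w :* (x :* y) := w :* (u :* x :* (v :* y))) ≈-refl
             [ tl a ≟ᶜ shift neg δ t ] [ tl b ≟ᶜ shift pos δ t ] (q^ area δ t) (q^ inversions a) (q^ inversions b)) ⟩
      sum (box r) (λ t → q^ area δ t ⊗ (A t a ⊗ B t b))  ∎

    large : ∀ f → (∀ c → f c ≤ ℤ.∣ c ∣) → ∀ {t} → t ∈ box r → d ℕ.+ Vec.sum (shift f δ t) ≤ m
    large f f≤ {t} t∈ = ℕ.≤-trans (ℕ.+-monoʳ-≤ d (ℕ.≤-trans (sum-shift f f≤ δ t) (ℕ.+-monoˡ-≤ _ (sum-∈-box t∈)))) m≥

    collect : ∀ {t} → t ∈ box r → sum ws (λ a → sum ws λ b → q^ area δ t ⊗ (A t a ⊗ B t b)) ≈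
                                 q^ area δ t ⊗ (1/pochs (shift neg δ t) ⊗ 1/pochs (shift pos δ t))
    collect {t} t∈ = begin
      sum ws (λ a → sum ws λ b → q^ area δ t ⊗ (A t a ⊗ B t b))
        ≈⟨ sum-cong ws (λ a → *-sum _ ws _) ⟨
      sum ws (λ a → q^ area δ t ⊗ sum ws λ b → A t a ⊗ B t b)
        ≈⟨ *-sum _ ws _ ⟨
      q^ area δ t ⊗ sum ws (λ a → sum ws λ b → A t a ⊗ B t b)
        ≈⟨ *-congˡ (sum-*-sum ws ws (A t) (B t)) ⟨
      q^ area δ t ⊗ (sum ws (A t) ⊗ sum ws (B t))
        ≈⟨ *-congˡ (*-cong (fixedTail m _ (large neg neg≤∣∣ t∈)) (fixedTail m _ (large pos pos≤∣∣ t∈))) ⟩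
      q^ area δ t ⊗ (1/pochs (shift neg δ t) ⊗ 1/pochs (shift pos δ t))  ∎

-- The theta function

triangle : ℕ → ℕ
triangle zero    = 0
triangle (suc k) = suc k ℕ.+ triangle k

-- This is (c² + c)/2, which for c = -(k+1) is again k(k+1)/2.
triangleℤ : ℤ → ℕ
triangleℤ (+ k)    = triangle k
triangleℤ -[1+ k ] = triangle k

-- Since c² + c is even, this is ‖γ‖² / 2 when |γ| = 0.
halfNorm : Exponent r → ℕ
halfNorm []      = 0
halfNorm (c ∷ γ) = triangleℤ c ℕ.+ halfNorm γ

normSq : Exponent r → ℤ
normSq γ = ∑[ c ∈ Vec.toList γ ] c ℤ.* c

2*triangle : ∀ k → 2 ℕ.* triangle k ≡ k ℕ.* k ℕ.+ k
2*triangle zero    = refl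
2*triangle (suc k) = trans (ℕ.*-distribˡ-+ 2 (suc k) (triangle k))
  (trans (cong (2 ℕ.* suc k ℕ.+_) (2*triangle k)) (regroup k))
  where
  regroup : ∀ k → 2 ℕ.* suc k ℕ.+ (k ℕ.* k ℕ.+ k) ≡ suc k ℕ.* suc k ℕ.+ suc k
  regroup = ℕ.solve-∀

2*triangleℤ : ∀ c → + 2 ℤ.* + triangleℤ c ≡ c ℤ.* c ℤ.+ c
2*triangleℤ (+ k) = begin
  + 2 ℤ.* + triangle k      ≡⟨ ℤ.pos-* 2 (triangle k) ⟨
  + (2 ℕ.* triangle k)      ≡⟨ cong +_ (2*triangle k) ⟩
  + (k ℕ.* k ℕ.+ k)         ≡⟨ ℤ.pos-+ (k ℕ.* k) k ⟩
  + (k ℕ.* k) ℤ.+ + k       ≡⟨ cong (ℤ._+ + k) (ℤ.pos-* k k) ⟩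
  + k ℤ.* + k ℤ.+ + k       ∎
  where open ≡-Reasoning
2*triangleℤ -[1+ k ] = begin
  + 2 ℤ.* + triangle k                       ≡⟨ 2*triangleℤ (+ k) ⟩
  + k ℤ.* + k ℤ.+ + k                        ≡⟨ regroup (+ k) ⟩
  ℤ.- (1ℤ ℤ.+ + k) ℤ.* ℤ.- (1ℤ ℤ.+ + k) ℤ.+ ℤ.- (1ℤ ℤ.+ + k)  ∎
  where
  open ≡-Reasoning
  regroup : ∀ k → k ℤ.* k ℤ.+ k ≡ ℤ.- (1ℤ ℤ.+ k) ℤ.* ℤ.- (1ℤ ℤ.+ k) ℤ.+ ℤ.- (1ℤ ℤ.+ k)
  regroup = ℤ.solve-∀

2*halfNorm : ∀ (γ : Exponent r) → + 2 ℤ.* + halfNorm γ ≡ normSq γ ℤ.+ ∣ γ ∣ᴱ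
2*halfNorm []      = refl
2*halfNorm (c ∷ γ) = begin
  + 2 ℤ.* + (triangleℤ c ℕ.+ halfNorm γ)                   ≡⟨ cong (+ 2 ℤ.*_) (ℤ.pos-+ (triangleℤ c) (halfNorm γ)) ⟩
  + 2 ℤ.* (+ triangleℤ c ℤ.+ + halfNorm γ)                 ≡⟨ ℤ.*-distribˡ-+ (+ 2) (+ triangleℤ c) (+ halfNorm γ) ⟩
  + 2 ℤ.* + triangleℤ c ℤ.+ + 2 ℤ.* + halfNorm γ           ≡⟨ cong₂ ℤ._+_ (2*triangleℤ c) (2*halfNorm γ) ⟩
  (c ℤ.* c ℤ.+ c) ℤ.+ (normSq γ ℤ.+ ∣ γ ∣ᴱ)                ≡⟨ regroup (c ℤ.* c) c (normSq γ) ∣ γ ∣ᴱ ⟩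
  (c ℤ.* c ℤ.+ normSq γ) ℤ.+ (c ℤ.+ ∣ γ ∣ᴱ)                ∎
  where
  open ≡-Reasoning
  regroup : ∀ a b x y → (a ℤ.+ b) ℤ.+ (x ℤ.+ y) ≡ (a ℤ.+ x) ℤ.+ (b ℤ.+ y)
  regroup = ℤ.solve-∀

normSq≡ : ∀ (γ : Exponent r) → ∣ γ ∣ᴱ ≡ 0ℤ → normSq γ ≡ + (2 ℕ.* halfNorm γ)
normSq≡ γ |γ|≡0 = begin
  normSq γ                   ≡⟨ ℤ.+-identityʳ _ ⟨
  normSq γ ℤ.+ 0ℤ            ≡⟨ cong (λ z → normSq γ ℤ.+ z) |γ|≡0 ⟨
  normSq γ ℤ.+ ∣ γ ∣ᴱ        ≡⟨ 2*halfNorm γ ⟨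
  + 2 ℤ.* + halfNorm γ       ≡⟨ ℤ.pos-* 2 (halfNorm γ) ⟨
  + (2 ℕ.* halfNorm γ)       ∎
  where open ≡-Reasoning

absSum≤normSq : ∀ (γ : Exponent r) → + absSum γ ℤ.≤ normSq γ
absSum≤normSq []      = ℤ.≤-refl
absSum≤normSq (c ∷ γ) = ℤ.≤-trans (ℤ.≤-reflexive (ℤ.pos-+ ℤ.∣ c ∣ (absSum γ)))
  (ℤ.+-mono-≤ (∣c∣≤c² c) (absSum≤normSq γ))
  where
  k≤k*k : ∀ k → k ≤ k ℕ.* k
  k≤k*k zero    = z≤n
  k≤k*k (suc k) = ℕ.m≤m*n (suc k) (suc k)
  ∣c∣≤c² : ∀ c → + ℤ.∣ c ∣ ℤ.≤ c ℤ.* c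
  ∣c∣≤c² (+ k)    = ℤ.≤-trans (ℤ.+≤+ (k≤k*k k)) (ℤ.≤-reflexive (ℤ.pos-* k k))
  ∣c∣≤c² -[1+ k ] = ℤ.+≤+ (k≤k*k (suc k))

-- Integers satisfy |c| ≤ c², so a bound on the norm bounds the entries. This makes the threshold
-- for the word length independent of γ.
absSum≤ : ∀ (γ : Exponent r) → ∣ γ ∣ᴱ ≡ 0ℤ → absSum γ ≤ 2 ℕ.* halfNorm γ
absSum≤ γ |γ|≡0 = ℤ.drop‿+≤+ (ℤ.≤-trans (absSum≤normSq γ) (ℤ.≤-reflexive (normSq≡ γ |γ|≡0)))

module _ (i : ℤ) (d : ℕ) where

  private
    -- The normalising division of `ℚ` does not reduce for a variable numerator; between
    -- unnormalised rationals the equation is a cross multiplication of integers.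
    lhs≃ : ℚ.toℚᵘ (i ℚ./ 1 ℚ.* ℚ.½) ℚᵘ.≃ ℚᵘ.mkℚᵘ i 0 ℚᵘ.* ℚᵘ.½
    lhs≃ = ℚᵘ.≃-trans (ℚ.toℚᵘ-homo-* (i ℚ./ 1) ℚ.½)
      (ℚᵘ.*-congʳ {ℚᵘ.½} (ℚ.toℚᵘ-fromℚᵘ (ℚᵘ.mkℚᵘ i 0)))

    rhs≃ : ℚ.toℚᵘ (+ d ℚ./ 1) ℚᵘ.≃ ℚᵘ.mkℚᵘ (+ d) 0
    rhs≃ = ℚ.toℚᵘ-fromℚᵘ (ℚᵘ.mkℚᵘ (+ d) 0)

    cross : i ℤ.* 1ℤ ℤ.* 1ℤ ≡ i
    cross = trans (ℤ.*-identityʳ _) (ℤ.*-identityʳ i)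

    *2 : + d ℤ.* + 2 ≡ + (2 ℕ.* d)
    *2 = trans (sym (ℤ.pos-* d 2)) (cong +_ (ℕ.*-comm d 2))

  half≡⇒ : i ℚ./ 1 ℚ.* ℚ.½ ≡ + d ℚ./ 1 → i ≡ + (2 ℕ.* d)
  half≡⇒ eq with ℚᵘ.≃-trans (ℚᵘ.≃-sym lhs≃) (ℚᵘ.≃-trans (ℚ.toℚᵘ-cong eq) rhs≃)
  ... | ℚᵘ.*≡* e = trans (sym cross) (trans e *2)

  half≡⇐ : i ≡ + (2 ℕ.* d) → i ℚ./ 1 ℚ.* ℚ.½ ≡ + d ℚ./ 1
  half≡⇐ eq = ℚ.toℚᵘ-injective (ℚᵘ.≃-trans lhs≃
    (ℚᵘ.≃-trans (ℚᵘ.*≡* (trans cross (trans eq (sym *2)))) (ℚᵘ.≃-sym rhs≃)))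

‖‖²≡ : ∀ .{{_ : NonZero r}} (γ : Exponent r) → ∣ γ ∣ᴱ ≡ 0ℤ → ‖ γ ‖² ≡ normSq γ ℚ./ 1
‖‖²≡ {r} γ |γ|≡0 = begin
  normSq γ ℚ./ 1 ℚ.- (∣ γ ∣ᴱ ℤ.* ∣ γ ∣ᴱ) ℚ./ r   ≡⟨ cong (λ z → normSq γ ℚ./ 1 ℚ.- (z ℤ.* z) ℚ./ r) |γ|≡0 ⟩
  normSq γ ℚ./ 1 ℚ.- 0ℤ ℚ./ r                    ≡⟨ cong (λ z → normSq γ ℚ./ 1 ℚ.- z) (ℚ.0/n≡0 r) ⟩
  normSq γ ℚ./ 1 ℚ.+ ℚ.0ℚ                        ≡⟨ ℚ.+-identityʳ _ ⟩
  normSq γ ℚ./ 1                                 ∎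
  where open ≡-Reasoning

module _ (n : ℕ) .{{n>1 : NonTrivial n}} (γ : Exponent n) where

  private instance
    n≢0 : NonZero n
    n≢0 = ℕ.nonTrivial⇒nonZero n

  Θ≡0 : ∣ γ ∣ᴱ ≢ 0ℤ → ∀ d → Θ n d γ ≡ 0ℤ
  Θ≡0 |γ|≢0 d = ℤΣ.[]-no (∣ γ ∣ᴱ ℤ.≟ 0ℤ ×-dec ‖ γ ‖² ℚ.* ℚ.½ ℚ.≟ + d ℚ./ 1) (|γ|≢0 ∘ proj₁)

  Θ≡monomial : ∣ γ ∣ᴱ ≡ 0ℤ → ∀ d → Θ n d γ ≡ monomial (halfNorm γ) d
  Θ≡monomial |γ|≡0 d = ℤΣ.[]-⇔ (∣ γ ∣ᴱ ℤ.≟ 0ℤ ×-dec ‖ γ ‖² ℚ.* ℚ.½ ℚ.≟ + d ℚ./ 1) (d ℕ.≟ halfNorm γ)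
    (λ (_ , eq) → sym (ℕ.*-cancelˡ-≡ (halfNorm γ) d 2 (ℤ.+-injective
      (trans (sym (normSq≡ γ |γ|≡0)) (half≡⇒ (normSq γ) d (trans (cong (ℚ._* ℚ.½) (sym (‖‖²≡ γ |γ|≡0))) eq))))))
    (λ { refl → |γ|≡0 , trans (cong (ℚ._* ℚ.½) (‖‖²≡ γ |γ|≡0)) (half≡⇐ (normSq γ) d (normSq≡ γ |γ|≡0)) })

-- The character as a limit of sums over pairs of words

weight : Vec (Fin n) m → Vec (Fin n) m → Exponent n
weight a b = diff (content a) (content b)

degree : Vec (Fin (suc r)) m → Vec (Fin (suc r)) m → ℕ
degree a b = halfNorm (weight a b)
  ℕ.+ (dot (Vec.tail (content a)) (Vec.tail (content b)) ℕ.+ (inversions a ℕ.+ inversions b))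

wordSum : ∀ r → ℕ → PowerSeries (suc r)
wordSum r m e γ = ∑[ a ∈ words (suc r) m ] ∑[ b ∈ words (suc r) m ]
  ⟦ (e ℕ.≟ degree a b) ×-dec (γ ≟ᴱ weight a b) ⟧

∣diff∣ : ∀ (v w : Vec ℕ r) → ∣ diff v w ∣ᴱ ≡ + Vec.sum w ℤ.- + Vec.sum v
∣diff∣ []      []      = refl
∣diff∣ (x ∷ v) (y ∷ w) = begin
  (+ y ℤ.- + x) ℤ.+ ∣ diff v w ∣ᴱ                          ≡⟨ cong (λ z → (+ y ℤ.- + x) ℤ.+ z) (∣diff∣ v w) ⟩
  (+ y ℤ.- + x) ℤ.+ (+ Vec.sum w ℤ.- + Vec.sum v)          ≡⟨ regroup (+ x) (+ y) (+ Vec.sum v) (+ Vec.sum w) ⟩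
  (+ y ℤ.+ + Vec.sum w) ℤ.- (+ x ℤ.+ + Vec.sum v)          ≡⟨ cong₂ (λ s t → s ℤ.- t) (ℤ.pos-+ y (Vec.sum w)) (ℤ.pos-+ x (Vec.sum v)) ⟨
  + (y ℕ.+ Vec.sum w) ℤ.- + (x ℕ.+ Vec.sum v)              ∎
  where
  open ≡-Reasoning
  regroup : ∀ x y v w → (y ℤ.- x) ℤ.+ (w ℤ.- v) ≡ (y ℤ.+ w) ℤ.- (x ℤ.+ v)
  regroup = ℤ.solve-∀

∣weight∣ : ∀ (a b : Vec (Fin n) m) → ∣ weight a b ∣ᴱ ≡ 0ℤ
∣weight∣ {m = m} a b = trans (∣diff∣ (content a) (content b))
  (trans (cong₂ (λ x y → + y ℤ.- + x) (sum-content a) (sum-content b)) (ℤ.+-inverseʳ (+ m)))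

coeff-sum : ∀ {d} {A : Set} (xs : List A) f i →
            coeff (Modulo.sum d xs f) i ≡ ∑ xs (λ x → coeff (f x) i)
coeff-sum []       f i = refl
coeff-sum {d} (x ∷ xs) f i = cong (λ z → coeff (f x) i ℤ.+ z) (coeff-sum {d} xs f i)

coeff-[]-⊗-q^ : ∀ {d} {P : Set} (p? : Dec P) m i →
                coeff (Modulo.[_] d p? ⊗ q^ m) i ≡ ⟦ (i ℕ.≟ m) ×-dec p? ⟧
coeff-[]-⊗-q^ (yes p) m i = trans (⊛-identityˡ (monomial m) i)
  (ℤΣ.[]-⇔ (i ℕ.≟ m) ((i ℕ.≟ m) ×-dec yes p) (_, p) proj₁)
coeff-[]-⊗-q^ (no ¬p) m i = trans (⊛-zeroˡ (monomial m) i)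
  (sym (ℤΣ.[]-no ((i ℕ.≟ m) ×-dec no ¬p) (¬p ∘ proj₂)))

wordSum≡0 : ∀ r m e γ → (∀ (a b : Vec (Fin (suc r)) m) → ¬ (e ≡ degree a b × γ ≡ weight a b)) →
            wordSum r m e γ ≡ 0ℤ
wordSum≡0 r m e γ ¬eq = ℤΣ.sum-0 (words (suc r) m) λ {a} _ → ℤΣ.sum-0 (words (suc r) m) λ {b} _ →
  ℤΣ.[]-no ((e ℕ.≟ degree a b) ×-dec (γ ≟ᴱ weight a b)) (¬eq a b)

-- For fixed γ the factor q^{‖γ‖²/2} is constant and leaves the sum. The condition γ = `weight a b`
-- need only be tested on the letters other than 1, because both exponents have total 0. What
-- remains is `sum-words`.
wordSum≡coeff : ∀ r m e γ → ∣ γ ∣ᴱ ≡ 0ℤ → halfNorm γ ≤ e → e ℕ.+ (r ℕ.* e ℕ.+ 2 ℕ.* e) ≤ m →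
                wordSum r m e γ ≡ coeff (q^ halfNorm γ ⊗ 1/poch e ^ˢ r) e
wordSum≡coeff r m e γ@(c ∷ δ) |γ|≡0 h≤e m≥ = begin
  wordSum r m e γ
    ≡⟨ ℤΣ.sum-cong ws (λ a → ℤΣ.sum-cong ws (term≡ a)) ⟩
  ∑[ a ∈ ws ] ∑[ b ∈ ws ] coeff (f a b) e
    ≡⟨ ℤΣ.sum-cong ws (λ a → coeff-sum {e} ws (f a) e) ⟨
  ∑[ a ∈ ws ] coeff (sum ws (f a)) e
    ≡⟨ coeff-sum {e} ws (λ a → sum ws (f a)) e ⟨
  coeff (sum ws (λ a → sum ws (f a))) e
    ≡⟨ at factor e ℕ.≤-refl ⟩
  coeff (q^ halfNorm γ ⊗ 1/poch e ^ˢ r) e  ∎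
  where
  open ≡-Reasoning
  open Modulo e using (_≈_; sum; [_]; ≈-sym; ≈-trans; sum-cong; *-sum; *-congˡ; q^-+; setoid)
  open SemiringSolver (seriesSemiring e) using (solve; _:=_; _:*_)
  ws = words (suc r) m
  tl : Vec (Fin (suc r)) m → Vec ℕ r
  tl w = Vec.tail (content w)
  rest : Vec (Fin (suc r)) m → Vec (Fin (suc r)) m → ℕ
  rest a b = dot (tl a) (tl b) ℕ.+ (inversions a ℕ.+ inversions b)
  f g : Vec (Fin (suc r)) m → Vec (Fin (suc r)) m → Series
  f a b = [ diff (tl a) (tl b) ≟ᴱ δ ] ⊗ q^ (halfNorm γ ℕ.+ rest a b)
  g a b = [ diff (tl a) (tl b) ≟ᴱ δ ] ⊗ q^ rest a b

  tail-weight : ∀ (α β : Vec ℕ (suc r)) → Vec.tail (diff α β) ≡ diff (Vec.tail α) (Vec.tail β)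
  tail-weight (x ∷ α) (y ∷ β) = refl

  determined : ∀ {γ′ : Exponent (suc r)} → ∣ γ′ ∣ᴱ ≡ 0ℤ → Vec.tail γ′ ≡ δ → γ ≡ γ′
  determined {c′ ∷ _} |γ′|≡0 refl = cong (_∷ δ)
    (ℤGroup.∙-cancelʳ ∣ δ ∣ᴱ c c′ (trans |γ|≡0 (sym |γ′|≡0)))

  term≡ : ∀ a b → ⟦ (e ℕ.≟ degree a b) ×-dec (γ ≟ᴱ weight a b) ⟧ ≡ coeff (f a b) e
  term≡ a b = trans
    (ℤΣ.[]-⇔ ((e ℕ.≟ degree a b) ×-dec (γ ≟ᴱ weight a b))
             ((e ℕ.≟ halfNorm γ ℕ.+ rest a b) ×-dec (diff (tl a) (tl b) ≟ᴱ δ))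
      (λ (p , eq) → trans p (cong (λ z → halfNorm z ℕ.+ rest a b) (sym eq)) ,
                    trans (sym (tail-weight (content a) (content b))) (cong Vec.tail (sym eq)))
      (λ (p , eq) → let γ≡ = determined (∣weight∣ a b) (trans (tail-weight (content a) (content b)) eq) in
                    trans p (cong (λ z → halfNorm z ℕ.+ rest a b) γ≡) , γ≡))
    (sym (coeff-[]-⊗-q^ {e} (diff (tl a) (tl b) ≟ᴱ δ) _ e))

  absSum-δ : absSum δ ≤ 2 ℕ.* e
  absSum-δ = ℕ.≤-trans (ℕ.m≤n+m (absSum δ) ℤ.∣ c ∣)
    (ℕ.≤-trans (absSum≤ γ |γ|≡0) (ℕ.*-monoʳ-≤ 2 h≤e))

  factor : sum ws (λ a → sum ws (f a)) ≈ q^ halfNorm γ ⊗ 1/poch e ^ˢ r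
  factor = ≈-trans
    (sum-cong ws (λ a → ≈-trans (sum-cong ws (λ b → ≈-trans (*-congˡ (q^-+ (halfNorm γ) (rest a b)))
        (solve 3 (λ x y z → x :* (y :* z) := y :* (x :* z)) (Modulo.≈-refl e)
          [ diff (tl a) (tl b) ≟ᴱ δ ] (q^ halfNorm γ) (q^ rest a b))))
      (≈-sym (*-sum (q^ halfNorm γ) ws (g a)))))
    (≈-trans (≈-sym (*-sum (q^ halfNorm γ) ws (λ a → sum ws (g a))))
      (*-congˡ (Limit.sum-words e m δ (ℕ.≤-trans (ℕ.+-monoʳ-≤ e (ℕ.+-monoʳ-≤ (r ℕ.* e) absSum-δ)) m≥))))

-- Unless |γ| = 0 and `halfNorm γ` ≤ e, both sides vanish for every m: weights have total 0, and a
-- degree is at least the `halfNorm` of its weight. Hence one threshold serves all γ.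
χΛ₀≡wordSum : ∀ p e m γ → e ℕ.+ (suc p ℕ.* e ℕ.+ 2 ℕ.* e) ≤ m →
              χΛ₀ (suc (suc p)) e γ ≡ wordSum (suc p) m e γ
χΛ₀≡wordSum p e m γ m≥ = cases (∣ γ ∣ᴱ ℤ.≟ 0ℤ) (halfNorm γ ℕ.≤? e)
  where
  open ≡-Reasoning
  R = recip (∏ (λ k → pow (1-q^ k) (suc p)))

  vanishing : (∀ i → Θ (2 ℕ.+ p) (e ∸ i) γ ≡ 0ℤ) → χΛ₀ (2 ℕ.+ p) e γ ≡ 0ℤ
  vanishing Θ≡0 = ℤΣ.sum-0 (upTo (suc e)) λ {i} _ →
    trans (cong (R i ℤ.*_) (Θ≡0 i)) (ℤ.*-zeroʳ (R i))

  cases : Dec (∣ γ ∣ᴱ ≡ 0ℤ) → Dec (halfNorm γ ≤ e) → χΛ₀ (2 ℕ.+ p) e γ ≡ wordSum (suc p) m e γ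
  cases (no |γ|≢0) _ = trans (vanishing λ i → Θ≡0 _ γ |γ|≢0 (e ∸ i))
    (sym (wordSum≡0 (suc p) m e γ λ { a b (_ , refl) → |γ|≢0 (∣weight∣ a b) }))
  cases (yes |γ|≡0) (no h≰e) = trans
    (vanishing λ i → trans (Θ≡monomial _ γ |γ|≡0 (e ∸ i)) (ℤΣ.[]-no (e ∸ i ℕ.≟ halfNorm γ)
      λ eq → h≰e (ℕ.≤-trans (ℕ.≤-reflexive (sym eq)) (ℕ.m∸n≤m e i))))
    (sym (wordSum≡0 (suc p) m e γ λ { a b (refl , refl) → h≰e (ℕ.m≤m+n _ _) }))
  cases (yes |γ|≡0) (yes h≤e) = begin
    (R ⊛ (λ i → Θ (2 ℕ.+ p) i γ)) e
      ≡⟨ ⊛-cong-≤ {R} {R} e (λ _ _ → refl) (λ i _ → Θ≡monomial _ γ |γ|≡0 i) ⟩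
    (R ⊛ monomial (halfNorm γ)) e
      ≡⟨ ⊛-comm R (monomial (halfNorm γ)) e ⟩
    (monomial (halfNorm γ) ⊛ R) e
      ≡⟨ at (Modulo.*-congˡ e {x = q^ halfNorm γ} (recip-∏-pow e (suc p))) e ℕ.≤-refl ⟩
    coeff (q^ halfNorm γ ⊗ 1/poch e ^ˢ suc p) e
      ≡⟨ wordSum≡coeff (suc p) m e γ |γ|≡0 h≤e m≥ ⟨
    wordSum (suc p) m e γ  ∎

-- Column strict fillings as pairs of words

private variable
  A : Set
  k : ℕ

lookup-injective : ∀ {v w : Vec A n} → (∀ i → lookup v i ≡ lookup w i) → v ≡ w
lookup-injective {v = v} {w} v≡w = trans (sym (Vec.tabulate∘lookup v))
  (trans (Vec.tabulate-cong v≡w) (Vec.tabulate∘lookup w))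

lookup-∷ʳ-inject₁ : ∀ (xs : Vec A n) y i → lookup (xs Vec.∷ʳ y) (Fin.inject₁ i) ≡ lookup xs i
lookup-∷ʳ-inject₁ (x ∷ xs) y Fin.zero    = refl
lookup-∷ʳ-inject₁ (x ∷ xs) y (Fin.suc i) = lookup-∷ʳ-inject₁ xs y i

lookup-∷ʳ-fromℕ : ∀ (xs : Vec A n) y → lookup (xs Vec.∷ʳ y) (Fin.fromℕ n) ≡ y
lookup-∷ʳ-fromℕ []       y = refl
lookup-∷ʳ-fromℕ (x ∷ xs) y = lookup-∷ʳ-fromℕ xs y

-- x₁ x₂ … x_k y_k … y₂ y₁
weave : Vec A k → Vec A k → Vec A (k ℕ.* 2)
weave []       []       = []
weave (x ∷ xs) (y ∷ ys) = x ∷ (weave xs ys Vec.∷ʳ y)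

unweave : ∀ k (w : Vec A (k ℕ.* 2)) → ∃[ xs ] ∃[ ys ] w ≡ weave {k = k} xs ys
unweave zero    []      = [] , [] , refl
unweave (suc k) (x ∷ w) with Vec.initLast w
... | w′ , y , refl with unweave k w′
... | xs , ys , refl = x ∷ xs , y ∷ ys , refl

-- The positions of x_i and y_i in the woven row. Building the row from both ends at once fits the
-- unfolding of `suc k ℕ.* 2` to `2 ℕ.+ k ℕ.* 2`, and puts the first letters of both words into the
-- outermost columns.
left right : Fin k → Fin (k ℕ.* 2)
left  Fin.zero    = Fin.zero
left  (Fin.suc i) = Fin.suc (Fin.inject₁ (left i))
right {suc k} Fin.zero    = Fin.suc (Fin.fromℕ (k ℕ.* 2))
right {suc k} (Fin.suc i) = Fin.suc (Fin.inject₁ (right i))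

toℕ-left : ∀ (i : Fin k) → toℕ (left i) ≡ toℕ i
toℕ-left Fin.zero    = refl
toℕ-left (Fin.suc i) = cong suc (trans (Fin.toℕ-inject₁ (left i)) (toℕ-left i))

toℕ-right : ∀ (i : Fin k) → suc (toℕ (right i) ℕ.+ toℕ i) ≡ k ℕ.* 2
toℕ-right {suc k} Fin.zero    = cong (suc ∘ suc) (trans (ℕ.+-identityʳ _) (Fin.toℕ-fromℕ (k ℕ.* 2)))
toℕ-right {suc k} (Fin.suc i) = cong (suc ∘ suc) (trans (ℕ.+-suc _ (toℕ i))
  (trans (cong (λ j → suc (j ℕ.+ toℕ i)) (Fin.toℕ-inject₁ (right i))) (toℕ-right i)))

lookup-weave-left : ∀ (xs ys : Vec A k) i → lookup (weave xs ys) (left i) ≡ lookup xs i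
lookup-weave-left (x ∷ xs) (y ∷ ys) Fin.zero    = refl
lookup-weave-left (x ∷ xs) (y ∷ ys) (Fin.suc i) =
  trans (lookup-∷ʳ-inject₁ (weave xs ys) y (left i)) (lookup-weave-left xs ys i)

lookup-weave-right : ∀ (xs ys : Vec A k) i → lookup (weave xs ys) (right i) ≡ lookup ys i
lookup-weave-right (x ∷ xs) (y ∷ ys) Fin.zero    = lookup-∷ʳ-fromℕ (weave xs ys) y
lookup-weave-right (x ∷ xs) (y ∷ ys) (Fin.suc i) =
  trans (lookup-∷ʳ-inject₁ (weave xs ys) y (right i)) (lookup-weave-right xs ys i)

left⊎right : ∀ k (j : Fin (k ℕ.* 2)) → (∃[ i ] j ≡ left {k} i) ⊎ (∃[ i ] j ≡ right {k} i)
left⊎right (suc k) Fin.zero    = inj₁ (Fin.zero , refl)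
left⊎right (suc k) (Fin.suc j) with view j
... | ‵fromℕ     = inj₂ (Fin.zero , refl)
... | ‵inject₁ j′ with left⊎right k j′
...   | inj₁ (i , refl) = inj₁ (Fin.suc i , refl)
...   | inj₂ (i , refl) = inj₂ (Fin.suc i , refl)

StrictlyIncreasing : (Fin m → Fin n) → Set
StrictlyIncreasing h = ∀ r s → r Fin.< s → h r Fin.< h s

punchIn-strictlyIncreasing : ∀ (i : Fin (suc m)) → StrictlyIncreasing (punchIn i)
punchIn-strictlyIncreasing i r s r<s = ℕ.≤∧≢⇒< (Fin.punchIn-mono-≤ i r s (ℕ.<⇒≤ r<s))
  (Fin.<⇒≢ r<s ∘ Fin.punchIn-injective i r s ∘ Fin.toℕ-injective)

-- Induction on the height: the entries after the first are positive, and lowered by one they miss a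
-- single value i. If the first entry is 0, the whole column misses i + 1. Otherwise the first entry
-- is 1, and 0 is the value missed.
strictlyIncreasing⇒punchIn : ∀ {m} (h : Fin m → Fin (suc m)) → StrictlyIncreasing h →
                             ∃[ i ] (∀ r → h r ≡ punchIn i r)
strictlyIncreasing⇒punchIn {zero}  h h< = Fin.zero , λ ()
strictlyIncreasing⇒punchIn {suc m} h h< =
  extend h lower h< suc-lower (strictlyIncreasing⇒punchIn lower lower<) (h Fin.zero) refl
  where
  0≢ : ∀ r → Fin.zero ≢ h (Fin.suc r)
  0≢ r 0≡ = contradiction (subst (h Fin.zero Fin.<_) (sym 0≡) (h< Fin.zero (Fin.suc r) (s≤s z≤n))) λ ()

  lower : Fin m → Fin (suc m)
  lower r = Fin.punchOut (0≢ r)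

  suc-lower : ∀ r → Fin.suc (lower r) ≡ h (Fin.suc r)
  suc-lower r = Fin.punchIn-punchOut (0≢ r)

  lower< : StrictlyIncreasing lower
  lower< r s r<s = ℕ.s<s⁻¹ (subst₂ (λ i j → toℕ i < toℕ j) (sym (suc-lower r)) (sym (suc-lower s))
    (h< (Fin.suc r) (Fin.suc s) (s≤s r<s)))

  extend : ∀ {m} (h : Fin (suc m) → Fin (2 ℕ.+ m)) (lower : Fin m → Fin (suc m)) → StrictlyIncreasing h →
           (∀ r → Fin.suc (lower r) ≡ h (Fin.suc r)) → ∃[ i ] (∀ r → lower r ≡ punchIn i r) →
           ∀ x → h Fin.zero ≡ x → ∃[ i ] (∀ r → h r ≡ punchIn i r)
  extend h lower h< suc-lower (i , eq) Fin.zero h₀ = Fin.suc i , λ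
    { Fin.zero    → h₀
    ; (Fin.suc r) → trans (sym (suc-lower r)) (cong Fin.suc (eq r)) }
  extend {zero} h lower h< suc-lower _ (Fin.suc Fin.zero) h₀ = Fin.zero , λ { Fin.zero → h₀ }
  extend {suc m} h lower h< suc-lower (Fin.suc i , eq) (Fin.suc x) h₀ = contradiction
    (subst₂ Fin._<_ h₀ (trans (sym (suc-lower Fin.zero)) (cong Fin.suc (eq Fin.zero)))
      (h< Fin.zero (Fin.suc Fin.zero) (s≤s z≤n))) λ { (s≤s ()) }
  extend {suc m} h lower h< suc-lower (Fin.zero , eq) (Fin.suc (Fin.suc x)) h₀ = contradiction
    (subst₂ Fin._<_ h₀ (trans (sym (suc-lower Fin.zero)) (cong Fin.suc (eq Fin.zero)))
      (h< Fin.zero (Fin.suc Fin.zero) (s≤s z≤n))) λ { (s≤s (s≤s ())) }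
  extend {suc m} h lower h< suc-lower (Fin.zero , eq) (Fin.suc Fin.zero) h₀ = Fin.zero , λ
    { Fin.zero    → h₀
    ; (Fin.suc r) → trans (sym (suc-lower r)) (cong Fin.suc (eq r)) }

shape : ℕ → ℕ → Partition
shape k p = k · (replicate p 1 ++ 0 ∷ [])

-- Below its first row `k · θ` has parts `k ℕ.* 1` and finally `k ℕ.* 0`, which do not reduce to k
-- and 0 for a variable k; hence the casts.
longRows : ∀ p → (Fin p → Vec (Fin n) k) → Filling n (shape k p)
longRows {k = k} zero    g = Vec.cast (sym (ℕ.*-zeroʳ k)) [] ∷ []
longRows {k = k} (suc p) g = Vec.cast (sym (ℕ.*-identityʳ k)) (g Fin.zero) ∷ longRows p (g ∘ Fin.suc)

longRows-cong : ∀ p {g h : Fin p → Vec (Fin n) k} → (∀ r → g r ≡ h r) → longRows p g ≡ longRows p h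
longRows-cong zero    g≡h = refl
longRows-cong {k = k} (suc p) g≡h = cong₂ (λ v F → Vec.cast (sym (ℕ.*-identityʳ k)) v ∷ F) (g≡h Fin.zero) (longRows-cong p (g≡h ∘ Fin.suc))

longRows-surjective : ∀ p (F : Filling n (shape k p)) → ∃[ g ] F ≡ longRows {k = k} p g
longRows-surjective {k = k} zero (w ∷ []) = (λ ()) , cong (_∷ []) (empty (ℕ.*-zeroʳ k) w)
  where
  empty : ∀ {m} (m≡0 : m ≡ 0) (w : Vec A m) → w ≡ Vec.cast (sym m≡0) []
  empty refl [] = refl
longRows-surjective {k = k} (suc p) (w ∷ F) with longRows-surjective {k = k} p F
... | g , refl = (λ { Fin.zero → Vec.cast (ℕ.*-identityʳ k) w ; (Fin.suc r) → g r }) ,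
  cong (_∷ longRows p g) (sym (trans (Vec.cast-trans (ℕ.*-identityʳ k) _ w) (Vec.cast-is-id refl w)))

longRows-cell : ∀ p (r : Fin p) (c : Fin k) → ∃[ u ] (row u ≡ toℕ r × col u ≡ toℕ c ×
                (∀ (g : Fin p → Vec (Fin n) k) → longRows p g ⟨ u ⟩ ≡ lookup (g r) c))
longRows-cell {k = k} (suc p) Fin.zero c = cell Fin.zero (Fin.cast (sym (ℕ.*-identityʳ k)) c) , refl ,
  Fin.toℕ-cast (sym (ℕ.*-identityʳ k)) c , λ g → Vec.lookup-cast (sym (ℕ.*-identityʳ k)) (g Fin.zero) c
longRows-cell (suc p) (Fin.suc r) c with longRows-cell p r c
... | cell r′ c′ , row≡ , col≡ , value≡ = cell (Fin.suc r′) c′ , cong suc row≡ , col≡ , λ g → value≡ (g ∘ Fin.suc)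

longRows-view : ∀ p (g : Fin p → Vec (Fin n) k) u → ∃[ r ] ∃[ c ]
                (row u ≡ toℕ r × col u ≡ toℕ c × longRows p g ⟨ u ⟩ ≡ lookup (g r) c)
longRows-view {k = k} zero g (cell Fin.zero c) = contradiction (Fin.cast (ℕ.*-zeroʳ k) c) λ ()
longRows-view {k = k} (suc p) g (cell Fin.zero c) = Fin.zero , Fin.cast (ℕ.*-identityʳ k) c , refl ,
  sym (Fin.toℕ-cast (ℕ.*-identityʳ k) c) , Vec.lookup-cast₁ (sym (ℕ.*-identityʳ k)) (g Fin.zero) c
longRows-view (suc p) g (cell (Fin.suc r) c) with longRows-view p (g ∘ Fin.suc) (cell r c)
... | r′ , c′ , row≡ , col≡ , value≡ = Fin.suc r′ , c′ , cong suc row≡ , col≡ , value≡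

-- The filling whose c-th column from the left is [n] ∖ {a_c} and whose c-th
-- column from the right is {b_c}.
fill : ∀ {k p} → Vec (Fin (2 ℕ.+ p)) k → Vec (Fin (2 ℕ.+ p)) k → Filling (2 ℕ.+ p) (k · θ (2 ℕ.+ p))
fill {k} {p} a b =
  weave (Vec.map (λ i → punchIn i Fin.zero) a) b ∷ longRows p (λ r → Vec.map (λ i → punchIn i (Fin.suc r)) a)

module _ {k p : ℕ} where

  private
    N = 2 ℕ.+ p

    heads : Vec (Fin N) k → Vec (Fin N) k
    heads = Vec.map (λ i → punchIn i Fin.zero)

  -- Stated for arbitrary rows and not only for `fill`, because `fill-surjective` reads off the
  -- columns before the word a is known.
  longCell : ∀ (r : Fin (suc p)) (c : Fin k) → ∃[ u ] (row u ≡ toℕ r × col u ≡ toℕ c ×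
             (∀ (v w : Vec (Fin N) k) g → _⟨_⟩ {μ = k · θ N} (weave v w ∷ longRows p g) u ≡
               lookup (Vec.lookup (v ∷ Vec.tabulate g) r) c))
  longCell Fin.zero    c = cell Fin.zero (left c) , refl , toℕ-left c , λ v w g → lookup-weave-left v w c
  longCell (Fin.suc r) c with longRows-cell p r c
  ... | cell r′ c′ , row≡ , col≡ , value≡ = cell (Fin.suc r′) c′ , cong suc row≡ , col≡ ,
    λ v w g → trans (value≡ g) (cong (λ x → lookup x c) (sym (Vec.lookup∘tabulate g r)))

  shortCell : ∀ (c : Fin k) → ∃[ u ] (row u ≡ 0 × suc (col u ℕ.+ toℕ c) ≡ k ℕ.* 2 ×
              (∀ (a b : Vec (Fin N) k) → fill a b ⟨ u ⟩ ≡ lookup b c))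
  shortCell c = cell Fin.zero (right c) , refl , toℕ-right c , λ a b → lookup-weave-right (heads a) b c

  fill-long : ∀ (a : Vec (Fin N) k) (r : Fin (suc p)) c →
    lookup (lookup (Vec.map (λ i → punchIn i Fin.zero) a ∷ Vec.tabulate (λ r → Vec.map (λ i → punchIn i (Fin.suc r)) a)) r) c
      ≡ punchIn (lookup a c) r
  fill-long a Fin.zero    c = Vec.lookup-map c _ a
  fill-long a (Fin.suc r) c = trans (cong (λ x → lookup x c) (Vec.lookup∘tabulate _ r)) (Vec.lookup-map c _ a)

  longCell-fill : ∀ r c (a b : Vec (Fin N) k) → fill a b ⟨ proj₁ (longCell r c) ⟩ ≡ punchIn (lookup a c) r
  longCell-fill r c a b = trans (proj₂ (proj₂ (proj₂ (longCell r c))) _ b _) (fill-long a r c)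

  -- The index `c` counts columns from the left end in `long` and from the right end in `short`.
  data FillView (a b : Vec (Fin N) k) (u : Cell (k · θ N)) : Set where
    long  : ∀ r c → row u ≡ toℕ r → col u ≡ toℕ c → fill a b ⟨ u ⟩ ≡ punchIn (lookup a c) r → FillView a b u
    short : ∀ c → row u ≡ 0 → suc (col u ℕ.+ toℕ c) ≡ k ℕ.* 2 → fill a b ⟨ u ⟩ ≡ lookup b c → FillView a b u

  fillView : ∀ a b u → FillView a b u
  fillView a b (cell Fin.zero j) with left⊎right k j
  ... | inj₁ (c , refl) = long Fin.zero c refl (toℕ-left c)
    (trans (lookup-weave-left (heads a) b c) (Vec.lookup-map c (λ i → punchIn i Fin.zero) a))
  ... | inj₂ (c , refl) = short c refl (toℕ-right c) (lookup-weave-right (heads a) b c)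
  fillView a b (cell (Fin.suc r) c) with longRows-view p (λ r → Vec.map (λ i → punchIn i (Fin.suc r)) a) (cell r c)
  ... | r′ , c′ , row≡ , col≡ , value≡ = long (Fin.suc r′) c′ (cong suc row≡) col≡
    (trans value≡ (Vec.lookup-map c′ _ a))

  -- Columns from the right end lie strictly to the right of columns from the left end.
  short≢long : ∀ {x} (c c′ : Fin k) → suc (x ℕ.+ toℕ c) ≡ k ℕ.* 2 → x ≢ toℕ c′
  short≢long {x} c c′ eq refl = ℕ.<-irrefl eq (begin-strict
    suc (toℕ c′ ℕ.+ toℕ c)          <⟨ s≤s (ℕ.≤-reflexive (sym (ℕ.+-suc (toℕ c′) (toℕ c)))) ⟩
    suc (toℕ c′ ℕ.+ suc (toℕ c))    ≤⟨ ℕ.+-mono-≤ (Fin.toℕ<n c′) (Fin.toℕ<n c) ⟩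
    k ℕ.+ k                         ≡⟨ cong (k ℕ.+_) (ℕ.+-identityʳ k) ⟨
    2 ℕ.* k                         ≡⟨ ℕ.*-comm 2 k ⟩
    k ℕ.* 2                         ∎)
    where open ℕ.≤-Reasoning

  fill-columnStrict : ∀ a b → ColumnStrict (fill a b)
  fill-columnStrict a b u v col≡ row< with fillView a b u | fillView a b v
  ... | _              | short c row≡0 _ _ = contradiction (subst (row u <_) row≡0 row<) λ ()
  ... | long r c row-u col-u F-u | long s c′ row-v col-v F-v
    with refl ← Fin.toℕ-injective (trans (sym col-u) (trans col≡ col-v)) =
    subst₂ Fin._<_ (sym F-u) (sym F-v)
      (punchIn-strictlyIncreasing (lookup a c) r s (subst₂ _<_ row-u row-v row<))
  ... | short c _ col-u _ | long s c′ row-v col-v F-v =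
    contradiction (trans col≡ col-v) (short≢long c c′ col-u)

  fill-injective : ∀ {a b a′ b′ : Vec (Fin N) k} → fill a b ≡ fill a′ b′ → a ≡ a′ × b ≡ b′
  fill-injective {a} {b} {a′} {b′} eq = lookup-injective a≡ , lookup-injective b≡
    where
    b≡ : ∀ c → lookup b c ≡ lookup b′ c
    b≡ c with shortCell c
    ... | u , _ , _ , value≡ = trans (sym (value≡ a b)) (trans (cong (_⟨ u ⟩) eq) (value≡ a′ b′))

    punchIn≡ : ∀ c r → punchIn (lookup a c) r ≡ punchIn (lookup a′ c) r
    punchIn≡ c r = trans (sym (longCell-fill r c a b))
      (trans (cong (_⟨ proj₁ (longCell r c) ⟩) eq) (longCell-fill r c a′ b′))

    a≡ : ∀ c → lookup a c ≡ lookup a′ c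
    a≡ c with lookup a c Fin.≟ lookup a′ c
    ... | yes a≡a′ = a≡a′
    -- If the letters differed, the letter of a′ would be an entry of the column that omits the
    -- letter of a, which is also the column that omits the letter of a′.
    ... | no  a≢a′ = contradiction
      (trans (sym (punchIn≡ c (Fin.punchOut a≢a′))) (Fin.punchIn-punchOut a≢a′))
      (Fin.punchInᵢ≢i (lookup a′ c) _)

  -- A column with one cell is unrestricted, so b is whatever stands in the right half of the first
  -- row. Each column in the left half is strictly increasing and misses one value, the
  -- corresponding letter of a.
  fill-surjective : ∀ (F : Filling N (k · θ N)) → ColumnStrict F → ∃[ a ] ∃[ b ] F ≡ fill {k} {p} a b
  fill-surjective (w ∷ F) strict with unweave k w | longRows-surjective {k = k} p F
  ... | v , b , refl | g , refl = a , b , cong₂ (λ v F → weave v b ∷ F)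
      (lookup-injective λ c → trans (column-a c Fin.zero) (sym (Vec.lookup-map c _ a)))
      (longRows-cong p λ r → lookup-injective λ c → trans (cong (λ x → lookup x c) (sym (Vec.lookup∘tabulate g r)))
        (trans (column-a c (Fin.suc r)) (sym (Vec.lookup-map c _ a))))
    where
    column : Fin k → Fin (suc p) → Fin N
    column c r = lookup (lookup (v ∷ Vec.tabulate g) r) c

    column< : ∀ c → StrictlyIncreasing (column c)
    column< c r s r<s with longCell r c | longCell s c
    ... | u , row-u , col-u , value-u | u′ , row-u′ , col-u′ , value-u′ =
      subst₂ Fin._<_ (value-u v b g) (value-u′ v b g)
        (strict u u′ (trans col-u (sym col-u′)) (subst₂ _<_ (sym row-u) (sym row-u′) r<s))

    a : Vec (Fin N) k
    a = Vec.tabulate λ c → proj₁ (strictlyIncreasing⇒punchIn (column c) (column< c))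

    column-a : ∀ c r → column c r ≡ punchIn (lookup a c) r
    column-a c r = trans (proj₂ (strictlyIncreasing⇒punchIn (column c) (column< c)) r)
      (cong (λ i → punchIn i r) (sym (Vec.lookup∘tabulate _ c)))

  -- Both lists are free of repetitions and have the same members, so the orders of enumeration need
  -- not be compared.
  columnStrict-↭ : filter columnStrict? (fillings N (k · θ N)) ↭
                   List.map (uncurry (fill {k} {p})) (cartesianProduct (words N k) (words N k))
  columnStrict-↭ = ∼bag⇒↭ (∈.unique∧set⇒bag
    (Unique.filter⁺ columnStrict? (fillings-unique N (k · θ N)))
    (Unique.map⁺ (λ eq → let a≡ , b≡ = fill-injective eq in cong₂ _,_ a≡ b≡)
      (Unique.cartesianProduct⁺ (words-unique N k) (words-unique N k)))
    (mk⇔ to from))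
    where
    to : ∀ {F} → F ∈ filter columnStrict? (fillings N (k · θ N)) →
         F ∈ List.map (uncurry (fill {k} {p})) (cartesianProduct (words N k) (words N k))
    to {F} F∈ with fill-surjective F (proj₂ (∈.∈-filter⁻ columnStrict? {xs = fillings N (k · θ N)} F∈))
    ... | a , b , refl = ∈.∈-map⁺ (uncurry (fill {k} {p})) (∈.∈-cartesianProduct⁺ (∈-words a) (∈-words b))
    from : ∀ {F} → F ∈ List.map (uncurry (fill {k} {p})) (cartesianProduct (words N k) (words N k)) →
           F ∈ filter columnStrict? (fillings N (k · θ N))
    from F∈ with ∈.∈-map⁻ (uncurry (fill {k} {p})) F∈
    ... | (a , b) , _ , refl = ∈.∈-filter⁺ columnStrict? (∈-fillings (fill a b)) (fill-columnStrict a b)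

  sum-columnStrict : ∀ (G : Filling N (k · θ N) → ℤ) →
    ∑ (filter columnStrict? (fillings N (k · θ N))) G ≡ ∑[ a ∈ words N k ] ∑[ b ∈ words N k ] G (fill a b)
  sum-columnStrict G = trans (ℤΣ.sum-↭ G columnStrict-↭) (trans
    (ℤΣ.sum-map (uncurry (fill {k} {p})) (cartesianProduct (words N k) (words N k)) G)
    (ℤΣ.sum-cartesianProductWith _,_ (words N k) (words N k) (G ∘ uncurry (fill {k} {p}))))

-- Sums over the cells of a filling, row by row

lower : ∀ {μ} m → Cell μ → Cell (m ∷ μ)
lower m (cell r c) = cell (Fin.suc r) c

sum-cells : ∀ m μ f → ∑ (cells (m ∷ μ)) f ≡
            ∑ (allFin m) (λ c → f (cell Fin.zero c)) ℤ.+ ∑ (cells μ) (f ∘ lower m)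
sum-cells m μ f = begin
  ∑ (cells (m ∷ μ)) f
    ≡⟨ by-rows (m ∷ μ) f ⟩
  ∑[ r ∈ allFin (suc (length μ)) ] ∑[ c ∈ allFin (List.lookup (m ∷ μ) r) ] f (cell r c)
    ≡⟨ ℤΣ.sum-allFin (length μ) (λ r → ∑[ c ∈ allFin (List.lookup (m ∷ μ) r) ] f (cell r c)) ⟩
  ∑ (allFin m) (λ c → f (cell Fin.zero c)) ℤ.+
    (∑[ r ∈ allFin (length μ) ] ∑[ c ∈ allFin (List.lookup μ r) ] f (cell (Fin.suc r) c))
    ≡⟨ cong (λ z → ∑ (allFin m) (λ c → f (cell Fin.zero c)) ℤ.+ z) (by-rows μ (f ∘ lower m)) ⟨
  ∑ (allFin m) (λ c → f (cell Fin.zero c)) ℤ.+ ∑ (cells μ) (f ∘ lower m)  ∎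
  where
  open ≡-Reasoning
  by-rows : ∀ μ (f : Cell μ → ℤ) →
    ∑ (cells μ) f ≡ ∑[ r ∈ allFin (length μ) ] ∑[ c ∈ allFin (List.lookup μ r) ] f (cell r c)
  by-rows μ f = trans
    (ℤΣ.sum-concatMap (λ r → List.map (cell r) (allFin (List.lookup μ r))) (allFin (length μ)) f)
    (ℤΣ.sum-cong (allFin (length μ)) λ r → ℤΣ.sum-map (cell r) (allFin (List.lookup μ r)) f)

length-filter : {P : A → Set} (P? : Decidable P) (xs : List A) →
                + length (filter P? xs) ≡ ∑[ x ∈ xs ] ⟦ P? x ⟧
length-filter P? []       = refl
length-filter P? (x ∷ xs) with does (P? x)
... | true  = trans (ℤ.pos-+ 1 (length (filter P? xs))) (cong (λ z → 1ℤ ℤ.+ z) (length-filter P? xs))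
... | false = trans (length-filter P? xs) (sym (ℤ.+-identityˡ _))

pos-sum : ∀ (f : A → ℕ) xs → + ℕ.sum (List.map f xs) ≡ ∑[ x ∈ xs ] + f x
pos-sum f []       = refl
pos-sum f (x ∷ xs) = trans (ℤ.pos-+ (f x) _) (cong (λ z → + f x ℤ.+ z) (pos-sum f xs))

sum-lookup : ∀ (v : Vec A m) (f : A → ℤ) → ∑ (allFin m) (f ∘ lookup v) ≡ ∑ (Vec.toList v) f
sum-lookup []      f = refl
sum-lookup {m = suc m} (x ∷ v) f = trans (ℤΣ.sum-allFin m (f ∘ lookup (x ∷ v)))
  (cong (λ z → f x ℤ.+ z) (sum-lookup v f))

sum-∷ʳ : ∀ (v : Vec A m) y (f : A → ℤ) → ∑ (Vec.toList (v Vec.∷ʳ y)) f ≡ ∑ (Vec.toList v) f ℤ.+ f y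
sum-∷ʳ []      y f = ℤ.+-comm (f y) 0ℤ
sum-∷ʳ (x ∷ v) y f = trans (cong (λ z → f x ℤ.+ z) (sum-∷ʳ v y f)) (sym (ℤ.+-assoc (f x) _ (f y)))

sum-weave : ∀ (v w : Vec A k) (f : A → ℤ) →
            ∑ (Vec.toList (weave v w)) f ≡ ∑ (Vec.toList v) f ℤ.+ ∑ (Vec.toList w) f
sum-weave []      []      f = refl
sum-weave (x ∷ v) (y ∷ w) f = begin
  f x ℤ.+ ∑ (Vec.toList (weave v w Vec.∷ʳ y)) f
    ≡⟨ cong (λ z → f x ℤ.+ z) (trans (sum-∷ʳ (weave v w) y f) (cong (ℤ._+ f y) (sum-weave v w f))) ⟩
  f x ℤ.+ (∑ (Vec.toList v) f ℤ.+ ∑ (Vec.toList w) f ℤ.+ f y)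
    ≡⟨ regroup (f x) (f y) (∑ (Vec.toList v) f) (∑ (Vec.toList w) f) ⟩
  (f x ℤ.+ ∑ (Vec.toList v) f) ℤ.+ (f y ℤ.+ ∑ (Vec.toList w) f)  ∎
  where
  open ≡-Reasoning
  regroup : ∀ x y v w → x ℤ.+ (v ℤ.+ w ℤ.+ y) ≡ (x ℤ.+ v) ℤ.+ (y ℤ.+ w)
  regroup = ℤ.solve-∀

sum-toList-map : ∀ {B : Set} (h : A → B) (v : Vec A m) f → ∑ (Vec.toList (Vec.map h v)) f ≡ ∑ (Vec.toList v) (f ∘ h)
sum-toList-map h []      f = refl
sum-toList-map h (x ∷ v) f = cong (λ z → f (h x) ℤ.+ z) (sum-toList-map h v f)

sum-const-1 : ∀ (v : Vec A m) → ∑ (Vec.toList v) (const 1ℤ) ≡ + m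
sum-const-1 []      = refl
sum-const-1 {m = suc m} (x ∷ v) = trans (cong (λ z → 1ℤ ℤ.+ z) (sum-const-1 v)) (sym (ℤ.pos-+ 1 m))

lookup-content : ∀ (w : Vec (Fin n) m) i → + lookup (content w) i ≡ ∑[ j ∈ Vec.toList w ] ⟦ j Fin.≟ i ⟧
lookup-content {n} [] i = cong +_ (Vec.lookup-replicate i 0)
lookup-content (j ∷ w) i with j Fin.≟ i
... | yes refl = trans (cong +_ (Vec.lookup∘updateAt i (content w)))
  (trans (ℤ.pos-+ 1 (lookup (content w) i)) (cong (λ z → 1ℤ ℤ.+ z) (lookup-content w i)))
... | no  j≢i  = trans (cong +_ (Vec.lookup∘updateAt′ i j (j≢i ∘ sym) (content w)))
  (trans (lookup-content w i) (sym (ℤ.+-identityˡ _)))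

-- The weight of a filling

count : Fin n → ∀ {μ} → Filling n μ → ℤ
count i {μ} F = ∑[ u ∈ cells μ ] ⟦ F ⟨ u ⟩ Fin.≟ i ⟧

count-∷ : ∀ (i : Fin n) {m μ} (w : Vec (Fin n) m) (F : Filling n μ) →
          count i {m ∷ μ} (w ∷ F) ≡ (∑[ j ∈ Vec.toList w ] ⟦ j Fin.≟ i ⟧) ℤ.+ count i F
count-∷ i {m} {μ} w F = trans (sum-cells m μ (λ u → ⟦ _⟨_⟩ {μ = m ∷ μ} (w ∷ F) u Fin.≟ i ⟧))
  (cong (ℤ._+ count i F) (sum-lookup w (λ j → ⟦ j Fin.≟ i ⟧)))

count-longRows : ∀ (i : Fin n) p (g : Fin p → Vec (Fin n) k) →
  count i (longRows p g) ≡ ∑[ r ∈ allFin p ] ∑[ j ∈ Vec.toList (g r) ] ⟦ j Fin.≟ i ⟧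
count-longRows {k = k} i zero g = trans (count-∷ i {k ℕ.* 0} (Vec.cast (sym (ℕ.*-zeroʳ k)) []) [])
  (cong (λ xs → ∑ xs (λ j → ⟦ j Fin.≟ i ⟧) ℤ.+ 0ℤ) (Vec.toList-cast (sym (ℕ.*-zeroʳ k)) []))
count-longRows {k = k} i (suc p) g = trans (count-∷ i (Vec.cast (sym (ℕ.*-identityʳ k)) (g Fin.zero)) (longRows p (g ∘ Fin.suc)))
  (trans (cong₂ (λ xs y → ∑ xs (λ j → ⟦ j Fin.≟ i ⟧) ℤ.+ y)
      (Vec.toList-cast (sym (ℕ.*-identityʳ k)) (g Fin.zero)) (count-longRows i p (g ∘ Fin.suc)))
    (sym (ℤΣ.sum-allFin p (λ r → ∑[ j ∈ Vec.toList (g r) ] ⟦ j Fin.≟ i ⟧))))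

sum-punchIn : ∀ (j i : Fin (suc m)) → ∑[ r ∈ allFin m ] ⟦ punchIn j r Fin.≟ i ⟧ ≡ 1ℤ ℤ.- ⟦ j Fin.≟ i ⟧
sum-punchIn {m} j i with j Fin.≟ i
... | yes refl = ℤΣ.sum-0 (allFin m) λ {r} _ → ℤΣ.[]-no (punchIn j r Fin.≟ j) (Fin.punchInᵢ≢i j r)
... | no  j≢i  = trans
  (ℤΣ.sum-single (λ r → ⟦ punchIn j r Fin.≟ i ⟧) (Unique.allFin⁺ m) (∈.∈-allFin (Fin.punchOut j≢i))
    λ {r} r≢ → ℤΣ.[]-no (punchIn j r Fin.≟ i) λ eq →
      r≢ (Fin.punchIn-injective j r _ (trans eq (sym (Fin.punchIn-punchOut j≢i)))))
  (ℤΣ.[]-yes (punchIn j (Fin.punchOut j≢i) Fin.≟ i) (Fin.punchIn-punchOut j≢i))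

module _ {k p : ℕ} (a b : Vec (Fin (2 ℕ.+ p)) k) where

  -- The letter i occurs β_i times in the short columns and once in each of the k - α_i long columns
  -- that do not omit it.
  count-fill : ∀ i → count i (fill a b) ≡ (+ lookup (content b) i ℤ.- + lookup (content a) i) ℤ.+ + k
  count-fill i = begin
    count i (fill a b)
      ≡⟨ count-∷ i (weave (Vec.map (λ j → punchIn j Fin.zero) a) b) (longRows p row-a) ⟩
    ∑ (Vec.toList (weave (Vec.map (λ j → punchIn j Fin.zero) a) b)) is-i ℤ.+ count i (longRows p row-a)
      ≡⟨ cong₂ ℤ._+_ (sum-weave (Vec.map (λ j → punchIn j Fin.zero) a) b is-i) (count-longRows i p row-a) ⟩
    ∑ (Vec.toList (Vec.map (λ j → punchIn j Fin.zero) a)) is-i ℤ.+ ∑ (Vec.toList b) is-i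
      ℤ.+ (∑[ r ∈ allFin p ] ∑ (Vec.toList (row-a r)) is-i)
      ≡⟨ cong₂ (λ x y → x ℤ.+ ∑ (Vec.toList b) is-i ℤ.+ y) (sum-toList-map (λ j → punchIn j Fin.zero) a is-i)
           (trans (ℤΣ.sum-cong (allFin p) λ r → sum-toList-map (λ j → punchIn j (Fin.suc r)) a is-i)
                  (ℤΣ.sum-swap (allFin p) (Vec.toList a) λ r j → is-i (punchIn j (Fin.suc r)))) ⟩
    ∑ as (λ j → is-i (punchIn j Fin.zero)) ℤ.+ ∑ (Vec.toList b) is-i
      ℤ.+ ∑ as (λ j → ∑[ r ∈ allFin p ] is-i (punchIn j (Fin.suc r)))
      ≡⟨ regroup (∑ as (λ j → is-i (punchIn j Fin.zero))) (∑ (Vec.toList b) is-i) _ ⟩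
    ∑ (Vec.toList b) is-i ℤ.+ (∑ as (λ j → is-i (punchIn j Fin.zero))
      ℤ.+ ∑ as (λ j → ∑[ r ∈ allFin p ] is-i (punchIn j (Fin.suc r))))
      ≡⟨ cong₂ ℤ._+_ (sym (lookup-content b i))
           (sym (ℤΣ.sum-+ as (λ j → is-i (punchIn j Fin.zero)) (λ j → ∑[ r ∈ allFin p ] is-i (punchIn j (Fin.suc r))))) ⟩
    + lookup (content b) i ℤ.+ ∑ as (λ j → is-i (punchIn j Fin.zero) ℤ.+ (∑[ r ∈ allFin p ] is-i (punchIn j (Fin.suc r))))
      ≡⟨ cong (λ z → + lookup (content b) i ℤ.+ z) (ℤΣ.sum-cong as λ j →
           trans (sym (ℤΣ.sum-allFin p (λ r → is-i (punchIn j r)))) (sum-punchIn j i)) ⟩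
    + lookup (content b) i ℤ.+ ∑ as (λ j → 1ℤ ℤ.- is-i j)
      ≡⟨ cong (λ z → + lookup (content b) i ℤ.+ z) complement ⟩
    + lookup (content b) i ℤ.+ (+ k ℤ.- + lookup (content a) i)
      ≡⟨ regroup′ (+ lookup (content b) i) (+ k) (+ lookup (content a) i) ⟩
    (+ lookup (content b) i ℤ.- + lookup (content a) i) ℤ.+ + k  ∎
    where
    open ≡-Reasoning
    as = Vec.toList a
    row-a = λ r → Vec.map (λ j → punchIn j (Fin.suc r)) a
    is-i : Fin (2 ℕ.+ p) → ℤ
    is-i j = ⟦ j Fin.≟ i ⟧
    regroup : ∀ x y z → x ℤ.+ y ℤ.+ z ≡ y ℤ.+ (x ℤ.+ z)
    regroup = ℤ.solve-∀
    regroup′ : ∀ x y z → x ℤ.+ (y ℤ.- z) ≡ (x ℤ.- z) ℤ.+ y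
    regroup′ = ℤ.solve-∀
    complement : ∑ as (λ j → 1ℤ ℤ.- is-i j) ≡ + k ℤ.- + lookup (content a) i
    complement = ℤGroup.∙-cancelʳ (+ lookup (content a) i) _ _ (begin
      ∑ as (λ j → 1ℤ ℤ.- is-i j) ℤ.+ + lookup (content a) i
        ≡⟨ cong (λ z → ∑ as (λ j → 1ℤ ℤ.- is-i j) ℤ.+ z) (lookup-content a i) ⟩
      ∑ as (λ j → 1ℤ ℤ.- is-i j) ℤ.+ ∑ as is-i
        ≡⟨ ℤΣ.sum-+ as (λ j → 1ℤ ℤ.- is-i j) is-i ⟨
      ∑ as (λ j → 1ℤ ℤ.- is-i j ℤ.+ is-i j)
        ≡⟨ ℤΣ.sum-cong as (λ j → ℤGroup.//-rightDividesˡ (is-i j) 1ℤ) ⟩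
      ∑ as (const 1ℤ)
        ≡⟨ sum-const-1 a ⟩
      + k
        ≡⟨ ℤGroup.//-rightDividesˡ (+ lookup (content a) i) (+ k) ⟨
      + k ℤ.- + lookup (content a) i ℤ.+ + lookup (content a) i  ∎)

  sum-shape : ℕ.sum (k · θ (2 ℕ.+ p)) ℕ./ (2 ℕ.+ p) ≡ k
  sum-shape = trans (ℕ./-congˡ (trans (cong (k ℕ.* 2 ℕ.+_) (sum-rows p)) (sym (ℕ.*-distribˡ-+ k 2 p)))) (ℕ.m*n/n≡m k (2 ℕ.+ p))
    where
    sum-rows : ∀ p → ℕ.sum (shape k p) ≡ k ℕ.* p
    sum-rows zero    = ℕ.+-identityʳ _
    sum-rows (suc p) = trans (cong (k ℕ.* 1 ℕ.+_) (sum-rows p)) (sym (ℕ.*-distribˡ-+ k 1 p))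

  x̄-fill : x̄^F (fill a b) ≡ weight a b
  x̄-fill = lookup-injective λ i → begin
    lookup (x̄^F (fill a b)) i
      ≡⟨ Vec.lookup-map i (ℤ._- + (ℕ.sum (k · θ (2 ℕ.+ p)) ℕ./ (2 ℕ.+ p))) (x^F (fill a b)) ⟩
    lookup (x^F (fill a b)) i ℤ.- + (ℕ.sum (k · θ (2 ℕ.+ p)) ℕ./ (2 ℕ.+ p))
      ≡⟨ cong₂ (λ x y → x ℤ.- + y) (Vec.lookup∘tabulate (λ i → + length (filter (λ u → fill a b ⟨ u ⟩ Fin.≟ i) (cells (k · θ (2 ℕ.+ p))))) i) sum-shape ⟩
    + length (filter (λ u → fill a b ⟨ u ⟩ Fin.≟ i) (cells (k · θ (2 ℕ.+ p)))) ℤ.- + k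
      ≡⟨ cong (ℤ._- + k) (trans (length-filter (λ u → fill a b ⟨ u ⟩ Fin.≟ i) (cells (k · θ (2 ℕ.+ p)))) (count-fill i)) ⟩
    (+ lookup (content b) i ℤ.- + lookup (content a) i) ℤ.+ + k ℤ.- + k
      ≡⟨ ℤGroup.//-rightDividesʳ (+ k) (+ lookup (content b) i ℤ.- + lookup (content a) i) ⟩
    + lookup (content b) i ℤ.- + lookup (content a) i
      ≡⟨ Vec.lookup-zipWith _ i (content a) (content b) ⟨
    lookup (weight a b) i  ∎
    where open ≡-Reasoning

-- The statistic inv of a filling

-- The sum of h(v_c, w_d) over positions c < d. The lengths may differ, since the first row is twice
-- as long as the second.
crossSum : {A B : Set} → (A → B → ℤ) → Vec A m → Vec B n → ℤ
crossSum h []      w       = 0ℤ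
crossSum h (x ∷ v) []      = 0ℤ
crossSum h (x ∷ v) (y ∷ w) = ∑ (Vec.toList w) (h x) ℤ.+ crossSum h v w

module _ {A B : Set} where

  crossSum-allFin : ∀ (h : A → B → ℤ) (v : Vec A m) (w : Vec B n) →
    ∑[ c ∈ allFin m ] ∑[ c′ ∈ allFin n ] ⟦ toℕ c ℕ.<? toℕ c′ ⟧ ℤ.* h (lookup v c) (lookup w c′) ≡ crossSum h v w
  crossSum-allFin h []      w  = refl
  crossSum-allFin {suc m} h (x ∷ v) [] = ℤΣ.sum-0 (allFin (suc m)) λ _ → refl
  crossSum-allFin {suc m} {suc n} h (x ∷ v) (y ∷ w) = trans
    (ℤΣ.sum-allFin m (λ c → ∑[ c′ ∈ allFin (suc n) ] entry c c′))
    (cong₂ ℤ._+_ first rest)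
    where
    entry : Fin (suc m) → Fin (suc n) → ℤ
    entry c c′ = ⟦ toℕ c ℕ.<? toℕ c′ ⟧ ℤ.* h (lookup (x ∷ v) c) (lookup (y ∷ w) c′)
    first : ∑[ c′ ∈ allFin (suc n) ] entry Fin.zero c′ ≡ ∑ (Vec.toList w) (h x)
    first = trans (ℤΣ.sum-allFin n (entry Fin.zero)) (trans (ℤ.+-identityˡ _)
      (trans (ℤΣ.sum-cong (allFin n) λ c′ → ℤ.*-identityˡ (h x (lookup w c′))) (sum-lookup w (h x))))
    rest : ∑[ c ∈ allFin m ] ∑[ c′ ∈ allFin (suc n) ] entry (Fin.suc c) c′ ≡ crossSum h v w
    rest = trans
      (ℤΣ.sum-cong (allFin m) λ c → trans (ℤΣ.sum-allFin n (entry (Fin.suc c))) (ℤ.+-identityˡ _))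
      (crossSum-allFin h v w)

  crossSum-cong : ∀ {h h′ : A → B → ℤ} → (∀ x y → h x y ≡ h′ x y) → ∀ (v : Vec A m) (w : Vec B n) →
                  crossSum h v w ≡ crossSum h′ v w
  crossSum-cong h≡ []      w       = refl
  crossSum-cong h≡ (x ∷ v) []      = refl
  crossSum-cong h≡ (x ∷ v) (y ∷ w) = cong₂ ℤ._+_ (ℤΣ.sum-cong (Vec.toList w) (h≡ x)) (crossSum-cong h≡ v w)

  crossSum-0 : ∀ (v : Vec A m) (w : Vec B n) → crossSum (λ _ _ → 0ℤ) v w ≡ 0ℤ
  crossSum-0 []      w       = refl
  crossSum-0 (x ∷ v) []      = refl
  crossSum-0 (x ∷ v) (y ∷ w) = cong₂ ℤ._+_ (ℤΣ.sum-0 (Vec.toList w) λ _ → refl) (crossSum-0 v w)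

  crossSum-+ : ∀ (h h′ : A → B → ℤ) (v : Vec A m) (w : Vec B n) →
               crossSum (λ x y → h x y ℤ.+ h′ x y) v w ≡ crossSum h v w ℤ.+ crossSum h′ v w
  crossSum-+ h h′ []      w       = refl
  crossSum-+ h h′ (x ∷ v) []      = refl
  crossSum-+ h h′ (x ∷ v) (y ∷ w) = trans
    (cong₂ ℤ._+_ (ℤΣ.sum-+ (Vec.toList w) (h x) (h′ x)) (crossSum-+ h h′ v w))
    (regroup (∑ (Vec.toList w) (h x)) (∑ (Vec.toList w) (h′ x)) (crossSum h v w) (crossSum h′ v w))
    where
    regroup : ∀ a b c d → (a ℤ.+ b) ℤ.+ (c ℤ.+ d) ≡ (a ℤ.+ c) ℤ.+ (b ℤ.+ d)
    regroup = ℤ.solve-∀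

  crossSum-cast : ∀ {m m′ n n′} (h : A → B → ℤ) (m≡ : m ≡ m′) (n≡ : n ≡ n′) v w →
                  crossSum h (Vec.cast m≡ v) (Vec.cast n≡ w) ≡ crossSum h v w
  crossSum-cast h refl refl v w = cong₂ (crossSum h) (Vec.cast-is-id refl v) (Vec.cast-is-id refl w)

  crossSum-emptyʳ : ∀ (h : A → B → ℤ) (v : Vec A m) (w : Vec B n) → n ≡ 0 → crossSum h v w ≡ 0ℤ
  crossSum-emptyʳ h []      [] _ = refl
  crossSum-emptyʳ h (x ∷ v) [] _ = refl

  crossSum-∷ʳˡ : ∀ (h : A → B → ℤ) (v : Vec A m) (w : Vec B n) y → n ≤ m →
                 crossSum h (v Vec.∷ʳ y) w ≡ crossSum h v w
  crossSum-∷ʳˡ h []      []      y _       = refl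
  crossSum-∷ʳˡ h (x ∷ v) []      y _       = refl
  crossSum-∷ʳˡ h (x ∷ v) (z ∷ w) y (s≤s n≤m) =
    cong (λ t → ∑ (Vec.toList w) (h x) ℤ.+ t) (crossSum-∷ʳˡ h v w y n≤m)

  -- Only c < d < k matters, and the first k entries of the woven row are v. So no cell of the
  -- second row attacks a short column.
  crossSum-weaveˡ : ∀ (h : A → B → ℤ) (v v′ : Vec A k) (w : Vec B k) →
                    crossSum h (weave v v′) w ≡ crossSum h v w
  crossSum-weaveˡ h []      []       []      = refl
  crossSum-weaveˡ {suc k} h (x ∷ v) (y ∷ v′) (z ∷ w) = cong (λ t → ∑ (Vec.toList w) (h x) ℤ.+ t)
    (trans (crossSum-∷ʳˡ h (weave v v′) w y (ℕ.m≤m*n k 2)) (crossSum-weaveˡ h v v′ w))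

crossSum-map : ∀ {A A′ B B′ : Set} (h : A′ → B′ → ℤ) (f : A → A′) (g : B → B′) (v : Vec A m) (w : Vec B n) →
               crossSum h (Vec.map f v) (Vec.map g w) ≡ crossSum (λ x y → h (f x) (g y)) v w
crossSum-map h f g []      w       = refl
crossSum-map h f g (x ∷ v) []      = refl
crossSum-map h f g (x ∷ v) (y ∷ w) = cong₂ ℤ._+_ (sum-toList-map g w (h (f x))) (crossSum-map h f g v w)

crossSum-∷ʳ : ∀ (h : A → A → ℤ) (v : Vec A m) y →
              crossSum h (v Vec.∷ʳ y) (v Vec.∷ʳ y) ≡ crossSum h v v ℤ.+ ∑ (Vec.toList v) (λ x → h x y)
crossSum-∷ʳ h []      y = refl
crossSum-∷ʳ h (x ∷ v) y = trans (cong₂ ℤ._+_ (sum-∷ʳ v y (h x)) (crossSum-∷ʳ h v y))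
  (regroup (∑ (Vec.toList v) (h x)) (h x y) (crossSum h v v) (∑ (Vec.toList v) (λ x → h x y)))
  where
  regroup : ∀ a b c d → (a ℤ.+ b) ℤ.+ (c ℤ.+ d) ≡ (a ℤ.+ c) ℤ.+ (b ℤ.+ d)
  regroup = ℤ.solve-∀

-- The right half is w read backwards, which exchanges the arguments of h there, and every entry of
-- v stands to the left of every entry of w.
crossSum-weave : ∀ (h : A → A → ℤ) (v w : Vec A k) →
  crossSum h (weave v w) (weave v w) ≡
  crossSum h v v ℤ.+ crossSum (flip h) w w ℤ.+ (∑[ x ∈ Vec.toList v ] ∑[ y ∈ Vec.toList w ] h x y)
crossSum-weave h []      []      = refl
crossSum-weave h (x ∷ v) (y ∷ w) = begin
  ∑ (Vec.toList (W Vec.∷ʳ y)) (h x) ℤ.+ crossSum h (W Vec.∷ʳ y) (W Vec.∷ʳ y)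
    ≡⟨ cong₂ ℤ._+_ (trans (sum-∷ʳ W y (h x)) (cong (ℤ._+ h x y) (sum-weave v w (h x))))
         (trans (crossSum-∷ʳ h W y) (cong₂ ℤ._+_ (crossSum-weave h v w) (sum-weave v w (λ z → h z y)))) ⟩
  (∑ vs (h x) ℤ.+ ∑ ws (h x) ℤ.+ h x y) ℤ.+
    (crossSum h v v ℤ.+ crossSum (flip h) w w ℤ.+ ∑ vs (λ x → ∑ ws (h x)) ℤ.+ (∑ vs (λ z → h z y) ℤ.+ ∑ ws (λ z → h z y)))
    ≡⟨ regroup (∑ vs (h x)) (∑ ws (h x)) (h x y) (crossSum h v v) (crossSum (flip h) w w)
         (∑ vs (λ x → ∑ ws (h x))) (∑ vs (λ z → h z y)) (∑ ws (λ z → h z y)) ⟩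
  (∑ vs (h x) ℤ.+ crossSum h v v) ℤ.+ (∑ ws (λ z → h z y) ℤ.+ crossSum (flip h) w w) ℤ.+
    (h x y ℤ.+ ∑ ws (h x) ℤ.+ (∑ vs (λ z → h z y) ℤ.+ ∑ vs (λ x → ∑ ws (h x))))
    ≡⟨ cong (λ z → (∑ vs (h x) ℤ.+ crossSum h v v) ℤ.+ (∑ ws (λ z → h z y) ℤ.+ crossSum (flip h) w w) ℤ.+
         (h x y ℤ.+ ∑ ws (h x) ℤ.+ z)) (ℤΣ.sum-+ vs (λ z → h z y) (λ x → ∑ ws (h x))) ⟨
  (∑ vs (h x) ℤ.+ crossSum h v v) ℤ.+ (∑ ws (λ z → h z y) ℤ.+ crossSum (flip h) w w) ℤ.+
    (h x y ℤ.+ ∑ ws (h x) ℤ.+ ∑ vs (λ z → h z y ℤ.+ ∑ ws (h z)))  ∎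
  where
  open ≡-Reasoning
  W = weave v w
  vs = Vec.toList v
  ws = Vec.toList w
  regroup : ∀ a b c d e f g i → (a ℤ.+ b ℤ.+ c) ℤ.+ (d ℤ.+ e ℤ.+ f ℤ.+ (g ℤ.+ i)) ≡
            (a ℤ.+ d) ℤ.+ (i ℤ.+ e) ℤ.+ (c ℤ.+ b ℤ.+ (g ℤ.+ f))
  regroup = ℤ.solve-∀

lt gt : Fin n → Fin n → ℤ
lt i j = ⟦ i Fin.<? j ⟧
gt i j = ⟦ j Fin.<? i ⟧

module _ {n : ℕ} where

  attack : ∀ {μ} → Filling n μ → Cell μ → Cell μ → ℤ
  attack F u v = ⟦ invAttacks? u v ×-dec (F ⟨ v ⟩ Fin.<? F ⟨ u ⟩) ⟧

  invSum : ∀ {μ} → Filling n μ → ℤ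
  invSum {μ} F = ∑[ u ∈ cells μ ] ∑[ v ∈ cells μ ] attack F u v

  length-Inv : ∀ {μ} (F : Filling n μ) → + length (Inv F) ≡ invSum F
  length-Inv {μ} F = trans
    (length-filter (λ (u , v) → invAttacks? u v ×-dec (F ⟨ v ⟩ Fin.<? F ⟨ u ⟩)) (cartesianProduct (cells μ) (cells μ)))
    (ℤΣ.sum-cartesianProductWith _,_ (cells μ) (cells μ) (λ (u , v) → attack F u v))

  crossNext : ∀ {m μ} → Vec (Fin n) m → Filling n μ → ℤ
  crossNext w []       = 0ℤ
  crossNext w (w′ ∷ F) = crossSum lt w w′

  -- Attacks join cells of the same row or of adjacent rows, so a new top row meets only itself and
  -- the row below it. In the latter case the attacker is the lower cell, which turns the comparison
  -- into `lt` seen from above.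
  invSum-∷ : ∀ {m μ} (w : Vec (Fin n) m) (F : Filling n μ) →
             invSum {m ∷ μ} (w ∷ F) ≡ crossSum gt w w ℤ.+ crossNext w F ℤ.+ invSum F
  invSum-∷ {m} {μ} w F = begin
    ∑[ u ∈ cells (m ∷ μ) ] ∑[ v ∈ cells (m ∷ μ) ] att u v
      ≡⟨ sum-cells m μ (λ u → ∑[ v ∈ cells (m ∷ μ) ] att u v) ⟩
    (∑[ c ∈ allFin m ] ∑[ v ∈ cells (m ∷ μ) ] att (top c) v) ℤ.+ (∑[ u ∈ cells μ ] ∑[ v ∈ cells (m ∷ μ) ] att (lower m u) v)
      ≡⟨ cong₂ ℤ._+_
           (trans (ℤΣ.sum-cong (allFin m) λ c → trans (sum-cells m μ (att (top c)))
                    -- A cell of the top row attacks nothing below it: the comparisons of row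
                    -- numbers evaluate to `false`, hence `refl`.
                    (trans (cong (λ z → (∑[ c′ ∈ allFin m ] att (top c) (top c′)) ℤ.+ z) (ℤΣ.sum-0 (cells μ) λ _ → refl)) (ℤ.+-identityʳ _)))
                  same-row)
           (trans (ℤΣ.sum-cong (cells μ) λ u → sum-cells m μ (att (lower m u)))
                  (trans (ℤΣ.sum-+ (cells μ) (λ u → ∑[ c′ ∈ allFin m ] att (lower m u) (top c′)) (λ u → ∑[ v ∈ cells μ ] attack F u v))
                         (cong (ℤ._+ invSum F) (next-row F)))) ⟩
    crossSum gt w w ℤ.+ (crossNext w F ℤ.+ invSum F)
      ≡⟨ ℤ.+-assoc (crossSum gt w w) _ _ ⟨
    crossSum gt w w ℤ.+ crossNext w F ℤ.+ invSum F  ∎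
    where
    open ≡-Reasoning
    att = attack {m ∷ μ} (w ∷ F)
    top : Fin m → Cell (m ∷ μ)
    top c = cell Fin.zero c

    same-row : ∑[ c ∈ allFin m ] ∑[ c′ ∈ allFin m ] att (top c) (top c′) ≡ crossSum gt w w
    same-row = trans
      (ℤΣ.sum-cong (allFin m) λ c → ℤΣ.sum-cong (allFin m) λ c′ → trans
        (ℤΣ.[]-⇔ (invAttacks? (top c) (top c′) ×-dec (lookup w c′ Fin.<? lookup w c))
                 ((toℕ c ℕ.<? toℕ c′) ×-dec (lookup w c′ Fin.<? lookup w c))
          (λ { (inj₁ (_ , c<c′) , w>) → c<c′ , w> }) (λ (c<c′ , w>) → inj₁ (refl , c<c′) , w>))
        (ℤΣ.[]-× (toℕ c ℕ.<? toℕ c′) (lookup w c′ Fin.<? lookup w c)))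
      (crossSum-allFin gt w w)

    next-row : ∀ {μ} (F : Filling n μ) →
      ∑[ u ∈ cells μ ] ∑[ c′ ∈ allFin m ] attack {m ∷ μ} (w ∷ F) (lower m u) (cell Fin.zero c′) ≡ crossNext w F
    next-row []                   = refl
    next-row {m′ ∷ μ′} (w′ ∷ F′) = begin
      ∑[ u ∈ cells (m′ ∷ μ′) ] ∑[ c′ ∈ allFin m ] att′ (lower m u) c′
        ≡⟨ sum-cells m′ μ′ (λ u → ∑[ c′ ∈ allFin m ] att′ (lower m u) c′) ⟩
      (∑[ c ∈ allFin m′ ] ∑[ c′ ∈ allFin m ] att′ (lower m (cell Fin.zero c)) c′) ℤ.+
        (∑[ u ∈ cells μ′ ] ∑[ c′ ∈ allFin m ] att′ (lower m (lower m′ u)) c′)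
        ≡⟨ trans (cong₂ ℤ._+_ (ℤΣ.sum-cong (allFin m′) λ c → ℤΣ.sum-cong (allFin m) λ c′ → trans
               (ℤΣ.[]-⇔ (invAttacks? {m ∷ m′ ∷ μ′} (lower m (cell Fin.zero c)) (cell Fin.zero c′) ×-dec (lookup w c′ Fin.<? lookup w′ c))
                        ((toℕ c′ ℕ.<? toℕ c) ×-dec (lookup w c′ Fin.<? lookup w′ c))
                 (λ { (inj₂ (_ , c′<c) , w<) → c′<c , w< }) (λ (c′<c , w<) → inj₂ (refl , c′<c) , w<))
               (ℤΣ.[]-× (toℕ c′ ℕ.<? toℕ c) (lookup w c′ Fin.<? lookup w′ c)))
             (ℤΣ.sum-0 (cells μ′) λ _ → ℤΣ.sum-0 (allFin m) λ _ → refl)) (ℤ.+-identityʳ _) ⟩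
      ∑[ c ∈ allFin m′ ] ∑[ c′ ∈ allFin m ] ⟦ toℕ c′ ℕ.<? toℕ c ⟧ ℤ.* lt (lookup w c′) (lookup w′ c)
        ≡⟨ ℤΣ.sum-swap (allFin m′) (allFin m) (λ c c′ → ⟦ toℕ c′ ℕ.<? toℕ c ⟧ ℤ.* lt (lookup w c′) (lookup w′ c)) ⟩
      ∑[ c′ ∈ allFin m ] ∑[ c ∈ allFin m′ ] ⟦ toℕ c′ ℕ.<? toℕ c ⟧ ℤ.* lt (lookup w c′) (lookup w′ c)
        ≡⟨ crossSum-allFin lt w w′ ⟩
      crossSum lt w w′  ∎
      where att′ = λ u (c′ : Fin m) → attack {m ∷ m′ ∷ μ′} (w ∷ w′ ∷ F′) u (cell Fin.zero c′)

  -- The contribution of two columns of the same height, apart from the arms.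
  columnInv : (x y : Fin m → Fin n) → ℤ
  columnInv {zero}        x y = 0ℤ
  columnInv {suc zero}    x y = gt (x Fin.zero) (y Fin.zero)
  columnInv {suc (suc m)} x y = gt (x Fin.zero) (y Fin.zero) ℤ.+ lt (x Fin.zero) (y (Fin.suc Fin.zero))
    ℤ.+ columnInv (x ∘ Fin.suc) (y ∘ Fin.suc)

  -- Regroups the inversions from rows to pairs of columns. The bottom row, of length `k ℕ.* 0`,
  -- contributes nothing.
  invSum-longRows : ∀ {A : Set} p (φ : Fin p → A → Fin n) (a : Vec A k) →
    invSum (longRows p (λ r → Vec.map (φ r) a)) ≡ crossSum (λ i j → columnInv (λ r → φ r i) (λ r → φ r j)) a a
  invSum-longRows {k} zero φ a = trans (invSum-∷ {k ℕ.* 0} (Vec.cast (sym (ℕ.*-zeroʳ k)) []) [])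
    (trans (trans (ℤ.+-identityʳ _) (ℤ.+-identityʳ _))
      (trans (crossSum-emptyʳ gt (Vec.cast (sym (ℕ.*-zeroʳ k)) []) (Vec.cast (sym (ℕ.*-zeroʳ k)) []) (ℕ.*-zeroʳ k)) (sym (crossSum-0 a a))))
  invSum-longRows {k} (suc zero) φ a = trans (invSum-∷ (Vec.cast e row₀) (longRows zero (λ r → Vec.map (φ (Fin.suc r)) a)))
    (trans (cong₂ (λ x y → crossSum gt (Vec.cast e row₀) (Vec.cast e row₀) ℤ.+ x ℤ.+ y)
        (crossSum-emptyʳ lt (Vec.cast e row₀) (Vec.cast (sym (ℕ.*-zeroʳ k)) []) (ℕ.*-zeroʳ k))
        (trans (invSum-longRows zero (φ ∘ Fin.suc) a) (crossSum-0 a a)))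
      (trans (trans (ℤ.+-identityʳ _) (ℤ.+-identityʳ _))
        (trans (crossSum-cast gt e e row₀ row₀) (crossSum-map gt (φ Fin.zero) (φ Fin.zero) a a))))
    where
    e = sym (ℕ.*-identityʳ k)
    row₀ = Vec.map (φ Fin.zero) a
  invSum-longRows {k} (suc (suc p)) φ a = begin
    invSum (longRows (suc (suc p)) (λ r → Vec.map (φ r) a))
      ≡⟨ invSum-∷ (Vec.cast e row₀) (longRows (suc p) (λ r → Vec.map (φ (Fin.suc r)) a)) ⟩
    crossSum gt (Vec.cast e row₀) (Vec.cast e row₀) ℤ.+ crossSum lt (Vec.cast e row₀) (Vec.cast e row₁)
      ℤ.+ invSum (longRows (suc p) (λ r → Vec.map (φ (Fin.suc r)) a))
      ≡⟨ cong₂ ℤ._+_ (cong₂ ℤ._+_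
           (trans (crossSum-cast gt e e row₀ row₀) (crossSum-map gt (φ Fin.zero) (φ Fin.zero) a a))
           (trans (crossSum-cast lt e e row₀ row₁) (crossSum-map lt (φ Fin.zero) (φ (Fin.suc Fin.zero)) a a)))
           (invSum-longRows (suc p) (φ ∘ Fin.suc) a) ⟩
    crossSum h₀ a a ℤ.+ crossSum h₁ a a ℤ.+ crossSum h₂ a a
      ≡⟨ cong (ℤ._+ crossSum h₂ a a) (crossSum-+ h₀ h₁ a a) ⟨
    crossSum (λ i j → h₀ i j ℤ.+ h₁ i j) a a ℤ.+ crossSum h₂ a a
      ≡⟨ crossSum-+ (λ i j → h₀ i j ℤ.+ h₁ i j) h₂ a a ⟨
    crossSum (λ i j → h₀ i j ℤ.+ h₁ i j ℤ.+ h₂ i j) a a  ∎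
    where
    open ≡-Reasoning
    e = sym (ℕ.*-identityʳ k)
    row₀ = Vec.map (φ Fin.zero) a
    row₁ = Vec.map (φ (Fin.suc Fin.zero)) a
    h₀ = λ i j → gt (φ Fin.zero i) (φ Fin.zero j)
    h₁ = λ i j → lt (φ Fin.zero i) (φ (Fin.suc Fin.zero) j)
    h₂ = λ i j → columnInv (λ r → φ (Fin.suc r) i) (λ r → φ (Fin.suc r) j)

columnInv-suc : ∀ {x y : Fin m → Fin (suc n)} {x′ y′ : Fin m → Fin n} →
  (∀ r → x r ≡ Fin.suc (x′ r)) → (∀ r → y r ≡ Fin.suc (y′ r)) → columnInv x y ≡ columnInv x′ y′
columnInv-suc {zero}        x≡ y≡ = refl
columnInv-suc {suc zero}    x≡ y≡ = cong₂ gt (x≡ Fin.zero) (y≡ Fin.zero)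
columnInv-suc {suc (suc m)} x≡ y≡ = cong₂ ℤ._+_
  (cong₂ ℤ._+_ (cong₂ gt (x≡ Fin.zero) (y≡ Fin.zero)) (cong₂ lt (x≡ Fin.zero) (y≡ (Fin.suc Fin.zero))))
  (columnInv-suc (x≡ ∘ Fin.suc) (y≡ ∘ Fin.suc))

-- With letters and rows numbered from 0, each row r before the last contributes 1, plus an extra 1
-- exactly when i < j = r + 1; the last row contributes 1 exactly when i < j = p + 1. The induction
-- strips off the top row. The constant p is what the arms will cancel.
columnInv-punchIn : ∀ p (i j : Fin (2 ℕ.+ p)) → columnInv (punchIn i) (punchIn j) ≡ + p ℤ.+ lt i j
columnInv-punchIn zero Fin.zero           Fin.zero           = refl
columnInv-punchIn zero Fin.zero           (Fin.suc Fin.zero) = refl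
columnInv-punchIn zero (Fin.suc Fin.zero) Fin.zero           = refl
columnInv-punchIn zero (Fin.suc Fin.zero) (Fin.suc Fin.zero) = refl
columnInv-punchIn (suc p) i j = trans
  (cong (λ z → gt (punchIn i Fin.zero) (punchIn j Fin.zero) ℤ.+ lt (punchIn i Fin.zero) (punchIn j (Fin.suc Fin.zero)) ℤ.+ z)
    (trans (columnInv-suc {x′ = punchIn (pred i)} {punchIn (pred j)} (punchIn-suc i) (punchIn-suc j))
           (columnInv-punchIn p (pred i) (pred j))))
  (step i j)
  where
  -- The value missed once the top row is deleted and the other entries are lowered by one. A column
  -- that misses 0 still misses 0.
  pred : ∀ {m} → Fin (2 ℕ.+ m) → Fin (suc m)
  pred Fin.zero    = Fin.zero
  pred (Fin.suc i) = i
  punchIn-suc : ∀ {m} (i : Fin (2 ℕ.+ m)) r → punchIn i (Fin.suc r) ≡ Fin.suc (punchIn (pred i) r)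
  punchIn-suc Fin.zero    r = refl
  punchIn-suc (Fin.suc i) r = refl
  carry : ∀ x y → 0ℤ ℤ.+ 1ℤ ℤ.+ (x ℤ.+ y) ≡ 1ℤ ℤ.+ x ℤ.+ y
  carry = ℤ.solve-∀
  carry₁ : ∀ x → 1ℤ ℤ.+ 1ℤ ℤ.+ (x ℤ.+ 0ℤ) ≡ 1ℤ ℤ.+ x ℤ.+ 1ℤ
  carry₁ = ℤ.solve-∀
  carry₂ : ∀ x → 1ℤ ℤ.+ 0ℤ ℤ.+ (x ℤ.+ 1ℤ) ≡ 1ℤ ℤ.+ x ℤ.+ 1ℤ
  carry₂ = ℤ.solve-∀
  step : ∀ i j → gt (punchIn i Fin.zero) (punchIn j Fin.zero) ℤ.+ lt (punchIn i Fin.zero) (punchIn j (Fin.suc Fin.zero))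
    ℤ.+ (+ p ℤ.+ lt (pred i) (pred j)) ≡ + suc p ℤ.+ lt i j
  step Fin.zero    Fin.zero              = carry (+ p) 0ℤ
  step Fin.zero    (Fin.suc Fin.zero)    = carry₁ (+ p)
  step Fin.zero    (Fin.suc (Fin.suc j)) = carry₂ (+ p)
  step (Fin.suc i) Fin.zero              = carry (+ p) 0ℤ
  step (Fin.suc i) (Fin.suc j)           = carry (+ p) (lt i j)

-- Arms

pairs : ℕ → ℤ
pairs m = ∑[ c ∈ allFin m ] ∑[ c′ ∈ allFin m ] ⟦ toℕ c ℕ.<? toℕ c′ ⟧

pairs≡crossSum : ∀ (v : Vec A m) → pairs m ≡ crossSum (λ _ _ → 1ℤ) v v
pairs≡crossSum {m = m} v = trans
  (ℤΣ.sum-cong (allFin m) λ c → ℤΣ.sum-cong (allFin m) λ c′ → sym (ℤ.*-identityʳ ⟦ toℕ c ℕ.<? toℕ c′ ⟧))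
  (crossSum-allFin (λ _ _ → 1ℤ) v v)

rowOf : ∀ {μ} → Cell μ → Cell μ → ℤ
rowOf u v = ⟦ (row v ℕ.≟ row u) ×-dec (col u ℕ.<? col v) ⟧

pos-arm : ∀ {μ} (u : Cell μ) → + arm u ≡ ∑ (cells μ) (rowOf u)
pos-arm {μ} u = length-filter (λ v → (row v ℕ.≟ row u) ×-dec (col u ℕ.<? col v)) (cells μ)

armSum : Partition → ℤ
armSum μ = ∑[ u ∈ cells μ ] + arm u

arm-lower : ∀ m {μ} (u : Cell μ) → + arm (lower m u) ≡ + arm u
arm-lower m {μ} u = begin
  + arm (lower m u)
    ≡⟨ pos-arm (lower m u) ⟩
  ∑ (cells (m ∷ μ)) (rowOf (lower m u))
    ≡⟨ sum-cells m μ (rowOf (lower m u)) ⟩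
  ∑ (allFin m) (λ c → rowOf (lower m u) (cell Fin.zero c)) ℤ.+ ∑ (cells μ) (rowOf u)
    ≡⟨ cong (ℤ._+ ∑ (cells μ) (rowOf u)) (ℤΣ.sum-0 (allFin m) λ _ → refl) ⟩
  0ℤ ℤ.+ ∑ (cells μ) (rowOf u)
    ≡⟨ ℤ.+-identityˡ _ ⟩
  ∑ (cells μ) (rowOf u)
    ≡⟨ pos-arm u ⟨
  + arm u  ∎
  where open ≡-Reasoning

armSum-∷ : ∀ m μ → armSum (m ∷ μ) ≡ pairs m ℤ.+ armSum μ
armSum-∷ m μ = trans (sum-cells m μ (λ u → + arm u)) (cong₂ ℤ._+_
  (ℤΣ.sum-cong (allFin m) λ c → trans (pos-arm {m ∷ μ} (cell Fin.zero c))
    (trans (sum-cells m μ (rowOf (cell Fin.zero c)))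
      (trans (cong (λ z → (∑[ c′ ∈ allFin m ] ⟦ toℕ c ℕ.<? toℕ c′ ⟧) ℤ.+ z) (ℤΣ.sum-0 (cells μ) λ _ → refl))
             (ℤ.+-identityʳ _))))
  (ℤΣ.sum-cong (cells μ) (arm-lower m)))

-- The arms of a row of length k count its pairs of columns. The total is written as a sum over
-- pairs of letters of a so that it cancels against the same expression in `invSum-fill`.
armSum-shape : ∀ p (a : Vec A k) → armSum (shape k p) ≡ crossSum (λ _ _ → + p) a a
armSum-shape {k = k} zero a = trans (armSum-∷ (k ℕ.* 0) [])
  (trans (cong (λ m → pairs m ℤ.+ 0ℤ) (ℕ.*-zeroʳ k)) (sym (crossSum-0 a a)))
armSum-shape {k = k} (suc p) a = trans (armSum-∷ (k ℕ.* 1) (shape k p))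
  (trans (cong₂ ℤ._+_ (trans (cong pairs (ℕ.*-identityʳ k)) (pairs≡crossSum a)) (armSum-shape p a))
    (sym (crossSum-+ (λ _ _ → 1ℤ) (λ _ _ → + p) a a)))

crossNext-longRows : ∀ {m m′} {w : Vec (Fin n) m} {w′ : Vec (Fin n) m′} p (g : Fin p → Vec (Fin n) k) →
  (∀ (v : Vec (Fin n) k) → crossSum lt w v ≡ crossSum lt w′ v) →
  crossNext w (longRows p g) ≡ crossNext w′ (longRows p g)
crossNext-longRows {k = k} {w = w} {w′} zero g w≡ = trans
  (crossSum-emptyʳ lt w (Vec.cast (sym (ℕ.*-zeroʳ k)) []) (ℕ.*-zeroʳ k))
  (sym (crossSum-emptyʳ lt w′ (Vec.cast (sym (ℕ.*-zeroʳ k)) []) (ℕ.*-zeroʳ k)))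
crossNext-longRows {n} {k} {w = w} {w′} (suc p) g w≡ =
  trans (uncast w) (trans (w≡ (g Fin.zero)) (sym (uncast w′)))
  where
  e = sym (ℕ.*-identityʳ k)
  uncast : ∀ {m} (w : Vec (Fin n) m) → crossSum lt w (Vec.cast e (g Fin.zero)) ≡ crossSum lt w (g Fin.zero)
  uncast w = trans (cong (λ v → crossSum lt v (Vec.cast e (g Fin.zero))) (sym (Vec.cast-is-id refl w)))
    (crossSum-cast lt refl e w (g Fin.zero))

module _ {k p : ℕ} (a b : Vec (Fin (2 ℕ.+ p)) k) where

  private
    N = 2 ℕ.+ p
    F = fill a b
    heads = Vec.map (λ i → punchIn i Fin.zero) a
    row-a = λ r → Vec.map (λ i → punchIn i (Fin.suc r)) a

  firstRow-¬descent : ∀ c → ¬ IsDescent F (cell Fin.zero c)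
  firstRow-¬descent c (v , (() , _) , _)

  -- Columns increase strictly, so all arms outside the first row are subtracted in `inv`, whatever
  -- a and b are.
  lowerRow-descent : ∀ u → IsDescent F (lower (k ℕ.* 2) u)
  lowerRow-descent u with fillView a b (lower (k ℕ.* 2) u)
  ... | short c () _ _
  ... | long (Fin.suc r) c row-u col-u F-u with longCell (Fin.inject₁ r) c | longCell-fill (Fin.inject₁ r) c a b
  ... | v , row-v , col-v , _ | F-v = v ,
    (trans (cong suc (trans row-v (Fin.toℕ-inject₁ r))) (sym row-u) , trans col-v (sym col-u)) ,
    subst₂ Fin._<_ (sym F-v) (sym F-u) (punchIn-strictlyIncreasing (lookup a c) (Fin.inject₁ r) (Fin.suc r)
      (s≤s (ℕ.≤-reflexive (Fin.toℕ-inject₁ r))))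

  sum-arm-Des : + ℕ.sum (List.map arm (Des F)) ≡ crossSum (λ _ _ → + p) a a
  sum-arm-Des = begin
    + ℕ.sum (List.map arm (Des F))
      ≡⟨ pos-sum arm (Des F) ⟩
    ∑[ u ∈ Des F ] + arm u
      ≡⟨ ℤΣ.sum-filter (isDescent? F) (cells (k · θ N)) (λ u → + arm u) ⟩
    ∑[ u ∈ cells (k · θ N) ] ⟦ isDescent? F u ⟧ ℤ.* + arm u
      ≡⟨ sum-cells (k ℕ.* 2) (shape k p) (λ u → ⟦ isDescent? F u ⟧ ℤ.* + arm u) ⟩
    (∑[ c ∈ allFin (k ℕ.* 2) ] ⟦ isDescent? F (cell Fin.zero c) ⟧ ℤ.* + arm (top c)) ℤ.+
      (∑[ u ∈ cells (shape k p) ] ⟦ isDescent? F (lower (k ℕ.* 2) u) ⟧ ℤ.* + arm (lower (k ℕ.* 2) u))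
      ≡⟨ cong₂ ℤ._+_
           (ℤΣ.sum-0 (allFin (k ℕ.* 2)) λ {c} _ → trans (cong (ℤ._* + arm (top c))
             (ℤΣ.[]-no (isDescent? F (top c)) (firstRow-¬descent c))) (ℤ.*-zeroˡ (+ arm (top c))))
           (ℤΣ.sum-cong (cells (shape k p)) λ u → trans (cong₂ ℤ._*_
             (ℤΣ.[]-yes (isDescent? F (lower (k ℕ.* 2) u)) (lowerRow-descent u)) (arm-lower (k ℕ.* 2) u)) (ℤ.*-identityˡ (+ arm u))) ⟩
    0ℤ ℤ.+ armSum (shape k p)
      ≡⟨ ℤ.+-identityˡ _ ⟩
    armSum (shape k p)
      ≡⟨ armSum-shape p a ⟩
    crossSum (λ _ _ → + p) a a  ∎
    where
    open ≡-Reasoning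
    top : Fin (k ℕ.* 2) → Cell (k · θ N)
    top c = cell Fin.zero c

  mixed : ℤ
  mixed = ∑[ i ∈ Vec.toList a ] ∑[ j ∈ Vec.toList b ] gt (punchIn i Fin.zero) j

  -- A short column has one cell, and no cell of the second row lies to the right of it, so it meets
  -- the long columns in the first row only. These meetings are `mixed`; the short columns among
  -- themselves give b read backwards, which turns `gt` into `lt`.
  invSum-fill : invSum F ≡ crossSum (λ _ _ → + p) a a ℤ.+ (crossSum lt a a ℤ.+ crossSum lt b b ℤ.+ mixed)
  invSum-fill = begin
    invSum F
      ≡⟨ invSum-∷ (weave heads b) (longRows p row-a) ⟩
    crossSum gt (weave heads b) (weave heads b) ℤ.+ crossNext (weave heads b) (longRows p row-a) ℤ.+ invSum (longRows p row-a)
      ≡⟨ cong₂ (λ x y → x ℤ.+ y ℤ.+ invSum (longRows p row-a)) (crossSum-weave gt heads b) (crossNext-longRows p row-a (crossSum-weaveˡ lt heads b)) ⟩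
    crossSum gt heads heads ℤ.+ crossSum lt b b ℤ.+ ∑ (Vec.toList heads) (λ i → ∑ (Vec.toList b) (gt i))
      ℤ.+ crossNext heads (longRows p row-a) ℤ.+ invSum (longRows p row-a)
      ≡⟨ regroup (crossSum gt heads heads) (crossSum lt b b) _ (crossNext heads (longRows p row-a)) (invSum (longRows p row-a)) ⟩
    (crossSum gt heads heads ℤ.+ crossNext heads (longRows p row-a) ℤ.+ invSum (longRows p row-a))
      ℤ.+ (crossSum lt b b ℤ.+ ∑ (Vec.toList heads) (λ i → ∑ (Vec.toList b) (gt i)))
      ≡⟨ cong₂ (λ x y → x ℤ.+ (crossSum lt b b ℤ.+ y)) long-part
           (sum-toList-map (λ i → punchIn i Fin.zero) a (λ i → ∑ (Vec.toList b) (gt i))) ⟩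
    (crossSum (λ _ _ → + p) a a ℤ.+ crossSum lt a a) ℤ.+ (crossSum lt b b ℤ.+ mixed)
      ≡⟨ regroup′ (crossSum (λ _ _ → + p) a a) (crossSum lt a a) (crossSum lt b b) mixed ⟩
    crossSum (λ _ _ → + p) a a ℤ.+ (crossSum lt a a ℤ.+ crossSum lt b b ℤ.+ mixed)  ∎
    where
    open ≡-Reasoning
    regroup : ∀ x y z u v → x ℤ.+ y ℤ.+ z ℤ.+ u ℤ.+ v ≡ (x ℤ.+ u ℤ.+ v) ℤ.+ (y ℤ.+ z)
    regroup = ℤ.solve-∀
    regroup′ : ∀ x y z u → (x ℤ.+ y) ℤ.+ (z ℤ.+ u) ≡ x ℤ.+ (y ℤ.+ z ℤ.+ u)
    regroup′ = ℤ.solve-∀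
    e = sym (ℕ.*-identityʳ k)
    -- This is invSum of the long columns alone, a filling to which invSum-longRows applies.
    long-part : crossSum gt heads heads ℤ.+ crossNext heads (longRows p row-a) ℤ.+ invSum (longRows p row-a)
                ≡ crossSum (λ _ _ → + p) a a ℤ.+ crossSum lt a a
    long-part = begin
      crossSum gt heads heads ℤ.+ crossNext heads (longRows p row-a) ℤ.+ invSum (longRows p row-a)
        ≡⟨ cong (ℤ._+ invSum (longRows p row-a)) (cong₂ ℤ._+_ (sym (crossSum-cast gt e e heads heads)) (sym (crossNext-longRows p row-a λ v → trans (cong (λ z → crossSum lt (Vec.cast e heads) z) (sym (Vec.cast-is-id refl v))) (crossSum-cast lt e refl heads v)))) ⟩
      crossSum gt (Vec.cast e heads) (Vec.cast e heads) ℤ.+ crossNext (Vec.cast e heads) (longRows p row-a) ℤ.+ invSum (longRows p row-a)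
        ≡⟨ invSum-∷ (Vec.cast e heads) (longRows p row-a) ⟨
      invSum (longRows (suc p) (λ r → Vec.map (λ i → punchIn i r) a))
        ≡⟨ invSum-longRows (suc p) (λ r i → punchIn i r) a ⟩
      crossSum (λ i j → columnInv (punchIn i) (punchIn j)) a a
        ≡⟨ crossSum-cong (columnInv-punchIn p) a a ⟩
      crossSum (λ i j → + p ℤ.+ lt i j) a a
        ≡⟨ crossSum-+ (λ _ _ → + p) lt a a ⟩
      crossSum (λ _ _ → + p) a a ℤ.+ crossSum lt a a  ∎

  -- The top entry of a long column is 1, which exceeds nothing, unless the omitted letter is 1.
  -- Then it is 2 and exceeds only the letter 1.
  mixed≡ : mixed ≡ + lookup (content a) Fin.zero ℤ.* + lookup (content b) Fin.zero
  mixed≡ = begin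
    mixed
      ≡⟨ ℤΣ.sum-cong (Vec.toList a) (λ i → ℤΣ.sum-cong (Vec.toList b) (both-zero i)) ⟩
    ∑[ i ∈ Vec.toList a ] ∑[ j ∈ Vec.toList b ] ⟦ i Fin.≟ Fin.zero ⟧ ℤ.* ⟦ j Fin.≟ Fin.zero ⟧
      ≡⟨ ℤΣ.sum-*-sum (Vec.toList a) (Vec.toList b) (λ i → ⟦ i Fin.≟ Fin.zero ⟧) (λ j → ⟦ j Fin.≟ Fin.zero ⟧) ⟨
    ∑ (Vec.toList a) (λ i → ⟦ i Fin.≟ Fin.zero ⟧) ℤ.* ∑ (Vec.toList b) (λ j → ⟦ j Fin.≟ Fin.zero ⟧)
      ≡⟨ cong₂ ℤ._*_ (lookup-content a Fin.zero) (lookup-content b Fin.zero) ⟨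
    + lookup (content a) Fin.zero ℤ.* + lookup (content b) Fin.zero  ∎
    where
    open ≡-Reasoning
    both-zero : ∀ (i j : Fin N) → gt (punchIn i Fin.zero) j ≡ ⟦ i Fin.≟ Fin.zero ⟧ ℤ.* ⟦ j Fin.≟ Fin.zero ⟧
    both-zero Fin.zero    Fin.zero    = refl
    both-zero Fin.zero    (Fin.suc j) = refl
    both-zero (Fin.suc i) Fin.zero    = refl
    both-zero (Fin.suc i) (Fin.suc j) = refl

  inv-fill : inv F ≡ crossSum lt a a ℤ.+ crossSum lt b b
                     ℤ.+ + lookup (content a) Fin.zero ℤ.* + lookup (content b) Fin.zero
  inv-fill = begin
    length (Inv F) ⊖ ℕ.sum (List.map arm (Des F))
      ≡⟨ ℤ.m-n≡m⊖n (length (Inv F)) (ℕ.sum (List.map arm (Des F))) ⟨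
    + length (Inv F) ℤ.- + ℕ.sum (List.map arm (Des F))
      ≡⟨ cong₂ ℤ._-_ (trans (length-Inv F) invSum-fill) sum-arm-Des ⟩
    arms ℤ.+ (crossSum lt a a ℤ.+ crossSum lt b b ℤ.+ mixed) ℤ.- arms
      ≡⟨ cancel arms _ ⟩
    crossSum lt a a ℤ.+ crossSum lt b b ℤ.+ mixed
      ≡⟨ cong (λ z → crossSum lt a a ℤ.+ crossSum lt b b ℤ.+ z) mixed≡ ⟩
    crossSum lt a a ℤ.+ crossSum lt b b ℤ.+ + lookup (content a) Fin.zero ℤ.* + lookup (content b) Fin.zero  ∎
    where
    open ≡-Reasoning
    arms = crossSum (λ _ _ → + p) a a
    cancel : ∀ x y → x ℤ.+ y ℤ.- x ≡ y
    cancel = ℤ.solve-∀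

-- The degree of a filling

below-content : ∀ (i : Fin n) (w : Vec (Fin n) m) → + below i (content w) ≡ ∑[ j ∈ Vec.toList w ] gt i j
below-content i [] = cong +_ (below-replicate i)
  where
  below-replicate : ∀ {n} (i : Fin n) → below i (Vec.replicate n 0) ≡ 0
  below-replicate Fin.zero    = refl
  below-replicate (Fin.suc i) = below-replicate i
below-content i (j ∷ w) = trans (below-step i j (content w)) (cong (λ z → gt i j ℤ.+ z) (below-content i w))
  where
  below-step : ∀ {n} (i j : Fin n) α → + below i (updateAt α j suc) ≡ gt i j ℤ.+ + below i α
  below-step Fin.zero    Fin.zero    (x ∷ α) = refl
  below-step Fin.zero    (Fin.suc j) (x ∷ α) = refl
  below-step (Fin.suc i) Fin.zero    (x ∷ α) = refl
  below-step (Fin.suc i) (Fin.suc j) (x ∷ α) = begin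
    + (x ℕ.+ below i (updateAt α j suc))          ≡⟨ ℤ.pos-+ x _ ⟩
    + x ℤ.+ + below i (updateAt α j suc)          ≡⟨ cong (λ z → + x ℤ.+ z) (below-step i j α) ⟩
    + x ℤ.+ (gt i j ℤ.+ + below i α)              ≡⟨ regroup (+ x) (gt i j) (+ below i α) ⟩
    gt i j ℤ.+ (+ x ℤ.+ + below i α)              ≡⟨ cong (λ z → gt i j ℤ.+ z) (ℤ.pos-+ x (below i α)) ⟨
    gt i j ℤ.+ + (x ℕ.+ below i α)                ∎
    where
    open ≡-Reasoning
    regroup : ∀ x y z → x ℤ.+ (y ℤ.+ z) ≡ y ℤ.+ (x ℤ.+ z)
    regroup = ℤ.solve-∀

trichotomy : ∀ (i : Fin n) (w : Vec (Fin n) m) →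
  ∑ (Vec.toList w) (lt i) ℤ.+ + below i (content w) ℤ.+ + lookup (content w) i ≡ + m
trichotomy {m = m} i w = begin
  ∑ ws (lt i) ℤ.+ + below i (content w) ℤ.+ + lookup (content w) i
    ≡⟨ cong₂ (λ x y → ∑ ws (lt i) ℤ.+ x ℤ.+ y) (below-content i w) (lookup-content w i) ⟩
  ∑ ws (lt i) ℤ.+ ∑ ws (gt i) ℤ.+ ∑ ws (λ j → ⟦ j Fin.≟ i ⟧)
    ≡⟨ cong (ℤ._+ ∑ ws (λ j → ⟦ j Fin.≟ i ⟧)) (ℤΣ.sum-+ ws (lt i) (gt i)) ⟨
  ∑ ws (λ j → lt i j ℤ.+ gt i j) ℤ.+ ∑ ws (λ j → ⟦ j Fin.≟ i ⟧)
    ≡⟨ ℤΣ.sum-+ ws (λ j → lt i j ℤ.+ gt i j) (λ j → ⟦ j Fin.≟ i ⟧) ⟨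
  ∑ ws (λ j → lt i j ℤ.+ gt i j ℤ.+ ⟦ j Fin.≟ i ⟧)
    ≡⟨ ℤΣ.sum-cong ws (exactly-one i) ⟩
  ∑ ws (const 1ℤ)
    ≡⟨ sum-const-1 w ⟩
  + m  ∎
  where
  open ≡-Reasoning
  ws = Vec.toList w
  exactly-one : ∀ {n} (i j : Fin n) → lt i j ℤ.+ gt i j ℤ.+ ⟦ j Fin.≟ i ⟧ ≡ 1ℤ
  exactly-one Fin.zero    Fin.zero    = refl
  exactly-one Fin.zero    (Fin.suc j) = refl
  exactly-one (Fin.suc i) Fin.zero    = refl
  exactly-one (Fin.suc i) (Fin.suc j) = exactly-one i j

dot-updateAt : ∀ (i : Fin n) α → dot (updateAt α i suc) (updateAt α i suc) ≡ dot α α ℕ.+ (2 ℕ.* lookup α i ℕ.+ 1)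
dot-updateAt Fin.zero    (x ∷ α) = regroup x (dot α α)
  where
  regroup : ∀ x y → suc x ℕ.* suc x ℕ.+ y ≡ x ℕ.* x ℕ.+ y ℕ.+ (2 ℕ.* x ℕ.+ 1)
  regroup = ℕ.solve-∀
dot-updateAt (Fin.suc i) (x ∷ α) = trans (cong (x ℕ.* x ℕ.+_) (dot-updateAt i α)) (sym (ℕ.+-assoc (x ℕ.* x) _ _))

-- Of the m² ordered pairs of positions, Σ α_i² carry equal letters. The others come in pairs, one
-- for each two positions with distinct letters, which form either an inversion or a pair counted by
-- `crossSum lt`.
square-length : ∀ (w : Vec (Fin n) m) →
  + m ℤ.* + m ≡ + 2 ℤ.* crossSum lt w w ℤ.+ + 2 ℤ.* + inversions w ℤ.+ + dot (content w) (content w)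
square-length {n} [] = cong +_ (sym (dot-replicate n))
  where
  dot-replicate : ∀ n → dot (Vec.replicate n 0) (Vec.replicate n 0) ≡ 0
  dot-replicate zero    = refl
  dot-replicate (suc n) = dot-replicate n
square-length {m = suc m} (i ∷ w) = begin
  (1ℤ ℤ.+ + m) ℤ.* (1ℤ ℤ.+ + m)
    ≡⟨ square (+ m) ⟩
  + m ℤ.* + m ℤ.+ (+ 2 ℤ.* + m ℤ.+ 1ℤ)
    ≡⟨ cong₂ (λ x y → x ℤ.+ (+ 2 ℤ.* y ℤ.+ 1ℤ)) (square-length w) (sym (trichotomy i w)) ⟩
  (+ 2 ℤ.* crossSum lt w w ℤ.+ + 2 ℤ.* + inversions w ℤ.+ + dot α α)
    ℤ.+ (+ 2 ℤ.* (∑ (Vec.toList w) (lt i) ℤ.+ + below i α ℤ.+ + lookup α i) ℤ.+ 1ℤ)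
    ≡⟨ regroup (crossSum lt w w) (+ inversions w) (+ dot α α) (∑ (Vec.toList w) (lt i)) (+ below i α) (+ lookup α i) ⟩
  + 2 ℤ.* (∑ (Vec.toList w) (lt i) ℤ.+ crossSum lt w w) ℤ.+ + 2 ℤ.* (+ below i α ℤ.+ + inversions w)
    ℤ.+ (+ dot α α ℤ.+ (+ 2 ℤ.* + lookup α i ℤ.+ 1ℤ))
    ≡⟨ cong₂ (λ x y → + 2 ℤ.* (∑ (Vec.toList w) (lt i) ℤ.+ crossSum lt w w) ℤ.+ + 2 ℤ.* x ℤ.+ y)
         (ℤ.pos-+ (below i α) (inversions w))
         (trans (cong +_ (dot-updateAt i α)) (trans (ℤ.pos-+ (dot α α) _) (cong (λ z → + dot α α ℤ.+ z)
           (trans (ℤ.pos-+ (2 ℕ.* lookup α i) 1) (cong (ℤ._+ 1ℤ) (ℤ.pos-* 2 (lookup α i))))))) ⟨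
  + 2 ℤ.* (∑ (Vec.toList w) (lt i) ℤ.+ crossSum lt w w) ℤ.+ + 2 ℤ.* + (below i α ℕ.+ inversions w)
    ℤ.+ + dot (updateAt α i suc) (updateAt α i suc)  ∎
  where
  open ≡-Reasoning
  α = content w
  square : ∀ x → (1ℤ ℤ.+ x) ℤ.* (1ℤ ℤ.+ x) ≡ x ℤ.* x ℤ.+ (+ 2 ℤ.* x ℤ.+ 1ℤ)
  square = ℤ.solve-∀
  regroup : ∀ c v d s b l → (+ 2 ℤ.* c ℤ.+ + 2 ℤ.* v ℤ.+ d) ℤ.+ (+ 2 ℤ.* (s ℤ.+ b ℤ.+ l) ℤ.+ 1ℤ) ≡
            + 2 ℤ.* (s ℤ.+ c) ℤ.+ + 2 ℤ.* (b ℤ.+ v) ℤ.+ (d ℤ.+ (+ 2 ℤ.* l ℤ.+ 1ℤ))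
  regroup = ℤ.solve-∀

normSq-diff : ∀ (v w : Vec ℕ n) → normSq (diff v w) ℤ.+ + 2 ℤ.* + dot v w ≡ + dot v v ℤ.+ + dot w w
normSq-diff []      []      = refl
normSq-diff (x ∷ v) (y ∷ w) = begin
  (+ y ℤ.- + x) ℤ.* (+ y ℤ.- + x) ℤ.+ normSq (diff v w) ℤ.+ + 2 ℤ.* + (x ℕ.* y ℕ.+ dot v w)
    ≡⟨ cong (λ z → (+ y ℤ.- + x) ℤ.* (+ y ℤ.- + x) ℤ.+ normSq (diff v w) ℤ.+ + 2 ℤ.* z) (pos-dot x y (dot v w)) ⟩
  (+ y ℤ.- + x) ℤ.* (+ y ℤ.- + x) ℤ.+ normSq (diff v w) ℤ.+ + 2 ℤ.* (+ x ℤ.* + y ℤ.+ + dot v w)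
    ≡⟨ regroup (+ x) (+ y) (normSq (diff v w)) (+ dot v w) ⟩
  + x ℤ.* + x ℤ.+ + y ℤ.* + y ℤ.+ (normSq (diff v w) ℤ.+ + 2 ℤ.* + dot v w)
    ≡⟨ cong (λ z → + x ℤ.* + x ℤ.+ + y ℤ.* + y ℤ.+ z) (normSq-diff v w) ⟩
  + x ℤ.* + x ℤ.+ + y ℤ.* + y ℤ.+ (+ dot v v ℤ.+ + dot w w)
    ≡⟨ regroup′ (+ x ℤ.* + x) (+ y ℤ.* + y) (+ dot v v) (+ dot w w) ⟩
  (+ x ℤ.* + x ℤ.+ + dot v v) ℤ.+ (+ y ℤ.* + y ℤ.+ + dot w w)
    ≡⟨ cong₂ ℤ._+_ (pos-dot x x (dot v v)) (pos-dot y y (dot w w)) ⟨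
  + (x ℕ.* x ℕ.+ dot v v) ℤ.+ + (y ℕ.* y ℕ.+ dot w w)  ∎
  where
  open ≡-Reasoning
  pos-dot : ∀ x y z → + (x ℕ.* y ℕ.+ z) ≡ + x ℤ.* + y ℤ.+ + z
  pos-dot x y z = trans (ℤ.pos-+ (x ℕ.* y) z) (cong (ℤ._+ + z) (ℤ.pos-* x y))
  regroup : ∀ x y s d → (y ℤ.- x) ℤ.* (y ℤ.- x) ℤ.+ s ℤ.+ + 2 ℤ.* (x ℤ.* y ℤ.+ d) ≡
            x ℤ.* x ℤ.+ y ℤ.* y ℤ.+ (s ℤ.+ + 2 ℤ.* d)
  regroup = ℤ.solve-∀
  regroup′ : ∀ a b c d → a ℤ.+ b ℤ.+ (c ℤ.+ d) ≡ (a ℤ.+ c) ℤ.+ (b ℤ.+ d)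
  regroup′ = ℤ.solve-∀

-- After doubling, one k² goes to each word and `square-length` removes the non-inversions. The
-- remaining Σ α_i² + Σ β_i² is ‖β-α‖² + 2 Σ α_i β_i, and the term α_1 β_1 of `inv` takes the letter
-- 1 out of the last sum.
degree-fill : ∀ {k p} (a b : Vec (Fin (2 ℕ.+ p)) k) → + (k ℕ.^ 2) ℤ.- inv (fill a b) ≡ + degree a b
degree-fill {k} a b = ℤ.*-cancelˡ-≡ (+ 2) _ _ (begin
  + 2 ℤ.* (+ (k ℕ.^ 2) ℤ.- inv (fill a b))
    ≡⟨ cong₂ (λ x y → + 2 ℤ.* (x ℤ.- y)) (trans (cong (λ z → + (k ℕ.* z)) (ℕ.*-identityʳ k)) (ℤ.pos-* k k)) (inv-fill a b) ⟩
  + 2 ℤ.* (+ k ℤ.* + k ℤ.- (crossSum lt a a ℤ.+ crossSum lt b b ℤ.+ α₀ ℤ.* β₀))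
    ≡⟨ regroup (+ k ℤ.* + k) (crossSum lt a a) (crossSum lt b b) (α₀ ℤ.* β₀) ⟩
  (+ k ℤ.* + k ℤ.- + 2 ℤ.* crossSum lt a a) ℤ.+ (+ k ℤ.* + k ℤ.- + 2 ℤ.* crossSum lt b b) ℤ.- + 2 ℤ.* (α₀ ℤ.* β₀)
    ≡⟨ cong₂ (λ x y → (x ℤ.- + 2 ℤ.* crossSum lt a a) ℤ.+ (y ℤ.- + 2 ℤ.* crossSum lt b b) ℤ.- + 2 ℤ.* (α₀ ℤ.* β₀))
         (square-length a) (square-length b) ⟩
  (+ 2 ℤ.* crossSum lt a a ℤ.+ + 2 ℤ.* + inversions a ℤ.+ + dot α α ℤ.- + 2 ℤ.* crossSum lt a a) ℤ.+
    (+ 2 ℤ.* crossSum lt b b ℤ.+ + 2 ℤ.* + inversions b ℤ.+ + dot β β ℤ.- + 2 ℤ.* crossSum lt b b) ℤ.- + 2 ℤ.* (α₀ ℤ.* β₀)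
    ≡⟨ cancel (crossSum lt a a) (crossSum lt b b) (+ inversions a) (+ inversions b) (+ dot α α) (+ dot β β) (α₀ ℤ.* β₀) ⟩
  (+ dot α α ℤ.+ + dot β β) ℤ.- + 2 ℤ.* (α₀ ℤ.* β₀) ℤ.+ + 2 ℤ.* (+ inversions a ℤ.+ + inversions b)
    ≡⟨ cong (λ z → z ℤ.- + 2 ℤ.* (α₀ ℤ.* β₀) ℤ.+ + 2 ℤ.* (+ inversions a ℤ.+ + inversions b)) (normSq-diff α β) ⟨
  normSq (weight a b) ℤ.+ + 2 ℤ.* + dot α β ℤ.- + 2 ℤ.* (α₀ ℤ.* β₀) ℤ.+ + 2 ℤ.* (+ inversions a ℤ.+ + inversions b)
    ≡⟨ cong₂ (λ x y → x ℤ.+ + 2 ℤ.* y ℤ.- + 2 ℤ.* (α₀ ℤ.* β₀) ℤ.+ + 2 ℤ.* (+ inversions a ℤ.+ + inversions b))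
         (trans (normSq≡ (weight a b) (∣weight∣ a b)) (ℤ.pos-* 2 (halfNorm (weight a b)))) (dot-head α β) ⟩
  + 2 ℤ.* + halfNorm (weight a b) ℤ.+ + 2 ℤ.* (α₀ ℤ.* β₀ ℤ.+ + dot (Vec.tail α) (Vec.tail β)) ℤ.- + 2 ℤ.* (α₀ ℤ.* β₀)
    ℤ.+ + 2 ℤ.* (+ inversions a ℤ.+ + inversions b)
    ≡⟨ collect (+ halfNorm (weight a b)) (α₀ ℤ.* β₀) (+ dot (Vec.tail α) (Vec.tail β)) (+ inversions a) (+ inversions b) ⟩
  + 2 ℤ.* (+ halfNorm (weight a b) ℤ.+ (+ dot (Vec.tail α) (Vec.tail β) ℤ.+ (+ inversions a ℤ.+ + inversions b)))
    ≡⟨ cong (+ 2 ℤ.*_) (trans (ℤ.pos-+ (halfNorm (weight a b)) _) (cong (λ z → + halfNorm (weight a b) ℤ.+ z)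
         (trans (ℤ.pos-+ (dot (Vec.tail α) (Vec.tail β)) _)
           (cong (λ z → + dot (Vec.tail α) (Vec.tail β) ℤ.+ z) (ℤ.pos-+ (inversions a) (inversions b)))))) ⟨
  + 2 ℤ.* + degree a b  ∎)
  where
  open ≡-Reasoning
  α = content a
  β = content b
  α₀ = + lookup α Fin.zero
  β₀ = + lookup β Fin.zero
  dot-head : ∀ {n} (v w : Vec ℕ (suc n)) →
    + dot v w ≡ + lookup v Fin.zero ℤ.* + lookup w Fin.zero ℤ.+ + dot (Vec.tail v) (Vec.tail w)
  dot-head (x ∷ v) (y ∷ w) = trans (ℤ.pos-+ (x ℕ.* y) (dot v w)) (cong (ℤ._+ + dot v w) (ℤ.pos-* x y))
  regroup : ∀ s x y z → + 2 ℤ.* (s ℤ.- (x ℤ.+ y ℤ.+ z)) ≡ (s ℤ.- + 2 ℤ.* x) ℤ.+ (s ℤ.- + 2 ℤ.* y) ℤ.- + 2 ℤ.* z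
  regroup = ℤ.solve-∀
  cancel : ∀ x y i j c d z →
    (+ 2 ℤ.* x ℤ.+ + 2 ℤ.* i ℤ.+ c ℤ.- + 2 ℤ.* x) ℤ.+ (+ 2 ℤ.* y ℤ.+ + 2 ℤ.* j ℤ.+ d ℤ.- + 2 ℤ.* y) ℤ.- + 2 ℤ.* z ≡
    (c ℤ.+ d) ℤ.- + 2 ℤ.* z ℤ.+ + 2 ℤ.* (i ℤ.+ j)
  cancel = ℤ.solve-∀
  collect : ∀ h z t i j → + 2 ℤ.* h ℤ.+ + 2 ℤ.* (z ℤ.+ t) ℤ.- + 2 ℤ.* z ℤ.+ + 2 ℤ.* (i ℤ.+ j) ≡
            + 2 ℤ.* (h ℤ.+ (t ℤ.+ (i ℤ.+ j)))
  collect = ℤ.solve-∀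

-- Telescoping

monoℤ : ∀ {p} → ℤ → Exponent (2 ℕ.+ p) → (a b : Vec (Fin (2 ℕ.+ p)) k) → ℤ
monoℤ d γ a b = ⟦ (d ℤ.≟ + degree a b) ×-dec (γ ≟ᴱ weight a b) ⟧

fullSum : ∀ p → ℕ → LaurentSeries (2 ℕ.+ p)
fullSum p k d γ = ∑[ a ∈ words (2 ℕ.+ p) k ] ∑[ b ∈ words (2 ℕ.+ p) k ] monoℤ d γ a b

term-fill : ∀ {p} (a b : Vec (Fin (2 ℕ.+ p)) k) d γ → term (2 ℕ.+ p) k (fill a b) d γ ≡ monoℤ d γ a b
term-fill {k} a b d γ = ℤΣ.[]-⇔
  ((d ℤ.≟ + (k ℕ.^ 2) ℤ.- inv (fill a b)) ×-dec (γ ≟ᴱ x̄^F (fill a b)))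
  ((d ℤ.≟ + degree a b) ×-dec (γ ≟ᴱ weight a b))
  (λ (d≡ , γ≡) → trans d≡ (degree-fill a b) , trans γ≡ (x̄-fill a b))
  (λ (d≡ , γ≡) → trans d≡ (sym (degree-fill a b)) , trans γ≡ (sym (x̄-fill a b)))

isZero : Vec (Fin (suc n)) k → ℤ
isZero []      = 0ℤ
isZero (i ∷ w) = ⟦ i Fin.≟ Fin.zero ⟧

module _ {n : ℕ} {μ : Partition} (F : Filling n μ) where

  -- The part of `In𝒞` beyond column strictness. Separated so that the sum over column strict
  -- fillings can be turned into a sum over words first.
  FirstOrNotLast : Set
  FirstOrNotLast = OneInFirstColumn F ⊎ ¬ OneInLastColumn F

  firstOrNotLast? : Dec FirstOrNotLast
  firstOrNotLast? =
    any-cell? (λ u → (col u ℕ.≟ 0) ×-dec (toℕ (F ⟨ u ⟩) ℕ.≟ 0))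
    ⊎-dec ¬? (any-cell? (λ u → (suc (col u) ℕ.≟ width μ) ×-dec (toℕ (F ⟨ u ⟩) ℕ.≟ 0)))

module _ {k p : ℕ} (i j : Fin (2 ℕ.+ p)) (a b : Vec (Fin (2 ℕ.+ p)) k) where

  private
    F = fill (i ∷ a) (j ∷ b)

  oneInFirst⇒ : OneInFirstColumn F → i ≢ Fin.zero
  oneInFirst⇒ (u , col≡0 , F≡0) refl with fillView (i ∷ a) (j ∷ b) u
  ... | long r c _ col-u F-u with refl ← Fin.toℕ-injective {i = c} {Fin.zero} (trans (sym col-u) col≡0) =
    Fin.punchInᵢ≢i Fin.zero r (trans (sym F-u) (Fin.toℕ-injective F≡0))
  ... | short c _ col-u _ = short≢long {p = p} c Fin.zero col-u col≡0

  ⇒oneInFirst : i ≢ Fin.zero → OneInFirstColumn F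
  ⇒oneInFirst i≢0 = cell Fin.zero Fin.zero , refl , cong toℕ (punchIn-0 i i≢0)
    where
    punchIn-0 : ∀ {m} (i : Fin (2 ℕ.+ m)) → i ≢ Fin.zero → punchIn i Fin.zero ≡ Fin.zero
    punchIn-0 Fin.zero    i≢0 = contradiction refl i≢0
    punchIn-0 (Fin.suc i) _   = refl

  oneInLast⇒ : OneInLastColumn F → j ≡ Fin.zero
  oneInLast⇒ (u , col≡ , F≡0) with fillView (i ∷ a) (j ∷ b) u
  ... | long r c _ col-u _ = contradiction col-u
    (short≢long {p = p} Fin.zero c (trans (cong suc (ℕ.+-identityʳ _)) col≡))
  ... | short c _ col-u F-u with refl ← Fin.toℕ-injective {i = c} {Fin.zero}
      (ℕ.+-cancelˡ-≡ (suc (col u)) (toℕ c) 0 (trans col-u (trans (sym col≡) (cong suc (sym (ℕ.+-identityʳ _)))))) =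
    trans (sym F-u) (Fin.toℕ-injective F≡0)

  ⇒oneInLast : j ≡ Fin.zero → OneInLastColumn F
  ⇒oneInLast refl with shortCell {suc k} {p} Fin.zero
  ... | u , _ , col-u , value = u , trans (cong suc (sym (ℕ.+-identityʳ _))) col-u , cong toℕ (value (i ∷ a) (j ∷ b))

  firstOrNotLast-complement : ⟦ firstOrNotLast? F ⟧ ℤ.+ isZero (i ∷ a) ℤ.* isZero (j ∷ b) ≡ 1ℤ
  firstOrNotLast-complement with i Fin.≟ Fin.zero | j Fin.≟ Fin.zero
  ... | yes i≡0 | yes j≡0 = cong (ℤ._+ 1ℤ) (ℤΣ.[]-no (firstOrNotLast? F) λ
    { (inj₁ first) → oneInFirst⇒ first i≡0 ; (inj₂ ¬last) → ¬last (⇒oneInLast j≡0) })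
  ... | yes i≡0 | no  j≢0 = cong (ℤ._+ 0ℤ) (ℤΣ.[]-yes (firstOrNotLast? F) (inj₂ (j≢0 ∘ oneInLast⇒)))
  ... | no  i≢0 | _       = cong (ℤ._+ 0ℤ) (ℤΣ.[]-yes (firstOrNotLast? F) (inj₁ (⇒oneInFirst i≢0)))

module _ (p : ℕ) where

  private
    N = 2 ℕ.+ p

  sum-𝒞 : ∀ k d γ → (∑ˢ[ F ∈ 𝒞 N k ] term N k F) d γ ≡
    ∑[ a ∈ words N k ] ∑[ b ∈ words N k ] ⟦ firstOrNotLast? (fill a b) ⟧ ℤ.* monoℤ d γ a b
  sum-𝒞 k d γ = begin
    ∑[ F ∈ 𝒞 N k ] term N k F d γ
      ≡⟨ ℤΣ.sum-filter in𝒞? Fs (λ F → term N k F d γ) ⟩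
    ∑[ F ∈ Fs ] ⟦ in𝒞? F ⟧ ℤ.* term N k F d γ
      ≡⟨ ℤΣ.sum-cong Fs (λ F → trans
           (cong (ℤ._* term N k F d γ) (trans
             (ℤΣ.[]-⇔ (in𝒞? F) (columnStrict? F ×-dec firstOrNotLast? F) id id)
             (ℤΣ.[]-× (columnStrict? F) (firstOrNotLast? F))))
           (ℤ.*-assoc ⟦ columnStrict? F ⟧ ⟦ firstOrNotLast? F ⟧ (term N k F d γ))) ⟩
    ∑[ F ∈ Fs ] ⟦ columnStrict? F ⟧ ℤ.* (⟦ firstOrNotLast? F ⟧ ℤ.* term N k F d γ)
      ≡⟨ ℤΣ.sum-filter columnStrict? Fs (λ F → ⟦ firstOrNotLast? F ⟧ ℤ.* term N k F d γ) ⟨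
    ∑ (filter columnStrict? Fs) (λ F → ⟦ firstOrNotLast? F ⟧ ℤ.* term N k F d γ)
      ≡⟨ sum-columnStrict {k} {p} (λ F → ⟦ firstOrNotLast? F ⟧ ℤ.* term N k F d γ) ⟩
    ∑[ a ∈ words N k ] ∑[ b ∈ words N k ] ⟦ firstOrNotLast? (fill a b) ⟧ ℤ.* term N k (fill a b) d γ
      ≡⟨ ℤΣ.sum-cong (words N k) (λ a → ℤΣ.sum-cong (words N k) λ b →
           cong (⟦ firstOrNotLast? (fill a b) ⟧ ℤ.*_) (term-fill a b d γ)) ⟩
    ∑[ a ∈ words N k ] ∑[ b ∈ words N k ] ⟦ firstOrNotLast? (fill a b) ⟧ ℤ.* monoℤ d γ a b  ∎
    where
    open ≡-Reasoning
    Fs = fillings N (k · θ N)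

  sum-isZero : ∀ k (f : Vec (Fin N) (suc k) → ℤ) →
    ∑[ w ∈ words N (suc k) ] isZero w ℤ.* f w ≡ ∑[ w ∈ words N k ] f (Fin.zero ∷ w)
  sum-isZero k f = begin
    ∑[ w ∈ words N (suc k) ] isZero w ℤ.* f w
      ≡⟨ ℤΣ.sum-cartesianProductWith _∷_ (allFin N) (words N k) (λ w → isZero w ℤ.* f w) ⟩
    ∑[ i ∈ allFin N ] ∑[ w ∈ words N k ] ⟦ i Fin.≟ Fin.zero ⟧ ℤ.* f (i ∷ w)
      ≡⟨ ℤΣ.sum-allFin (suc p) (λ i → ∑[ w ∈ words N k ] ⟦ i Fin.≟ Fin.zero ⟧ ℤ.* f (i ∷ w)) ⟩
    (∑[ w ∈ words N k ] 1ℤ ℤ.* f (Fin.zero ∷ w)) ℤ.+ (∑[ i ∈ allFin (suc p) ] ∑[ w ∈ words N k ] 0ℤ ℤ.* f (Fin.suc i ∷ w))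
      ≡⟨ cong₂ ℤ._+_ (ℤΣ.sum-cong (words N k) λ w → ℤ.*-identityˡ (f (Fin.zero ∷ w)))
           (ℤΣ.sum-0 (allFin (suc p)) λ {i} _ → ℤΣ.sum-0 (words N k) λ {w} _ → ℤ.*-zeroˡ (f (Fin.suc i ∷ w))) ⟩
    (∑[ w ∈ words N k ] f (Fin.zero ∷ w)) ℤ.+ 0ℤ
      ≡⟨ ℤ.+-identityʳ _ ⟩
    ∑[ w ∈ words N k ] f (Fin.zero ∷ w)  ∎
    where open ≡-Reasoning

  weight-zero : ∀ (a b : Vec (Fin N) k) → weight (Fin.zero ∷ a) (Fin.zero ∷ b) ≡ weight a b
  weight-zero a b = diff-suc (content a) (content b)
    where
    diff-suc : ∀ {n} (α β : Vec ℕ (suc n)) → diff (updateAt α Fin.zero suc) (updateAt β Fin.zero suc) ≡ diff α β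
    diff-suc (x ∷ α) (y ∷ β) = cong (_∷ diff α β) (trans (ℤ.m-n≡m⊖n (suc y) (suc x))
      (trans (ℤ.[1+m]⊖[1+n]≡m⊖n y x) (sym (ℤ.m-n≡m⊖n y x))))

  -- The letter 1 is the smallest, so in front of a word it creates no inversion; its multiplicity
  -- is dropped by the tails and cancels in the difference of the contents.
  degree-zero : ∀ (a b : Vec (Fin N) k) → degree (Fin.zero ∷ a) (Fin.zero ∷ b) ≡ degree a b
  degree-zero a b = cong₂ ℕ._+_ (cong halfNorm (weight-zero a b))
    (cong₂ ℕ._+_ (cong₂ dot (tail-zero (content a)) (tail-zero (content b)))
      (cong₂ ℕ._+_ (cong (ℕ._+ inversions a) (below-zero (content a))) (cong (ℕ._+ inversions b) (below-zero (content b)))))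
    where
    tail-zero : ∀ {n} (α : Vec ℕ (suc n)) → Vec.tail (updateAt α Fin.zero suc) ≡ Vec.tail α
    tail-zero (x ∷ α) = refl
    below-zero : ∀ {n} (α : Vec ℕ (suc n)) → below Fin.zero α ≡ 0
    below-zero (x ∷ α) = refl

  -- Pairs of words of length k + 1 that both start with 1 are copies of the pairs of length k; all
  -- other pairs are the fillings in 𝒞ₖ₊₁.
  fullSum-suc : ∀ k d γ → fullSum p k d γ ℤ.+ (∑ˢ[ F ∈ 𝒞 N (suc k) ] term N (suc k) F) d γ ≡ fullSum p (suc k) d γ
  fullSum-suc k d γ = begin
    fullSum p k d γ ℤ.+ (∑ˢ[ F ∈ 𝒞 N (suc k) ] term N (suc k) F) d γ
      ≡⟨ cong₂ ℤ._+_ (sym (ℤΣ.sum-cong (words N k) λ a → ℤΣ.sum-cong (words N k) λ b → mono-zero a b)) (sum-𝒞 (suc k) d γ) ⟩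
    (∑[ a ∈ words N k ] ∑[ b ∈ words N k ] monoℤ d γ (Fin.zero ∷ a) (Fin.zero ∷ b)) ℤ.+ ∑ ws (λ a → ∑ ws (inside a))
      ≡⟨ cong (ℤ._+ ∑ ws (λ a → ∑ ws (inside a))) (sym zeros) ⟩
    ∑ ws (λ a → ∑ ws (outside a)) ℤ.+ ∑ ws (λ a → ∑ ws (inside a))
      ≡⟨ ℤΣ.sum-+ ws (λ a → ∑ ws (outside a)) (λ a → ∑ ws (inside a)) ⟨
    ∑ ws (λ a → ∑ ws (outside a) ℤ.+ ∑ ws (inside a))
      ≡⟨ ℤΣ.sum-cong ws (λ a → trans (sym (ℤΣ.sum-+ ws (outside a) (inside a))) (ℤΣ.sum-cong ws (all a))) ⟩
    fullSum p (suc k) d γ  ∎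
    where
    open ≡-Reasoning
    ws = words N (suc k)
    inside outside : Vec (Fin N) (suc k) → Vec (Fin N) (suc k) → ℤ
    inside  a b = ⟦ firstOrNotLast? (fill a b) ⟧ ℤ.* monoℤ d γ a b
    outside a b = isZero a ℤ.* (isZero b ℤ.* monoℤ d γ a b)

    mono-zero : ∀ (a b : Vec (Fin N) k) → monoℤ d γ (Fin.zero ∷ a) (Fin.zero ∷ b) ≡ monoℤ d γ a b
    mono-zero a b = cong₂ (λ e x → ⟦ (d ℤ.≟ + e) ×-dec (γ ≟ᴱ x) ⟧) (degree-zero a b) (weight-zero a b)

    zeros : ∑ ws (λ a → ∑ ws (outside a)) ≡ ∑[ a ∈ words N k ] ∑[ b ∈ words N k ] monoℤ d γ (Fin.zero ∷ a) (Fin.zero ∷ b)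
    zeros = trans
      (ℤΣ.sum-cong ws λ a → trans (sym (ℤΣ.*-sum (isZero a) ws (λ b → isZero b ℤ.* monoℤ d γ a b)))
        (cong (isZero a ℤ.*_) (sum-isZero k (monoℤ d γ a))))
      (sum-isZero k (λ a → ∑[ b ∈ words N k ] monoℤ d γ a (Fin.zero ∷ b)))

    all : ∀ a b → outside a b ℤ.+ inside a b ≡ monoℤ d γ a b
    all (i ∷ a) (j ∷ b) = begin
      x ℤ.* (y ℤ.* z) ℤ.+ f ℤ.* z      ≡⟨ factor x y z f ⟩
      (f ℤ.+ x ℤ.* y) ℤ.* z            ≡⟨ cong (ℤ._* z) (firstOrNotLast-complement i j a b) ⟩
      1ℤ ℤ.* z                         ≡⟨ ℤ.*-identityˡ z ⟩
      z                                ∎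
      where
      x = isZero (i ∷ a)
      y = isZero (j ∷ b)
      f = ⟦ firstOrNotLast? (fill (i ∷ a) (j ∷ b)) ⟧
      z = monoℤ d γ (i ∷ a) (j ∷ b)
      factor : ∀ x y z f → x ℤ.* (y ℤ.* z) ℤ.+ f ℤ.* z ≡ (f ℤ.+ x ℤ.* y) ℤ.* z
      factor = ℤ.solve-∀

  partialSum : ∀ m d γ → (∑ˢ[ k ∈ upTo (suc m) ] ∑ˢ[ F ∈ 𝒞 N k ] term N k F) d γ ≡ fullSum p m d γ
  -- For k = 0 the width is 0, so no column is the last one and the empty filling satisfies the
  -- second alternative.
  partialSum zero d γ = trans (ℤ.+-identityʳ _) (trans (sum-𝒞 0 d γ) (cong (λ z → z ℤ.+ 0ℤ ℤ.+ 0ℤ) (trans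
    (cong (ℤ._* monoℤ {p = p} d γ [] []) (ℤΣ.[]-yes (firstOrNotLast? (fill {p = p} [] [])) (inj₂ λ { (_ , () , _) })))
    (ℤ.*-identityˡ (monoℤ {p = p} d γ [] [])))))
  partialSum (suc m) d γ = trans
    (ℤΣ.sum-upTo-last (suc m) (λ k → (∑ˢ[ F ∈ 𝒞 N k ] term N k F) d γ))
    (trans (cong (ℤ._+ (∑ˢ[ F ∈ 𝒞 N (suc m) ] term N (suc m) F) d γ) (partialSum m d γ)) (fullSum-suc m d γ))

corollary7 : (n : ℕ) .{{_ : NonTrivial n}} → toLaurent (χΛ₀ n) ≈∑ (λ k → ∑ˢ[ F ∈ 𝒞 n k ] term n k F)
corollary7 zero       = contradiction (ℕ.nonTrivial⇒n>1 0) λ ()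
corollary7 (suc zero) = contradiction (ℕ.nonTrivial⇒n>1 1) λ { (s≤s ()) }
-- One more than `bound`, because the m + 1 terms with k ≤ m add up to the sum over words of length
-- m.
corollary7 (suc (suc p)) (+ e) = suc bound , λ { (suc m) (s≤s m≥) γ → begin
  χΛ₀ (2 ℕ.+ p) e γ
    ≡⟨ χΛ₀≡wordSum p e m γ m≥ ⟩
  wordSum (suc p) m e γ
    ≡⟨ ℤΣ.sum-cong (words (2 ℕ.+ p) m) (λ a → ℤΣ.sum-cong (words (2 ℕ.+ p) m) λ b →
         ℤΣ.[]-⇔ ((e ℕ.≟ degree a b) ×-dec (γ ≟ᴱ weight a b)) ((+ e ℤ.≟ + degree a b) ×-dec (γ ≟ᴱ weight a b))
           (λ (e≡ , γ≡) → cong +_ e≡ , γ≡) (λ (e≡ , γ≡) → ℤ.+-injective e≡ , γ≡)) ⟩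
  fullSum p m (+ e) γ
    ≡⟨ partialSum p m (+ e) γ ⟨
  (∑ˢ[ k ∈ upTo (suc m) ] ∑ˢ[ F ∈ 𝒞 (2 ℕ.+ p) k ] term (2 ℕ.+ p) k F) (+ e) γ  ∎ }
  where
  open ≡-Reasoning
  bound = e ℕ.+ (suc p ℕ.* e ℕ.+ 2 ℕ.* e)
-- Degrees are natural numbers, so no pair of words contributes to a negative power. K = 1 ensures
-- that `partialSum` applies.
corollary7 (suc (suc p)) -[1+ e ] = 1 , λ { (suc m) _ γ → sym (trans (partialSum p m -[1+ e ] γ)
  (ℤΣ.sum-0 (words (2 ℕ.+ p) m) λ {a} _ → ℤΣ.sum-0 (words (2 ℕ.+ p) m) λ {b} _ →
    ℤΣ.[]-no ((-[1+ e ] ℤ.≟ + degree a b) ×-dec (γ ≟ᴱ weight a b)) λ { (() , _) })) }
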